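{- Let $q$ be a prime power and let $\mathcal{A}$ be a central hyperplane arrangement in $\mathbb{F}_q^3$. (1) If $\chi(\mathcal{A},q)=0$, then $\mathcal{A}$ is free with exponents $(1, q, |\mathcal{A}|-q-1)$. (2) If $|\mathcal{A}|\geq 2q$ and $\mathcal{A}$ is free, then $\chi(\mathcal{A},q)=0$.
   Context: A central hyperplane arrangement $\mathcal{A}$ in $V=\mathbb{F}_q^3$ is a finite set of 2-dimensional linear subspaces. Characteristic polynomial: with $L(\mathcal{A})$ the set of intersections of subsets of $\mathcal{A}$ (including $V$) ordered by reverse inclusion, and Möbius function $\mu(V)=1$, $\mu(X)=-\sum_{Y<X}\mu(Y)$, set $\chi(\mathcal{A},t)=\sum_{X\in L(\mathcal{A})}\mu(X)t^{\dim X}$. Freeness: let $S=\mathbb{F}_q[x_1,x_2,x_3]$, fix for each $H$ a nonzero linear form $\alpha_H$ vanishing on $H$, and let $D(\mathcal{A})=\{\delta=\sum_i f_i\partial/\partial x_i,\ f_i\in S : \delta(\alpha_H)\in\alpha_HS\ \forall H\in\mathcal{A}\}$. $\mathcal{A}$ is free if $D(\mathcal{A})$ is a free $S$-module; its exponents are then the multiset of polynomial degrees of a homogeneous basis (the Euler field $\sum x_i\partial/\partial x_i$ has degree 1). -}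

module Defs where

open import Level using (Level; _⊔_) renaming (suc to lsuc)
open import Algebra.Bundles using (CommutativeRing)
open import Data.Bool using (Bool; true; false; _∧_; _∨_; not; if_then_else_)
open import Data.Nat as ℕ using (ℕ; zero; suc)
open import Data.Nat.Primality using (Prime)
open import Data.Integer as ℤ using (ℤ; +_)
open import Data.Fin using (Fin)
import Data.Fin as Fin
open import Data.Product using (Σ; _×_; _,_; proj₁; proj₂)
open import Data.List as List using (List; []; _∷_; _++_; map; concatMap; foldr; length; zip)
open import Data.List.Relation.Unary.All using (All)
open import Data.List.Relation.Unary.Any using (Any)
open import Data.List.Relation.Unary.AllPairs using (AllPairs)
open import Relation.Nullary using (¬_; does)
open import Relation.Binary using (Decidable)
open import Relation.Binary.PropositionalEquality using (_≡_)
open import Function.Bundles using (_⇔_)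

IsPrimePower : ℕ → Set
IsPrimePower q = Σ ℕ λ p → Σ ℕ λ k → Prime p × q ≡ p ℕ.^ suc k

record FiniteField (c ℓ : Level) (q : ℕ) : Set (lsuc (c ⊔ ℓ)) where
  field
    commRing : CommutativeRing c ℓ
  open CommutativeRing commRing public
  field
    1≉0      : ¬ (1# ≈ 0#)
    inverse  : ∀ x → ¬ (x ≈ 0#) → Σ Carrier λ y → x * y ≈ 1#
    _≟_      : Decidable _≈_
    elems    : List Carrier
    complete : ∀ x → Any (x ≈_) elems
    distinct : AllPairs (λ x y → ¬ (x ≈ y)) elems
    size     : length elems ≡ q

tuples : ∀ {a} {A : Set a} → List A → ℕ → List (List A)
tuples xs zero    = [] ∷ []
tuples xs (suc k) = concatMap (λ x → map (x ∷_) (tuples xs k)) xs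

masks : ℕ → List (List Bool)
masks zero    = [] ∷ []
masks (suc n) = concatMap (λ b → map (b ∷_) (masks n)) (true ∷ false ∷ [])

select : ∀ {a} {A : Set a} → List Bool → List A → List A
select (true  ∷ m) (x ∷ xs) = x ∷ select m xs
select (false ∷ m) (x ∷ xs) = select m xs
select _ _ = []

allB : ∀ {a} {A : Set a} → (A → Bool) → List A → Bool
allB p = foldr (λ x acc → p x ∧ acc) true

anyB : ∀ {a} {A : Set a} → (A → Bool) → List A → Bool
anyB p = foldr (λ x acc → p x ∨ acc) false

filterB : ∀ {a} {A : Set a} → (A → Bool) → List A → List A
filterB p = foldr (λ x acc → if p x then x ∷ acc else acc) []

sumℤ : List ℤ → ℤ
sumℤ = foldr ℤ._+_ (+ 0)

module _ {c ℓ : Level} {q : ℕ} (𝔽 : FiniteField c ℓ q) where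
  open FiniteField 𝔽

  eqb : Carrier → Carrier → Bool
  eqb x y = does (x ≟ y)

  isZero : Carrier → Bool
  isZero x = eqb x 0#

  -- vectors of V = F_q^3 (also used for linear forms a₁x₁+a₂x₂+a₃x₃)
  V3 : Set c
  V3 = Carrier × Carrier × Carrier

  dot : V3 → V3 → Carrier
  dot (a₁ , a₂ , a₃) (v₁ , v₂ , v₃) = a₁ * v₁ + a₂ * v₂ + a₃ * v₃

  zeroVecB : V3 → Bool
  zeroVecB (v₁ , v₂ , v₃) = isZero v₁ ∧ isZero v₂ ∧ isZero v₃

  points : List V3
  points = concatMap (λ a → concatMap (λ b → map (λ d → a , b , d) elems) elems) elems

  -- Central arrangements in V: a hyperplane H is given by a nonzero linear
  -- form α_H with H = ker α_H; an arrangement is a list of such forms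
  -- defining pairwise distinct hyperplanes (so |A| = length of the list).

  NonzeroForm : V3 → Set ℓ
  NonzeroForm (a₁ , a₂ , a₃) = ¬ ((a₁ ≈ 0#) × (a₂ ≈ 0#) × (a₃ ≈ 0#))

  DistinctHyperplanes : V3 → V3 → Set (c ⊔ ℓ)
  DistinctHyperplanes α β = ¬ (∀ v → (dot α v ≈ 0#) ⇔ (dot β v ≈ 0#))

  IsArrangement : List V3 → Set (c ⊔ ℓ)
  IsArrangement A = All NonzeroForm A × AllPairs DistinctHyperplanes A

  inX : List V3 → V3 → Bool
  inX B v = allB (λ α → isZero (dot α v)) B

  subsetB : List V3 → List V3 → Bool
  subsetB B C = allB (inX C) (filterB (λ v → inX B v) points)

  containedInB : List V3 → V3 → Bool
  containedInB C α = subsetB C (α ∷ [])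

  -- Each X ∈ L(A) is represented exactly once by its "flat" : the sublist
  -- of all H ∈ A with X ⊆ H  (a sublist selected by mask m is closed iff
  -- for every H ∈ A:  H selected  ⇔  X ⊆ H).
  closedMask : List V3 → List Bool → Bool
  closedMask A m = allB (λ p → eqbB (proj₁ p) (containedInB (select m A) (proj₂ p))) (zip m A)
    where
      eqbB : Bool → Bool → Bool
      eqbB true  b = b
      eqbB false b = not b

  flats : List V3 → List (List V3)
  flats A = map (λ m → select m A) (filterB (λ m → closedMask A m) (masks (length A)))

  isV : List V3 → Bool
  isV X = subsetB [] X

  -- Y < X in L(A) (reverse inclusion):  X ⊊ Y
  ltB : List V3 → List V3 → Bool
  ltB Y X = subsetB X Y ∧ not (subsetB Y X)

  -- Möbius function: μ(V) = 1, μ(X) = - Σ_{Y<X} μ(Y).  Recursion on a fuel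
  -- parameter; since chains in L(A) ⊆ subspaces of F_q^3 have at most 4
  -- elements, fuel 4 computes the true value for every X ∈ L(A).
  mobiusF : List V3 → ℕ → List V3 → ℤ
  mobiusF A zero    X = + 0
  mobiusF A (suc k) X =
    if isV X then + 1
    else ℤ.- sumℤ (map (mobiusF A k) (filterB (λ Y → ltB Y X) (flats A)))

  mobius : List V3 → List V3 → ℤ
  mobius A X = mobiusF A 4 X

  lincomb : List Carrier → List V3 → V3
  lincomb (a ∷ as) ((v₁ , v₂ , v₃) ∷ vs) with lincomb as vs
  ... | (w₁ , w₂ , w₃) = a * v₁ + w₁ , a * v₂ + w₂ , a * v₃ + w₃
  lincomb _ _ = 0# , 0# , 0#

  independentB : List V3 → Bool
  independentB vs = allB (λ as → not (zeroVecB (lincomb as vs)) ∨ allB isZero as)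
                        (tuples elems (length vs))

  hasIndependentB : List V3 → ℕ → Bool
  hasIndependentB X d = anyB independentB (tuples (filterB (λ v → inX X v) points) d)

  dim : List V3 → ℕ
  dim X = if hasIndependentB X 3 then 3
          else if hasIndependentB X 2 then 2
          else if hasIndependentB X 1 then 1 else 0

  chi : List V3 → ℕ → ℤ
  chi A t = sumℤ (map (λ X → mobius A X ℤ.* (+ (t ℕ.^ dim X))) (flats A))

  -- The polynomial ring S = F_q[x₁,x₂,x₃]: a polynomial is a finite list
  -- of terms (coefficient, exponent vector); two polynomials are equal iff
  -- all their coefficients agree.

  Mono : Set
  Mono = ℕ × ℕ × ℕ

  deg : Mono → ℕ
  deg (i , j , k) = i ℕ.+ j ℕ.+ k

  Poly : Set c
  Poly = List (Carrier × Mono)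

  monoEqB : Mono → Mono → Bool
  monoEqB (i , j , k) (i' , j' , k') = does (i ℕ.≟ i') ∧ does (j ℕ.≟ j') ∧ does (k ℕ.≟ k')

  coeff : Poly → Mono → Carrier
  coeff p m = foldr (λ t acc → if monoEqB (proj₂ t) m then proj₁ t + acc else acc) 0# p

  _≈P_ : Poly → Poly → Set ℓ
  p ≈P r = ∀ m → coeff p m ≈ coeff r m

  0P : Poly
  0P = []

  _+P_ : Poly → Poly → Poly
  p +P r = p ++ r

  _*P_ : Poly → Poly → Poly
  p *P r = concatMap (λ t → map (λ u → proj₁ t * proj₁ u , addM (proj₂ t) (proj₂ u)) r) p
    where
      addM : Mono → Mono → Mono
      addM (i , j , k) (i' , j' , k') = i ℕ.+ i' , j ℕ.+ j' , k ℕ.+ k'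

  constP : Carrier → Poly
  constP a = (a , 0 , 0 , 0) ∷ []

  linP : V3 → Poly
  linP (a₁ , a₂ , a₃) = (a₁ , 1 , 0 , 0) ∷ (a₂ , 0 , 1 , 0) ∷ (a₃ , 0 , 0 , 1) ∷ []

  HomogeneousOfDeg : Poly → ℕ → Set ℓ
  HomogeneousOfDeg p d = ∀ m → ¬ (coeff p m ≈ 0#) → deg m ≡ d

  -- Derivations δ = f₁∂₁ + f₂∂₂ + f₃∂₃  (f₁,f₂,f₃ ∈ S)

  Der : Set c
  Der = Poly × Poly × Poly

  _≈D_ : Der → Der → Set ℓ
  (f₁ , f₂ , f₃) ≈D (g₁ , g₂ , g₃) = (f₁ ≈P g₁) × (f₂ ≈P g₂) × (f₃ ≈P g₃)

  0D : Der
  0D = 0P , 0P , 0P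

  _+D_ : Der → Der → Der
  (f₁ , f₂ , f₃) +D (g₁ , g₂ , g₃) = f₁ +P g₁ , f₂ +P g₂ , f₃ +P g₃

  _·D_ : Poly → Der → Der
  g ·D (f₁ , f₂ , f₃) = g *P f₁ , g *P f₂ , g *P f₃

  sumD : (k : ℕ) → (Fin k → Der) → Der
  sumD zero    θ = 0D
  sumD (suc k) θ = θ Fin.zero +D sumD k (λ j → θ (Fin.suc j))

  applyD : Der → V3 → Poly
  applyD (f₁ , f₂ , f₃) (a₁ , a₂ , a₃) = (constP a₁ *P f₁) +P ((constP a₂ *P f₂) +P (constP a₃ *P f₃))

  InD : List V3 → Der → Set (c ⊔ ℓ)
  InD A δ = All (λ α → Σ Poly λ g → applyD δ α ≈P (linP α *P g)) A

  HomogeneousDer : Der → ℕ → Set ℓ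
  HomogeneousDer (f₁ , f₂ , f₃) d = HomogeneousOfDeg f₁ d × HomogeneousOfDeg f₂ d × HomogeneousOfDeg f₃ d

  IsBasis : List V3 → (k : ℕ) → (Fin k → Der) → Set (c ⊔ ℓ)
  IsBasis A k θ =
      (∀ j → InD A (θ j))
    × (∀ δ → InD A δ → Σ (Fin k → Poly) λ g → δ ≈D sumD k (λ j → g j ·D θ j))
    × (∀ (g : Fin k → Poly) → sumD k (λ j → g j ·D θ j) ≈D 0D → ∀ j → g j ≈P 0P)

  -- A is free: D(A) is a free S-module (has a basis; any basis of a
  -- submodule of S³ is finite)
  Free : List V3 → Set (c ⊔ ℓ)
  Free A = Σ ℕ λ k → Σ (Fin k → Der) λ θ → IsBasis A k θ

  FreeWithExponents : List V3 → ℕ → ℕ → ℕ → Set (c ⊔ ℓ)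
  FreeWithExponents A d₁ d₂ d₃ =
    Σ (Fin 3 → Der) λ θ → IsBasis A 3 θ
      × HomogeneousDer (θ Fin.zero) d₁
      × HomogeneousDer (θ (Fin.suc Fin.zero)) d₂
      × HomogeneousDer (θ (Fin.suc (Fin.suc Fin.zero))) d₃

{-# OPTIONS --safe #-}

-- By Crapo–Rota, χ(A, q) counts the points of V outside A, so χ(A, q) = 0 says that A
-- covers V.  Besides the Euler field x = (x₁, x₂, x₃), every D(A) contains
-- x^q = (x₁^q, x₂^q, x₃^q).
--
-- (1) The polynomials vanishing on all of V form the ideal of the 2×2 minors of x and
-- x^q.  If A covers V, its defining polynomial Q lies there, so Q = det(x, x^q, θ) for
-- some θ.  Reducing modulo each linear form shows θ ∈ D(A), and Saito's criterion applies.
--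
-- (2) Suppose p is a point outside A.  Since Q S³ ⊆ D(A) and Q does not vanish on the line
-- spanned by p, the coordinates of a field in a basis of D(A) are determined on that line
-- by the values of the field there.  On the line x^q equals t^(q−1) x, where t is the
-- parameter, so the coordinates of x^q have no constant term: x^q = Σ xᵢ ηᵢ with
-- ηᵢ ∈ D(A).  Now Q divides det(x, x^q, ηᵢ), which vanishes on the line, so the quotient
-- has no constant term and the determinant has no terms of degree ≤ |A|.  For |A| ≥ 2q
-- this contradicts x^q = Σ xᵢ ηᵢ by a comparison of coefficients.
module Submission where

open import Defs
open import Level using (Level; _⊔_)
open import Algebra.Bundles using (CommutativeRing)
import Algebra.Properties.AbelianGroup
import Algebra.Properties.CommutativeSemiring.Binomial
import Algebra.Properties.CommutativeSemiring.Exp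
import Algebra.Properties.Ring
import Algebra.Properties.Semiring.Mult
import Algebra.Properties.Semiring.Mult.TCOptimised
import Algebra.Properties.Semiring.Sum
import Algebra.Solver.Ring
open import Algebra.Solver.Ring.AlmostCommutativeRing using (fromCommutativeRing; _-Raw-AlmostCommutative⟶_)
open import Data.Bool using (Bool; true; false; T; _∨_; not; if_then_else_)
open import Data.Empty using (⊥; ⊥-elim)
open import Data.Fin as Fin using (Fin; toℕ; inject₁; fromℕ)
import Data.Fin.Properties as Finₚ
open import Data.Integer as ℤ using (ℤ; +_; -[1+_])
import Data.Integer.Properties as ℤₚ
import Data.Integer.Tactic.RingSolver as ℤ-Solver
open import Data.List using (List; []; _∷_; _++_; map; foldr; length; tabulate; replicate; concatMap; zip; zipWith)
import Data.List.Properties as Listₚ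
open import Data.List.Membership.Propositional using (find) renaming (_∈_ to _∈ₗ_)
import Data.List.Relation.Binary.Permutation.Homogeneous as Homogeneous
import Data.List.Relation.Binary.Permutation.Setoid
import Data.List.Relation.Binary.Permutation.Setoid.Properties
open import Data.List.Relation.Binary.Pointwise using (Pointwise; []; _∷_)
open import Data.List.Relation.Unary.All as All using (All; []; _∷_)
import Data.List.Relation.Unary.All.Properties as Allₚ
open import Data.List.Relation.Unary.AllPairs as AllPairs using (AllPairs; []; _∷_)
import Data.List.Relation.Unary.AllPairs.Properties as AllPairsₚ
open import Data.List.Relation.Unary.Any as Any using (Any; here; there; _─_)
import Data.List.Relation.Unary.Any.Properties as Anyₚ
open import Data.Maybe using (Maybe; just; nothing)
open import Data.Nat as ℕ using (ℕ; zero; suc; _≤_; _<_; z≤n; s≤s)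
open import Data.Nat.Combinatorics using (_C_; nCn≡1)
import Data.Nat.Properties as ℕₚ
import Data.Nat.Tactic.RingSolver as ℕ-Solver
open import Data.Product using (Σ; _×_; _,_; proj₁; proj₂)
open import Data.Sum using (_⊎_; inj₁; inj₂)
open import Data.Unit using (⊤; tt)
open import Function.Bundles using (mk⇔)
open import Relation.Binary using (IsEquivalence; Setoid)
open import Relation.Binary.PropositionalEquality as ≡ using (_≡_; _≢_; cong)
import Relation.Binary.Reasoning.Setoid
open import Relation.Nullary using (¬_; Dec; yes; no; does)
open import Relation.Nullary.Decidable using (dec-true; dec-false)

-- Polynomials are unnormalised term lists, equal when all coefficients agree, so neither degrees
-- nor unique factorisation come for free. Three substitutes carry the algebra: well-definedness is
-- proved once for all linear functionals of the coefficients; a linear form α is shown to be prime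
-- by a substitution that retracts S onto a copy of S/(α); and nonzero factors are cancelled by
-- looking at a strictly heaviest term. Finiteness of the field enters through x^q = x and root
-- counting: a polynomial in one variable with at most q coefficients that vanishes on F_q is zero.
-- This gives the additivity of f ↦ f^q, hence α(x^q) = α^q, which is why x^q lies in D(A); it also
-- shows that a combination of normal monomials vanishing on V is zero. In (2) the given basis may
-- have any length and need not be homogeneous, so there are no exponents to compare. Only constant
-- terms of coordinates are used, and these can be read off on a line through the origin. The bound
-- 2q is the degree of the two monomials x₁^(q-1) x₂ x₃^q and x₁^(2q-1) x₃ at which coefficients are
-- compared.

module IntegerSolver {c ℓ} (R : CommutativeRing c ℓ) where
  open CommutativeRing R
  open Algebra.Properties.Ring ring using (-‿distribˡ-*; -‿distribʳ-*; -0#≈0#; -‿involutive)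
  open Algebra.Properties.AbelianGroup +-abelianGroup using (⁻¹-∙-comm)
  open Algebra.Properties.Semiring.Mult.TCOptimised semiring using (×-homo-+; ×1-homo-*) renaming (_×_ to _⊗_)
  open Relation.Binary.Reasoning.Setoid setoid

  -- The canonical ring map ℤ → R. With integer coefficients the solver can compare and cancel
  -- numerals by computation, with no test of equality in `R`.
  ⟦_⟧ℤ : ℤ → Carrier
  ⟦ + n ⟧ℤ      = n ⊗ 1#
  ⟦ -[1+ n ] ⟧ℤ = - (suc n ⊗ 1#)

  ⊖-homo : ∀ m n → ⟦ m ℤ.⊖ n ⟧ℤ ≈ m ⊗ 1# + - (n ⊗ 1#)
  ⊖-homo zero    zero    = sym (-‿inverseʳ 0#)
  ⊖-homo zero    (suc n) = sym (+-identityˡ _)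
  ⊖-homo (suc m) zero    = sym (trans (+-congˡ -0#≈0#) (+-identityʳ _))
  ⊖-homo (suc m) (suc n) = begin
    ⟦ suc m ℤ.⊖ suc n ⟧ℤ                ≡⟨ cong ⟦_⟧ℤ (ℤₚ.[1+m]⊖[1+n]≡m⊖n m n) ⟩
    ⟦ m ℤ.⊖ n ⟧ℤ                        ≈⟨ ⊖-homo m n ⟩
    m ⊗ 1# + - (n ⊗ 1#)                 ≈⟨ +-congˡ (sym (+-identityˡ _)) ⟩
    m ⊗ 1# + (0# + - (n ⊗ 1#))          ≈⟨ +-congˡ (+-congʳ (sym (-‿inverseʳ 1#))) ⟩
    m ⊗ 1# + ((1# + - 1#) + - (n ⊗ 1#)) ≈⟨ +-congˡ (+-assoc _ _ _) ⟩
    m ⊗ 1# + (1# + (- 1# + - (n ⊗ 1#))) ≈⟨ sym (+-assoc _ _ _) ⟩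
    (m ⊗ 1# + 1#) + (- 1# + - (n ⊗ 1#)) ≈⟨ +-cong (trans (+-comm _ _) (sym (×-homo-+ 1# 1 m))) (trans (⁻¹-∙-comm _ _) (-‿cong (sym (×-homo-+ 1# 1 n)))) ⟩
    suc m ⊗ 1# + - (suc n ⊗ 1#)         ∎

  +ℤ-homo : ∀ i j → ⟦ i ℤ.+ j ⟧ℤ ≈ ⟦ i ⟧ℤ + ⟦ j ⟧ℤ
  +ℤ-homo (+ m)    (+ n)    = ×-homo-+ 1# m n
  +ℤ-homo (+ m)    -[1+ n ] = ⊖-homo m (suc n)
  +ℤ-homo -[1+ m ] (+ n)    = trans (⊖-homo n (suc m)) (+-comm _ _)
  +ℤ-homo -[1+ m ] -[1+ n ] = begin
    - (suc (suc (m ℕ.+ n)) ⊗ 1#)         ≡⟨ cong (λ k → - (k ⊗ 1#)) (≡.sym (ℕₚ.+-suc (suc m) n)) ⟩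
    - ((suc m ℕ.+ suc n) ⊗ 1#)           ≈⟨ -‿cong (×-homo-+ 1# (suc m) (suc n)) ⟩
    - (suc m ⊗ 1# + suc n ⊗ 1#)          ≈⟨ sym (⁻¹-∙-comm _ _) ⟩
    - (suc m ⊗ 1#) + - (suc n ⊗ 1#)      ∎

  -ℤ-homo : ∀ i → ⟦ ℤ.- i ⟧ℤ ≈ - ⟦ i ⟧ℤ
  -ℤ-homo (+ zero)  = sym -0#≈0#
  -ℤ-homo (+ suc n) = refl
  -ℤ-homo -[1+ n ]  = sym (-‿involutive _)

  +*ℤ-homo : ∀ m j → ⟦ + m ℤ.* j ⟧ℤ ≈ ⟦ + m ⟧ℤ * ⟦ j ⟧ℤ
  +*ℤ-homo m (+ n) = trans (reflexive (cong ⟦_⟧ℤ (≡.sym (ℤₚ.pos-* m n)))) (×1-homo-* m n)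
  +*ℤ-homo m -[1+ n ] = begin
    ⟦ + m ℤ.* ℤ.- (+ suc n) ⟧ℤ   ≡⟨ cong ⟦_⟧ℤ (≡.sym (ℤₚ.neg-distribʳ-* (+ m) (+ suc n))) ⟩
    ⟦ ℤ.- (+ m ℤ.* + suc n) ⟧ℤ   ≈⟨ -ℤ-homo (+ m ℤ.* + suc n) ⟩
    - ⟦ + m ℤ.* + suc n ⟧ℤ       ≈⟨ -‿cong (+*ℤ-homo m (+ suc n)) ⟩
    - (m ⊗ 1# * suc n ⊗ 1#)      ≈⟨ -‿distribʳ-* _ _ ⟩
    m ⊗ 1# * - (suc n ⊗ 1#)      ∎

  *ℤ-homo : ∀ i j → ⟦ i ℤ.* j ⟧ℤ ≈ ⟦ i ⟧ℤ * ⟦ j ⟧ℤ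
  *ℤ-homo (+ m)    j = +*ℤ-homo m j
  *ℤ-homo -[1+ m ] j = begin
    ⟦ ℤ.- (+ suc m) ℤ.* j ⟧ℤ     ≡⟨ cong ⟦_⟧ℤ (≡.sym (ℤₚ.neg-distribˡ-* (+ suc m) j)) ⟩
    ⟦ ℤ.- (+ suc m ℤ.* j) ⟧ℤ     ≈⟨ -ℤ-homo (+ suc m ℤ.* j) ⟩
    - ⟦ + suc m ℤ.* j ⟧ℤ         ≈⟨ -‿cong (+*ℤ-homo (suc m) j) ⟩
    - (suc m ⊗ 1# * ⟦ j ⟧ℤ)      ≈⟨ -‿distribˡ-* _ _ ⟩
    - (suc m ⊗ 1#) * ⟦ j ⟧ℤ      ∎

  ℤ-morphism : ℤ.+-*-rawRing -Raw-AlmostCommutative⟶ fromCommutativeRing R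
  ℤ-morphism = record
    { ⟦_⟧ = ⟦_⟧ℤ ; +-homo = +ℤ-homo ; *-homo = *ℤ-homo ; -‿homo = -ℤ-homo ; 0-homo = refl ; 1-homo = refl }

  ℤ-dec : ∀ i j → Maybe (⟦ i ⟧ℤ ≈ ⟦ j ⟧ℤ)
  ℤ-dec i j with i ℤₚ.≟ j
  ... | yes i≡j = just (reflexive (cong ⟦_⟧ℤ i≡j))
  ... | no _    = nothing

  open Algebra.Solver.Ring ℤ.+-*-rawRing (fromCommutativeRing R) ℤ-morphism ℤ-dec public
    using (solve; _:=_; _:+_; _:*_; _:-_; :-_; con)
    renaming (Polynomial to Expression)

  :0 :1 : ∀ {n} → Expression n
  :0 = con (+ 0)
  :1 = con (+ 1)

-- The binomial theorem with its two end terms split off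

module Binomials {c ℓ} (R : CommutativeRing c ℓ) where
  open CommutativeRing R
  open Algebra.Properties.CommutativeSemiring.Binomial commutativeSemiring using (theorem)
  open Algebra.Properties.CommutativeSemiring.Exp commutativeSemiring public using (_^_; ^-congˡ; ^-homo-*; ^-distrib-*)
  open Algebra.Properties.Semiring.Mult semiring public using (×-homo-1; ×-congʳ; ×-assoc-*) renaming (_×_ to _⊗_)
  open Algebra.Properties.Semiring.Sum semiring public using (sum; sum-init-last; sum-cong-≋; *-distribˡ-sum)
  open Relation.Binary.Reasoning.Setoid setoid

  middleTerm : ∀ m → Carrier → Carrier → Fin m → Carrier
  middleTerm m x y k = (suc m C suc (toℕ k)) ⊗ (x ^ suc (toℕ k) * y ^ (m ℕ.∸ toℕ k))

  binomial-split : ∀ m x y → (x + y) ^ suc m ≈ y ^ suc m + (sum (middleTerm m x y) + x ^ suc m)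
  binomial-split m x y = trans (theorem (suc m) x y) (+-cong first (trans (sum-init-last {m} upper) (+-cong middle last)))
    where
    upper : Fin (suc m) → Carrier
    upper k = (suc m C suc (toℕ k)) ⊗ (x ^ suc (toℕ k) * y ^ (m ℕ.∸ toℕ k))
    first : 1 ⊗ (1# * y ^ suc m) ≈ y ^ suc m
    first = trans (×-homo-1 _) (*-identityˡ _)
    middle : sum (λ k → upper (inject₁ k)) ≈ sum (middleTerm m x y)
    middle = sum-cong-≋ {m} {λ k → upper (inject₁ k)} {middleTerm m x y}
      (λ k → reflexive (cong (λ i → (suc m C suc i) ⊗ (x ^ suc i * y ^ (m ℕ.∸ i))) (Finₚ.toℕ-inject₁ k)))
    last : (suc m C suc (toℕ (fromℕ m))) ⊗ (x ^ suc (toℕ (fromℕ m)) * y ^ (m ℕ.∸ toℕ (fromℕ m))) ≈ x ^ suc m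
    last = begin
      (suc m C suc (toℕ (fromℕ m))) ⊗ (x ^ suc (toℕ (fromℕ m)) * y ^ (m ℕ.∸ toℕ (fromℕ m)))
        ≡⟨ cong (λ i → (suc m C suc i) ⊗ (x ^ suc i * y ^ (m ℕ.∸ i))) (Finₚ.toℕ-fromℕ m) ⟩
      (suc m C suc m) ⊗ (x ^ suc m * y ^ (m ℕ.∸ m))
        ≡⟨ ≡.cong₂ (λ i j → i ⊗ (x ^ suc m * y ^ j)) (nCn≡1 (suc m)) (ℕₚ.n∸n≡0 m) ⟩
      1 ⊗ (x ^ suc m * 1#) ≈⟨ trans (×-homo-1 _) (*-identityʳ _) ⟩
      x ^ suc m ∎

-- Cross products, determinants and divisibility over a commutative ring

module RingVectors {c ℓ} (R : CommutativeRing c ℓ) where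
  open CommutativeRing R
  open IntegerSolver R

  Vec3 : Set c
  Vec3 = Carrier × Carrier × Carrier

  infix 4 _≈³_ _∣_
  _≈³_ : Vec3 → Vec3 → Set ℓ
  (u₁ , u₂ , u₃) ≈³ (v₁ , v₂ , v₃) = (u₁ ≈ v₁) × (u₂ ≈ v₂) × (u₃ ≈ v₃)

  _∙_ : Vec3 → Vec3 → Carrier
  (u₁ , u₂ , u₃) ∙ (v₁ , v₂ , v₃) = u₁ * v₁ + u₂ * v₂ + u₃ * v₃

  _×³_ : Vec3 → Vec3 → Vec3
  (u₁ , u₂ , u₃) ×³ (v₁ , v₂ , v₃) = u₂ * v₃ - u₃ * v₂ , u₃ * v₁ - u₁ * v₃ , u₁ * v₂ - u₂ * v₁

  det : Vec3 → Vec3 → Vec3 → Carrier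
  det u v w = u ∙ (v ×³ w)

  ∙-cong : ∀ {u u' v v'} → u ≈³ u' → v ≈³ v' → u ∙ v ≈ u' ∙ v'
  ∙-cong (a , b , d) (a' , b' , d') = +-cong (+-cong (*-cong a a') (*-cong b b')) (*-cong d d')

  -‿cong₂ : ∀ {x x' y y'} → x ≈ x' → y ≈ y' → x - y ≈ x' - y'
  -‿cong₂ p r = +-cong p (-‿cong r)

  ×³-cong : ∀ {u u' v v'} → u ≈³ u' → v ≈³ v' → (u ×³ v) ≈³ (u' ×³ v')
  ×³-cong (a , b , d) (a' , b' , d') =
    -‿cong₂ (*-cong b d') (*-cong d b') , -‿cong₂ (*-cong d a') (*-cong a d') , -‿cong₂ (*-cong a b') (*-cong b a')

  det-cong : ∀ {u u' v v' w w'} → u ≈³ u' → v ≈³ v' → w ≈³ w' → det u v w ≈ det u' v' w'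
  det-cong p r s = ∙-cong p (×³-cong r s)

  _∣_ : Carrier → Carrier → Set (c ⊔ ℓ)
  a ∣ b = Σ Carrier λ g → b ≈ a * g

  ∣-resp : ∀ {a b b'} → b ≈ b' → a ∣ b → a ∣ b'
  ∣-resp p (g , e) = g , trans (sym p) e

  ∣-+ : ∀ {a b b'} → a ∣ b → a ∣ b' → a ∣ (b + b')
  ∣-+ (g , e) (g' , e') = g + g' , trans (+-cong e e') (sym (distribˡ _ _ _))

  ∣-*ʳ : ∀ {a b} d → a ∣ b → a ∣ (b * d)
  ∣-*ʳ d (g , e) = g * d , trans (*-congʳ e) (*-assoc _ _ _)

  ∣-*ˡ : ∀ {a b} d → a ∣ b → a ∣ (d * b)
  ∣-*ˡ d p = ∣-resp (*-comm _ _) (∣-*ʳ d p)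

  ∣-self : ∀ {a} d → a ∣ (a * d)
  ∣-self d = d , refl

  *-cancel-unit : ∀ {a b} d → a * b ≈ 1# → (d * a) * b ≈ d
  *-cancel-unit d p = trans (*-assoc _ _ _) (trans (*-congˡ p) (*-identityʳ _))

  private
    Triple : ℕ → Set
    Triple n = Expression n × Expression n × Expression n

    _:∙_ : ∀ {n} → Triple n → Triple n → Expression n
    (u₁ , u₂ , u₃) :∙ (v₁ , v₂ , v₃) = u₁ :* v₁ :+ u₂ :* v₂ :+ u₃ :* v₃

    _:×_ : ∀ {n} → Triple n → Triple n → Triple n
    (u₁ , u₂ , u₃) :× (v₁ , v₂ , v₃) = u₂ :* v₃ :- u₃ :* v₂ , u₃ :* v₁ :- u₁ :* v₃ , u₁ :* v₂ :- u₂ :* v₁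

    :det : ∀ {n} → Triple n → Triple n → Triple n → Expression n
    :det u v w = u :∙ (v :× w)

  -- Cofactor identity: det(u,v,w) α = (α∙u) v×w + (α∙v) w×u + (α∙w) u×v, one coordinate in each of
  -- the three lemmas. It is read in both directions: divisibility of the three pairings passes to
  -- the determinant, and divisibility of the determinant and two pairings passes to the third term.
  det-adjoint₁ : ∀ α u v w → det u v w * proj₁ α ≈
    (α ∙ u) * proj₁ (v ×³ w) + (α ∙ v) * proj₁ (w ×³ u) + (α ∙ w) * proj₁ (u ×³ v)
  det-adjoint₁ (a , b , d) (u₁ , u₂ , u₃) (v₁ , v₂ , v₃) (w₁ , w₂ , w₃) =
    solve 12 (λ a b d u₁ u₂ u₃ v₁ v₂ v₃ w₁ w₂ w₃ →
      let α = a , b , d ; u = u₁ , u₂ , u₃ ; v = v₁ , v₂ , v₃ ; w = w₁ , w₂ , w₃ in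
      :det u v w :* a := (α :∙ u) :* proj₁ (v :× w) :+ (α :∙ v) :* proj₁ (w :× u) :+ (α :∙ w) :* proj₁ (u :× v))
      refl a b d u₁ u₂ u₃ v₁ v₂ v₃ w₁ w₂ w₃

  det-adjoint₂ : ∀ α u v w → det u v w * proj₁ (proj₂ α) ≈
    (α ∙ u) * proj₁ (proj₂ (v ×³ w)) + (α ∙ v) * proj₁ (proj₂ (w ×³ u)) + (α ∙ w) * proj₁ (proj₂ (u ×³ v))
  det-adjoint₂ (a , b , d) (u₁ , u₂ , u₃) (v₁ , v₂ , v₃) (w₁ , w₂ , w₃) =
    solve 12 (λ a b d u₁ u₂ u₃ v₁ v₂ v₃ w₁ w₂ w₃ →
      let α = a , b , d ; u = u₁ , u₂ , u₃ ; v = v₁ , v₂ , v₃ ; w = w₁ , w₂ , w₃ in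
      :det u v w :* b := (α :∙ u) :* proj₁ (proj₂ (v :× w)) :+ (α :∙ v) :* proj₁ (proj₂ (w :× u)) :+ (α :∙ w) :* proj₁ (proj₂ (u :× v)))
      refl a b d u₁ u₂ u₃ v₁ v₂ v₃ w₁ w₂ w₃

  det-adjoint₃ : ∀ α u v w → det u v w * proj₂ (proj₂ α) ≈
    (α ∙ u) * proj₂ (proj₂ (v ×³ w)) + (α ∙ v) * proj₂ (proj₂ (w ×³ u)) + (α ∙ w) * proj₂ (proj₂ (u ×³ v))
  det-adjoint₃ (a , b , d) (u₁ , u₂ , u₃) (v₁ , v₂ , v₃) (w₁ , w₂ , w₃) =
    solve 12 (λ a b d u₁ u₂ u₃ v₁ v₂ v₃ w₁ w₂ w₃ →
      let α = a , b , d ; u = u₁ , u₂ , u₃ ; v = v₁ , v₂ , v₃ ; w = w₁ , w₂ , w₃ in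
      :det u v w :* d := (α :∙ u) :* proj₂ (proj₂ (v :× w)) :+ (α :∙ v) :* proj₂ (proj₂ (w :× u)) :+ (α :∙ w) :* proj₂ (proj₂ (u :× v)))
      refl a b d u₁ u₂ u₃ v₁ v₂ v₃ w₁ w₂ w₃

  scale : Carrier → Vec3 → Vec3
  scale r (u₁ , u₂ , u₃) = r * u₁ , r * u₂ , r * u₃

  _+³_ : Vec3 → Vec3 → Vec3
  (u₁ , u₂ , u₃) +³ (v₁ , v₂ , v₃) = u₁ + v₁ , u₂ + v₂ , u₃ + v₃

  0³ : Vec3
  0³ = 0# , 0# , 0#

  -- Cramer's rule before division by det(u,v,w); the division is possible later because a common
  -- factor of all four determinants can be cancelled.
  cramer : ∀ d u v w → scale (det u v w) d ≈³
    (scale (det d v w) u +³ (scale (det u d w) v +³ scale (det u v d) w))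
  cramer (d₁ , d₂ , d₃) (u₁ , u₂ , u₃) (v₁ , v₂ , v₃) (w₁ , w₂ , w₃) =
      solve 12 (λ d₁ d₂ d₃ u₁ u₂ u₃ v₁ v₂ v₃ w₁ w₂ w₃ →
        let d = d₁ , d₂ , d₃ ; u = u₁ , u₂ , u₃ ; v = v₁ , v₂ , v₃ ; w = w₁ , w₂ , w₃ in
        :det u v w :* d₁ := :det d v w :* u₁ :+ (:det u d w :* v₁ :+ :det u v d :* w₁))
        refl d₁ d₂ d₃ u₁ u₂ u₃ v₁ v₂ v₃ w₁ w₂ w₃
    , solve 12 (λ d₁ d₂ d₃ u₁ u₂ u₃ v₁ v₂ v₃ w₁ w₂ w₃ →
        let d = d₁ , d₂ , d₃ ; u = u₁ , u₂ , u₃ ; v = v₁ , v₂ , v₃ ; w = w₁ , w₂ , w₃ in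
        :det u v w :* d₂ := :det d v w :* u₂ :+ (:det u d w :* v₂ :+ :det u v d :* w₂))
        refl d₁ d₂ d₃ u₁ u₂ u₃ v₁ v₂ v₃ w₁ w₂ w₃
    , solve 12 (λ d₁ d₂ d₃ u₁ u₂ u₃ v₁ v₂ v₃ w₁ w₂ w₃ →
        let d = d₁ , d₂ , d₃ ; u = u₁ , u₂ , u₃ ; v = v₁ , v₂ , v₃ ; w = w₁ , w₂ , w₃ in
        :det u v w :* d₃ := :det d v w :* u₃ :+ (:det u d w :* v₃ :+ :det u v d :* w₃))
        refl d₁ d₂ d₃ u₁ u₂ u₃ v₁ v₂ v₃ w₁ w₂ w₃

  det-rotate : ∀ u v w → det u v w ≈ det v w u
  det-rotate (u₁ , u₂ , u₃) (v₁ , v₂ , v₃) (w₁ , w₂ , w₃) =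
    solve 9 (λ u₁ u₂ u₃ v₁ v₂ v₃ w₁ w₂ w₃ →
      let u = u₁ , u₂ , u₃ ; v = v₁ , v₂ , v₃ ; w = w₁ , w₂ , w₃ in :det u v w := :det v w u)
      refl u₁ u₂ u₃ v₁ v₂ v₃ w₁ w₂ w₃

  det-combination : ∀ f g h u v w → det (scale f u +³ (scale g v +³ scale h w)) v w ≈ f * det u v w
  det-combination f g h (u₁ , u₂ , u₃) (v₁ , v₂ , v₃) (w₁ , w₂ , w₃) =
    solve 12 (λ f g h u₁ u₂ u₃ v₁ v₂ v₃ w₁ w₂ w₃ →
      let u = u₁ , u₂ , u₃ ; v = v₁ , v₂ , v₃ ; w = w₁ , w₂ , w₃ in
      :det (f :* u₁ :+ (g :* v₁ :+ h :* w₁) , f :* u₂ :+ (g :* v₂ :+ h :* w₂) , f :* u₃ :+ (g :* v₃ :+ h :* w₃)) v w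
        := f :* :det u v w)
      refl f g h u₁ u₂ u₃ v₁ v₂ v₃ w₁ w₂ w₃

  det-parallel : ∀ r s p w → det (scale r p) (scale s p) w ≈ 0#
  det-parallel r s (p₁ , p₂ , p₃) (w₁ , w₂ , w₃) =
    solve 8 (λ r s p₁ p₂ p₃ w₁ w₂ w₃ →
      :det (r :* p₁ , r :* p₂ , r :* p₃) (s :* p₁ , s :* p₂ , s :* p₃) (w₁ , w₂ , w₃) := :0)
      refl r s p₁ p₂ p₃ w₁ w₂ w₃

-- Pigeonhole arguments for duplicate-free lists

module DistinctLists {a ℓ} (S : Setoid a ℓ) where
  open Setoid S renaming (Carrier to A)
  open Data.List.Relation.Binary.Permutation.Setoid S
    using (_↭_; ↭-refl; ↭-trans; ↭-prep; ↭-swap)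
  open Data.List.Relation.Binary.Permutation.Setoid.Properties S using (xs↭ys⇒|xs|≡|ys|)

  Distinct : List A → Set _
  Distinct = AllPairs (λ x y → ¬ (x ≈ y))

  _∈_ : A → List A → Set _
  x ∈ xs = Any (x ≈_) xs

  ∈-extract : ∀ {x ys} (p : x ∈ ys) → ys ↭ x ∷ (ys ─ p)
  ∈-extract {ys = y ∷ ys} (here x≈y) = Homogeneous.prep (sym x≈y) ↭-refl
  ∈-extract {x} {y ∷ ys} (there p)   = ↭-trans (↭-prep y (∈-extract p)) (↭-swap y x ↭-refl)

  ∈-─ : ∀ {x y ys} (p : x ∈ ys) → ¬ (x ≈ y) → y ∈ ys → y ∈ (ys ─ p)
  ∈-─ (here x≈z) x≉y (here y≈z) = ⊥-elim (x≉y (trans x≈z (sym y≈z)))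
  ∈-─ (here x≈z) x≉y (there r)  = r
  ∈-─ (there p)  x≉y (here y≈z) = here y≈z
  ∈-─ (there p)  x≉y (there r)  = there (∈-─ p x≉y r)

  -- Each element of `xs` is removed from `ys` in turn; distinctness keeps the remaining elements
  -- available. The leftover `zs` yields the length bound, and being empty under equal lengths it
  -- turns an inclusion into a permutation.
  complement : ∀ {xs ys} → Distinct xs → All (_∈ ys) xs → Σ (List A) λ zs → ys ↭ xs ++ zs
  complement {[]}     {ys} [] [] = ys , ↭-refl
  complement {x ∷ xs} {ys} (x∉xs ∷ dxs) (x∈ys ∷ xs⊆ys)
    with complement dxs (All.zipWith (λ { (x≉y , y∈ys) → ∈-─ x∈ys x≉y y∈ys }) (x∉xs , xs⊆ys))
  ... | zs , perm = zs , ↭-trans (∈-extract x∈ys) (↭-prep x perm)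

  length-mono : ∀ {xs ys} → Distinct xs → All (_∈ ys) xs → length xs ≤ length ys
  length-mono {xs} {ys} d i with complement d i
  ... | zs , perm = ≡.subst (length xs ≤_)
          (≡.trans (≡.sym (Listₚ.length-++ xs)) (≡.sym (xs↭ys⇒|xs|≡|ys| perm))) (ℕₚ.m≤m+n (length xs) (length zs))

  permutation : ∀ {xs ys} → Distinct xs → All (_∈ ys) xs → length ys ≤ length xs → ys ↭ xs
  permutation {xs} {ys} d i le with complement d i
  ... | [] , perm     = ≡.subst (ys ↭_) (Listₚ.++-identityʳ xs) perm
  ... | z ∷ zs , perm = ⊥-elim (ℕₚ.<⇒≱ (≡.subst (suc (length xs) ≤_)
          (≡.trans (≡.trans (≡.sym (ℕₚ.+-suc (length xs) (length zs))) (≡.sym (Listₚ.length-++ xs))) (≡.sym (xs↭ys⇒|xs|≡|ys| perm)))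
          (s≤s (ℕₚ.m≤m+n (length xs) (length zs)))) le)

-- One-variable polynomials over a finite field: root counting, x^q = x, vanishing binomials

module FieldPolynomials {c ℓ} {q : ℕ} (𝔽 : FiniteField c ℓ q) where
  open FiniteField 𝔽
  open IntegerSolver commRing
  open Binomials commRing
  open Algebra.Properties.Ring ring using (x∙y⁻¹≈ε⇒x≈y)
  open Relation.Binary.Reasoning.Setoid setoid
  open DistinctLists setoid
  open import Data.List.Relation.Binary.Permutation.Setoid setoid using (_↭_)
  open import Data.List.Relation.Binary.Permutation.Setoid.Properties setoid
    using (foldr-commMonoid; ∈-resp-↭; AllPairs-resp-↭; xs↭ys⇒|xs|≡|ys|)

  *-cancelˡ-0 : ∀ {x y} → ¬ (x ≈ 0#) → x * y ≈ 0# → y ≈ 0#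
  *-cancelˡ-0 {x} {y} x≉0 xy≈0 with inverse x x≉0
  ... | x⁻¹ , xx⁻¹≈1 = begin
    y              ≈⟨ *-identityˡ y ⟨
    1# * y         ≈⟨ *-congʳ (trans (*-comm _ _) xx⁻¹≈1) ⟨
    (x⁻¹ * x) * y  ≈⟨ *-assoc _ _ _ ⟩
    x⁻¹ * (x * y)  ≈⟨ *-congˡ xy≈0 ⟩
    x⁻¹ * 0#       ≈⟨ zeroʳ _ ⟩
    0#             ∎

  *-≉0 : ∀ {x y} → ¬ (x ≈ 0#) → ¬ (y ≈ 0#) → ¬ (x * y ≈ 0#)
  *-≉0 x≉0 y≉0 xy≈0 = y≉0 (*-cancelˡ-0 x≉0 xy≈0)

  ^-≉0 : ∀ {x} n → ¬ (x ≈ 0#) → ¬ (x ^ n ≈ 0#)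
  ^-≉0 zero    x≉0 = 1≉0
  ^-≉0 (suc n) x≉0 = *-≉0 x≉0 (^-≉0 n x≉0)

  horner : List Carrier → Carrier → Carrier
  horner cs x = foldr (λ d acc → d + x * acc) 0# cs

  -- Synthetic division: the coefficients of (f(x) - f(r)) / (x - r) are the intermediate values of
  -- Horner's scheme at r.
  quot : Carrier → List Carrier → List Carrier
  quot r []           = []
  quot r (d ∷ [])     = []
  quot r (d ∷ e ∷ cs) = horner (e ∷ cs) r ∷ quot r (e ∷ cs)

  quot-length : ∀ r d cs → length (quot r (d ∷ cs)) ≡ length cs
  quot-length r d []       = ≡.refl
  quot-length r d (e ∷ cs) = cong suc (quot-length r e cs)

  quot-spec : ∀ r x cs → horner cs x ≈ horner cs r + (x - r) * horner (quot r cs) x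
  quot-spec r x [] = solve 2 (λ r x → :0 := :0 :+ (x :- r) :* :0) refl r x
  quot-spec r x (d ∷ []) =
    solve 3 (λ r x d → d :+ x :* :0 := (d :+ r :* :0) :+ (x :- r) :* :0) refl r x d
  quot-spec r x (d ∷ e ∷ cs) = trans (+-congˡ (*-congˡ (quot-spec r x (e ∷ cs))))
    (solve 5 (λ r x d h k → d :+ x :* (h :+ (x :- r) :* k) := (d :+ r :* h) :+ (x :- r) :* (h :+ x :* k))
      refl r x d (horner (e ∷ cs) r) (horner (quot r (e ∷ cs)) x))

  quot-zero : ∀ r cs → All (_≈ 0#) (quot r cs) → horner cs r ≈ 0# → All (_≈ 0#) cs
  quot-zero r []           _        _ = []
  quot-zero r (d ∷ [])     _        p = trans (sym (trans (+-congˡ (zeroʳ r)) (+-identityʳ d))) p ∷ []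
  quot-zero r (d ∷ e ∷ cs) (h ∷ hs) p =
    trans (sym (trans (+-congˡ (trans (*-congˡ h) (zeroʳ r))) (+-identityʳ d))) p ∷ quot-zero r (e ∷ cs) hs h

  -- Division by x - r leaves a quotient with one coefficient fewer, and every other listed root is
  -- a root of it because it differs from r. A zero quotient together with f(r) = 0 forces f = 0.
  few-roots : ∀ rs cs → Distinct rs → length cs ≤ length rs → All (λ r → horner cs r ≈ 0#) rs → All (_≈ 0#) cs
  few-roots rs       []       _        _        _        = []
  few-roots (r ∷ rs) (d ∷ cs) (r∉ ∷ dr) (s≤s le) (z ∷ zs) =
    quot-zero r (d ∷ cs)
      (few-roots rs (quot r (d ∷ cs)) dr (≡.subst (_≤ length rs) (≡.sym (quot-length r d cs)) le)
        (All.zipWith root (r∉ , zs))) z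
    where
    root : ∀ {x} → (¬ (r ≈ x)) × horner (d ∷ cs) x ≈ 0# → horner (quot r (d ∷ cs)) x ≈ 0#
    root {x} (r≉x , hx) = *-cancelˡ-0 (λ e → r≉x (sym (x∙y⁻¹≈ε⇒x≈y _ _ e))) (begin
      (x - r) * horner (quot r (d ∷ cs)) x                       ≈⟨ +-identityˡ _ ⟨
      0# + (x - r) * horner (quot r (d ∷ cs)) x                  ≈⟨ +-congʳ z ⟨
      horner (d ∷ cs) r + (x - r) * horner (quot r (d ∷ cs)) x   ≈⟨ quot-spec r x (d ∷ cs) ⟨
      horner (d ∷ cs) x                                          ≈⟨ hx ⟩
      0#                                                         ∎)

  vanishing-horner : ∀ cs → length cs ≤ q → (∀ x → horner cs x ≈ 0#) → All (_≈ 0#) cs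
  vanishing-horner cs le v = few-roots elems cs distinct (≡.subst (length cs ≤_) (≡.sym size) le) (All.tabulate (λ {x} _ → v x))

  Term : Set c
  Term = Carrier × ℕ

  value : List Term → Carrier → Carrier
  value T x = foldr (λ t acc → proj₁ t * x ^ proj₂ t + acc) 0# T

  coefficient : List Term → ℕ → Carrier
  coefficient T i = foldr (λ t acc → if does (proj₂ t ℕ.≟ i) then proj₁ t + acc else acc) 0# T

  bump : ℕ → Carrier → List Carrier → List Carrier
  bump i       d []       = []
  bump zero    d (e ∷ cs) = d + e ∷ cs
  bump (suc i) d (e ∷ cs) = e ∷ bump i d cs

  nth : List Carrier → ℕ → Carrier
  nth []       i       = 0#
  nth (e ∷ cs) zero    = e
  nth (e ∷ cs) (suc i) = nth cs i

  -- The root bound counts the entries of a coefficient vector, so a term list is spread over a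
  -- vector of fixed length `N`. A term of exponent `N` or more would be lost in `bump`, hence the
  -- bounds on exponents in the lemmas below.
  dense : ℕ → List Term → List Carrier
  dense N T = foldr (λ t cs → bump (proj₂ t) (proj₁ t) cs) (replicate N 0#) T

  bump-length : ∀ i d cs → length (bump i d cs) ≡ length cs
  bump-length i       d []       = ≡.refl
  bump-length zero    d (e ∷ cs) = ≡.refl
  bump-length (suc i) d (e ∷ cs) = cong suc (bump-length i d cs)

  dense-length : ∀ N T → length (dense N T) ≡ N
  dense-length N []            = Listₚ.length-replicate N
  dense-length N ((d , i) ∷ T) = ≡.trans (bump-length i d (dense N T)) (dense-length N T)

  horner-bump : ∀ i d cs x → i ℕ.< length cs → horner (bump i d cs) x ≈ d * x ^ i + horner cs x
  horner-bump zero    d (e ∷ cs) x le = trans (+-assoc _ _ _) (+-congʳ (sym (*-identityʳ d)))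
  horner-bump (suc i) d (e ∷ cs) x (s≤s le) = trans (+-congˡ (*-congˡ (horner-bump i d cs x le)))
    (solve 5 (λ e x d y h → e :+ x :* (d :* y :+ h) := d :* (x :* y) :+ (e :+ x :* h)) refl e x d (x ^ i) (horner cs x))

  horner-replicate : ∀ N x → horner (replicate N 0#) x ≈ 0#
  horner-replicate zero    x = refl
  horner-replicate (suc N) x = trans (+-identityˡ _) (trans (*-congˡ (horner-replicate N x)) (zeroʳ x))

  horner-dense : ∀ N T x → All (λ t → proj₂ t ℕ.< N) T → horner (dense N T) x ≈ value T x
  horner-dense N []            x []       = horner-replicate N x
  horner-dense N ((d , i) ∷ T) x (i< ∷ T<) =
    trans (horner-bump i d (dense N T) x (≡.subst (i ℕ.<_) (≡.sym (dense-length N T)) i<)) (+-congˡ (horner-dense N T x T<))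

  nth-zero : ∀ cs → All (_≈ 0#) cs → ∀ i → nth cs i ≈ 0#
  nth-zero []       []       i       = refl
  nth-zero (e ∷ cs) (z ∷ zs) zero    = z
  nth-zero (e ∷ cs) (z ∷ zs) (suc i) = nth-zero cs zs i

  nth-bump : ∀ i d cs j → i ℕ.< length cs → nth (bump i d cs) j ≈ (if does (i ℕ.≟ j) then d + nth cs j else nth cs j)
  nth-bump zero    d (e ∷ cs) zero    le = refl
  nth-bump zero    d (e ∷ cs) (suc j) le = refl
  nth-bump (suc i) d (e ∷ cs) zero    le = refl
  nth-bump (suc i) d (e ∷ cs) (suc j) (s≤s le) = nth-bump i d cs j le

  nth-replicate : ∀ N i → nth (replicate N 0#) i ≈ 0#
  nth-replicate zero    i       = refl
  nth-replicate (suc N) zero    = refl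
  nth-replicate (suc N) (suc i) = nth-replicate N i

  nth-dense : ∀ N T j → All (λ t → proj₂ t ℕ.< N) T → nth (dense N T) j ≈ coefficient T j
  nth-dense N []            j []        = nth-replicate N j
  nth-dense N ((d , i) ∷ T) j (i< ∷ T<)
    with does (i ℕ.≟ j) | nth-bump i d (dense N T) j (≡.subst (i ℕ.<_) (≡.sym (dense-length N T)) i<)
  ... | true  | e = trans e (+-congˡ (nth-dense N T j T<))
  ... | false | e = trans e (nth-dense N T j T<)

  vanishing-terms : ∀ T → All (λ t → proj₂ t ℕ.< q) T → (∀ x → value T x ≈ 0#) → ∀ i → coefficient T i ≈ 0#
  vanishing-terms T T< v i = trans (sym (nth-dense q T i T<))
    (nth-zero (dense q T) (vanishing-horner (dense q T) (ℕₚ.≤-reflexive (dense-length q T))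
      (λ x → trans (horner-dense q T x T<) (v x))) i)

  product : List Carrier → Carrier
  product = foldr _*_ 1#

  units : Σ (List Carrier) λ us → elems ↭ (0# ∷ us)
  units = complement ([] ∷ []) (complete 0# ∷ [])

  us : List Carrier
  us = proj₁ units

  us-distinct : Distinct (0# ∷ us)
  us-distinct = AllPairs-resp-↭ (λ x≉y y≈x → x≉y (sym y≈x))
    ((λ y≈y' p e → p (trans e (sym y≈y'))) , (λ x≈x' p e → p (trans x≈x' e))) (proj₂ units) distinct

  us-complete : ∀ {x} → ¬ (x ≈ 0#) → x ∈ us
  us-complete {x} x≉0 with ∈-resp-↭ (proj₂ units) (complete x)
  ... | here x≈0 = ⊥-elim (x≉0 x≈0)
  ... | there p  = p

  us-nonzero : All (λ u → ¬ (u ≈ 0#)) us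
  us-nonzero = All.map (λ 0≉u u≈0 → 0≉u (sym u≈0)) (AllPairs.head us-distinct)

  suc-length-us : suc (length us) ≡ q
  suc-length-us = ≡.trans (≡.sym (xs↭ys⇒|xs|≡|ys| (proj₂ units))) size

  product-scale : ∀ x ys → product (map (x *_) ys) ≈ x ^ length ys * product ys
  product-scale x []       = sym (*-identityˡ 1#)
  product-scale x (y ∷ ys) = trans (*-congˡ (product-scale x ys))
    (solve 4 (λ x y u v → (x :* y) :* (u :* v) := (x :* u) :* (y :* v)) refl x y (x ^ length ys) (product ys))

  product-≉0 : ∀ {ys} → All (λ u → ¬ (u ≈ 0#)) ys → ¬ (product ys ≈ 0#)
  product-≉0 []       = 1≉0
  product-≉0 (p ∷ ps) = *-≉0 p (product-≉0 ps)

  scaled-distinct : ∀ {x ys} → ¬ (x ≈ 0#) → Distinct ys → Distinct (map (x *_) ys)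
  scaled-distinct x≉0 [] = []
  scaled-distinct {x} x≉0 (_∷_ {y} p ps) = Allₚ.map⁺ (All.map (λ {z} y≉z e → y≉z
    (x∙y⁻¹≈ε⇒x≈y _ _ (*-cancelˡ-0 x≉0 (trans (solve 3 (λ x y z → x :* (y :- z) := x :* y :- x :* z) refl x y z)
      (trans (+-congʳ e) (-‿inverseʳ _)))))) p) ∷ scaled-distinct x≉0 ps

  -- Multiplication by x permutes the units, so their product is unchanged when every factor is
  -- multiplied by x; this nonzero product then cancels.
  unit-power : ∀ x → ¬ (x ≈ 0#) → x ^ length us ≈ 1#
  unit-power x x≉0 = sym (x∙y⁻¹≈ε⇒x≈y _ _ (*-cancelˡ-0 (product-≉0 us-nonzero) (begin
    P * (1# - x ^ length us)             ≈⟨ solve 2 (λ p y → p :* (:1 :- y) := p :- y :* p) refl P (x ^ length us) ⟩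
    P - x ^ length us * P                ≈⟨ +-congˡ (-‿cong (product-scale x us)) ⟨
    P - product (map (x *_) us)          ≈⟨ +-congʳ (foldr-commMonoid *-isCommutativeMonoid scaled) ⟩
    product (map (x *_) us) - product (map (x *_) us) ≈⟨ -‿inverseʳ _ ⟩
    0# ∎)))
    where
    P = product us
    scaled : us ↭ map (x *_) us
    scaled = permutation (scaled-distinct x≉0 (AllPairs.tail us-distinct))
      (Allₚ.map⁺ (All.map (λ u≉0 → us-complete (*-≉0 x≉0 u≉0)) us-nonzero))
      (ℕₚ.≤-reflexive (≡.sym (Listₚ.length-map (x *_) us)))

  x^q≈x : ∀ x → x ^ q ≈ x
  x^q≈x x = ≡.subst (λ n → x ^ n ≈ x) suc-length-us (lemma (x ≟ 0#))
    where
    lemma : Dec (x ≈ 0#) → x * x ^ length us ≈ x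
    lemma (yes x≈0) = trans (*-congʳ x≈0) (trans (zeroˡ _) (sym x≈0))
    lemma (no x≉0)  = trans (*-congˡ (unit-power x x≉0)) (*-identityʳ x)

  q≡2+ : Σ ℕ λ n → q ≡ suc (suc n)
  q≡2+ with us | suc-length-us | us-complete 1≉0
  ... | u ∷ us' | e | _ = length us' , ≡.sym e

  one^ : ∀ n → 1# ^ n ≈ 1#
  one^ zero    = refl
  one^ (suc n) = trans (*-identityˡ _) (one^ n)

  horner-tabulate : ∀ {n} (f : Fin n → Carrier) x → horner (tabulate f) x ≈ sum (λ k → f k * x ^ toℕ k)
  horner-tabulate {zero}  f x = refl
  horner-tabulate {suc n} f x = +-cong (sym (*-identityʳ _)) (begin
    x * horner (tabulate (λ k → f (Fin.suc k))) x        ≈⟨ *-congˡ (horner-tabulate (λ k → f (Fin.suc k)) x) ⟩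
    x * sum (λ k → f (Fin.suc k) * x ^ toℕ k)            ≈⟨ *-distribˡ-sum x (λ k → f (Fin.suc k) * x ^ toℕ k) ⟩
    sum (λ k → x * (f (Fin.suc k) * x ^ toℕ k))          ≈⟨ sum-cong-≋ {n} (λ k → solve 3 (λ x y z → x :* (y :* z) := y :* (x :* z)) refl x (f (Fin.suc k)) (x ^ toℕ k)) ⟩
    sum (λ k → f (Fin.suc k) * (x * x ^ toℕ k))          ∎)

  -- The polynomial (x+1)^q - x^q - 1 has degree below q and vanishes at every field element because
  -- y^q = y. By the root bound its coefficients, which are the interior binomial coefficients, are
  -- zero in the field.
  binomial-vanishes : ∀ {m} → q ≡ suc m → ∀ (k : Fin m) → (q C suc (toℕ k)) ⊗ 1# ≈ 0#
  binomial-vanishes {m} ≡.refl k = Allₚ.tabulate⁻ (All.tail (vanishing-horner cs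
      (ℕₚ.≤-reflexive (cong suc (Listₚ.length-tabulate b))) zeros)) k
    where
    b : Fin m → Carrier
    b k = (suc m C suc (toℕ k)) ⊗ 1#
    -- The leading zero is the constant coefficient: `b k` belongs to x^(k+1). This makes exactly q
    -- coefficients, the largest number the root bound allows.
    cs = 0# ∷ tabulate b
    mid : Carrier → Carrier
    mid x = sum (middleTerm m x 1#)
    zeros : ∀ x → horner cs x ≈ 0#
    zeros x = begin
      0# + x * horner (tabulate b) x         ≈⟨ +-identityˡ _ ⟩
      x * horner (tabulate b) x              ≈⟨ *-congˡ (horner-tabulate b x) ⟩
      x * sum (λ k → b k * x ^ toℕ k)        ≈⟨ *-distribˡ-sum x (λ k → b k * x ^ toℕ k) ⟩
      sum (λ k → x * (b k * x ^ toℕ k))      ≈⟨ sum-cong-≋ {m} term ⟩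
      mid x                                  ≈⟨ solve 3 (λ a b c → b := (a :+ (b :+ c)) :- (c :+ a)) refl (1# ^ suc m) (mid x) (x ^ suc m) ⟩
      (1# ^ suc m + (mid x + x ^ suc m)) - (x ^ suc m + 1# ^ suc m)
        ≈⟨ +-cong (sym (binomial-split m x 1#)) (-‿cong (+-cong (x^q≈x x) (x^q≈x 1#))) ⟩
      (x + 1#) ^ suc m - (x + 1#)            ≈⟨ +-congʳ (x^q≈x (x + 1#)) ⟩
      (x + 1#) - (x + 1#)                    ≈⟨ -‿inverseʳ _ ⟩
      0#                                     ∎
      where
      term : ∀ k → x * (b k * x ^ toℕ k) ≈ middleTerm m x 1# k
      term k = begin
        x * (b k * x ^ toℕ k)                          ≈⟨ solve 3 (λ x y z → x :* (y :* z) := y :* (x :* z)) refl x (b k) (x ^ toℕ k) ⟩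
        b k * (x ^ suc (toℕ k))                        ≈⟨ ×-assoc-* n 1# _ ⟩
        n ⊗ (1# * x ^ suc (toℕ k))                     ≈⟨ ×-congʳ n (trans (*-comm _ _) (*-congˡ (sym (one^ (m ℕ.∸ toℕ k))))) ⟩
        n ⊗ (x ^ suc (toℕ k) * 1# ^ (m ℕ.∸ toℕ k))     ∎
        where n = suc m C suc (toℕ k)

record RingMap {a b c d} (A : CommutativeRing a b) (B : CommutativeRing c d) : Set (a ⊔ b ⊔ c ⊔ d) where
  private
    module A = CommutativeRing A
    module B = CommutativeRing B
  field
    to      : A.Carrier → B.Carrier
    to-cong : ∀ {x y} → x A.≈ y → to x B.≈ to y
    +-homo  : ∀ x y → to (x A.+ y) B.≈ to x B.+ to y
    *-homo  : ∀ x y → to (x A.* y) B.≈ to x B.* to y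
    1-homo  : to A.1# B.≈ B.1#

  open Algebra.Properties.AbelianGroup B.+-abelianGroup using (identityˡ-unique; inverseˡ-unique)

  0-homo : to A.0# B.≈ B.0#
  0-homo = identityˡ-unique _ _ (B.trans (B.sym (+-homo A.0# A.0#)) (to-cong (A.+-identityˡ A.0#)))

  -‿homo : ∀ x → to (A.- x) B.≈ B.- to x
  -‿homo x = inverseˡ-unique _ _ (B.trans (B.sym (+-homo _ _)) (B.trans (to-cong (A.-‿inverseˡ x)) 0-homo))

identityMap : ∀ {a b} (A : CommutativeRing a b) → RingMap A A
identityMap A = record { to = λ x → x ; to-cong = λ {x} {y} p → p ; +-homo = λ _ _ → refl ; *-homo = λ _ _ → refl ; 1-homo = refl }
  where open CommutativeRing A using (refl)

-- The polynomial ring S, with equality of coefficients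

module PolynomialRing {c ℓ} {q : ℕ} (𝔽 : FiniteField c ℓ q) where
  open FiniteField 𝔽 hiding (_≟_)
  open Algebra.Properties.Ring ring using (-0#≈0#)
  open Algebra.Properties.AbelianGroup +-abelianGroup using (⁻¹-∙-comm)

  Exponent : Set
  Exponent = ℕ × ℕ × ℕ

  Polynomial : Set c
  Polynomial = List (Carrier × Exponent)

  infixl 6 _⊕_
  _⊕_ : Exponent → Exponent → Exponent
  (i , j , k) ⊕ (i' , j' , k') = i ℕ.+ i' , j ℕ.+ j' , k ℕ.+ k'

  ⊕-comm : ∀ m n → m ⊕ n ≡ n ⊕ m
  ⊕-comm (i , j , k) (i' , j' , k') = ≡.cong₂ _,_ (ℕₚ.+-comm i i') (≡.cong₂ _,_ (ℕₚ.+-comm j j') (ℕₚ.+-comm k k'))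

  ⊕-assoc : ∀ l m n → (l ⊕ m) ⊕ n ≡ l ⊕ (m ⊕ n)
  ⊕-assoc (i , j , k) (i' , j' , k') (i″ , j″ , k″) =
    ≡.cong₂ _,_ (ℕₚ.+-assoc i i' i″) (≡.cong₂ _,_ (ℕₚ.+-assoc j j' j″) (ℕₚ.+-assoc k k' k″))

  sameExp : Exponent → Exponent → Bool
  sameExp = monoEqB 𝔽

  sameExp-true : ∀ {m n} → m ≡ n → sameExp m n ≡ true
  sameExp-true {i , j , k} ≡.refl
    rewrite dec-true (i ℕ.≟ i) ≡.refl | dec-true (j ℕ.≟ j) ≡.refl | dec-true (k ℕ.≟ k) ≡.refl = ≡.refl

  sameExp-sound : ∀ m n → sameExp m n ≡ true → m ≡ n
  sameExp-sound (i , j , k) (i' , j' , k') e with i ℕ.≡ᵇ i' in ei | j ℕ.≡ᵇ j' in ej | k ℕ.≡ᵇ k' in ek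
  ... | true  | true  | true = ≡.cong₂ _,_ (decode i i' ei) (≡.cong₂ _,_ (decode j j' ej) (decode k k' ek))
    where
    decode : ∀ a b → (a ℕ.≡ᵇ b) ≡ true → a ≡ b
    decode a b e = ℕₚ.≡ᵇ⇒≡ a b (≡.subst T (≡.sym e) tt)
  sameExp-sound _ _ () | false | _     | _
  sameExp-sound _ _ () | true  | false | _
  sameExp-sound _ _ () | true  | true  | false

  sameExp-false : ∀ {m n} → m ≢ n → sameExp m n ≡ false
  sameExp-false {m} {n} m≢n with sameExp m n in e
  ... | true  = ⊥-elim (m≢n (sameExp-sound m n e))
  ... | false = ≡.refl

  coef : Polynomial → Exponent → Carrier
  coef = coeff 𝔽

  infix 4 _≋_
  record _≋_ (p r : Polynomial) : Set ℓ where
    constructor mk≋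
    field coeffs : ∀ m → coef p m ≈ coef r m
  open _≋_ public

  coef-++ : ∀ p r m → coef (p ++ r) m ≈ coef p m + coef r m
  coef-++ []            r m = sym (+-identityˡ _)
  coef-++ ((d , n) ∷ p) r m with sameExp n m
  ... | true  = trans (+-congˡ (coef-++ p r m)) (sym (+-assoc _ _ _))
  ... | false = coef-++ p r m

  -- The ring operations are opaque so that unification treats them as injective.
  infixl 6 _⊞_
  infixl 7 _⊠_
  opaque
    _⊞_ _⊠_ : Polynomial → Polynomial → Polynomial
    _⊞_ = _+P_ 𝔽
    _⊠_ = _*P_ 𝔽

    const : Carrier → Polynomial
    const = constP 𝔽

    neg : Polynomial → Polynomial
    neg = map (λ t → - proj₁ t , proj₂ t)

    coef-⊞ : ∀ p r m → coef (p ⊞ r) m ≈ coef p m + coef r m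
    coef-⊞ = coef-++

    coef-neg : ∀ p m → coef (neg p) m ≈ - coef p m
    coef-neg []            m = sym -0#≈0#
    coef-neg ((d , n) ∷ p) m with sameExp n m
    ... | true  = trans (+-congˡ (coef-neg p m)) (⁻¹-∙-comm _ _)
    ... | false = coef-neg p m

    ⊞-def : ∀ p r → p ⊞ r ≡ _+P_ 𝔽 p r
    ⊞-def p r = ≡.refl

  drop : Exponent → Polynomial → Polynomial
  drop m = foldr (λ t acc → if sameExp (proj₂ t) m then acc else t ∷ acc) []

  drop-length : ∀ m p → length (drop m p) ≤ length p
  drop-length m []      = z≤n
  drop-length m (t ∷ p) with sameExp (proj₂ t) m
  ... | true  = ℕₚ.m≤n⇒m≤1+n (drop-length m p)
  ... | false = s≤s (drop-length m p)

  coef-drop : ∀ m p n → coef (drop m p) n ≈ (if sameExp m n then 0# else coef p n)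
  coef-drop m [] n with sameExp m n
  ... | true  = refl
  ... | false = refl
  coef-drop m ((d , l) ∷ p) n with sameExp l m in lm
  coef-drop m ((d , l) ∷ p) n | true with sameExp-sound l m lm
  coef-drop m ((d , l) ∷ p) n | true | ≡.refl with sameExp l n | coef-drop l p n
  ... | true  | e = e
  ... | false | e = e
  coef-drop m ((d , l) ∷ p) n | false with sameExp l n in ln
  coef-drop m ((d , l) ∷ p) n | false | false = coef-drop m p n
  coef-drop m ((d , l) ∷ p) n | false | true with sameExp-sound l n ln
  coef-drop m ((d , l) ∷ p) n | false | true | ≡.refl with sameExp m l in ml | coef-drop m p l
  ... | false | e = +-congˡ e
  ... | true  | e with sameExp-sound m l ml
  ...   | ≡.refl with ≡.trans (≡.sym (sameExp-true {m} ≡.refl)) lm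
  ...     | ()

  -- Every F-linear functional on polynomials has the form `linear f`; the ring
  -- operations and all substitutions are handled through such functionals.
  module Linear {c' ℓ'} (R : CommutativeRing c' ℓ') (ι : RingMap commRing R) where
    private module R = CommutativeRing R
    open IntegerSolver R
    open RingMap ι
    open Relation.Binary.Reasoning.Setoid R.setoid
    open Algebra.Properties.Ring R.ring using (x∙y⁻¹≈ε⇒x≈y; -‿distribˡ-*)
    open Algebra.Properties.AbelianGroup R.+-abelianGroup using () renaming (⁻¹-∙-comm to R-⁻¹-∙-comm)

    linear : (Exponent → R.Carrier) → Polynomial → R.Carrier
    linear f = foldr (λ t acc → to (proj₁ t) R.* f (proj₂ t) R.+ acc) R.0#

    linear-cong : ∀ {f g} → (∀ m → f m R.≈ g m) → ∀ p → linear f p R.≈ linear g p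
    linear-cong e []            = R.refl
    linear-cong e ((d , m) ∷ p) = R.+-cong (R.*-congˡ (e m)) (linear-cong e p)

    linear-++ : ∀ f p r → linear f (p ++ r) R.≈ linear f p R.+ linear f r
    linear-++ f []      r = R.sym (R.+-identityˡ _)
    linear-++ f (t ∷ p) r = R.trans (R.+-congˡ (linear-++ f p r)) (R.sym (R.+-assoc _ _ _))

    opaque
      unfolding _⊞_ neg const

      linear-⊞ : ∀ f p r → linear f (p ⊞ r) R.≈ linear f p R.+ linear f r
      linear-⊞ = linear-++

      linear-neg : ∀ f p → linear f (neg p) R.≈ R.- linear f p
      linear-neg f [] = R.sym (Algebra.Properties.Ring.-0#≈0# R.ring)
      linear-neg f ((d , m) ∷ p) = R.trans
        (R.+-cong (R.trans (R.*-congʳ (-‿homo d)) (R.sym (-‿distribˡ-* _ _))) (linear-neg f p)) (R-⁻¹-∙-comm _ _)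

      linear-const : ∀ f d → linear f (const d) R.≈ to d R.* f (0 , 0 , 0)
      linear-const f d = R.+-identityʳ _

    linear-split : ∀ f m p → linear f p R.≈ to (coef p m) R.* f m R.+ linear f (drop m p)
    linear-split f m [] = R.sym (R.trans (R.+-identityʳ _) (R.trans (R.*-congʳ 0-homo) (R.zeroˡ _)))
    linear-split f m ((d , n) ∷ p) with sameExp n m in e
    ... | false = R.trans (R.+-congˡ (linear-split f m p))
                    (solve 3 (λ x y z → x :+ (y :+ z) := y :+ (x :+ z)) R.refl _ _ _)
    ... | true with sameExp-sound n m e
    ...   | ≡.refl = R.trans (R.+-congˡ (linear-split f m p)) (R.trans
                    (solve 4 (λ x y z w → x :* w :+ (y :* w :+ z) := (x :+ y) :* w :+ z) R.refl _ _ _ _)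
                    (R.+-congʳ (R.*-congʳ (R.sym (+-homo _ _)))))

    -- Terms of one exponent may be scattered over the list and cancel only together. The induction
    -- therefore runs on a length bound and removes all terms with the exponent of the head at once.
    -- The hypothesis concerns the product, so that either the coefficient or the functional may be
    -- the vanishing factor.
    linear-vanish : ∀ f p → (∀ m → to (coef p m) R.* f m R.≈ R.0#) → linear f p R.≈ R.0#
    linear-vanish f p = bounded (length p) p ℕₚ.≤-refl
      where
      bounded : ∀ n p → length p ≤ n → (∀ m → to (coef p m) R.* f m R.≈ R.0#) → linear f p R.≈ R.0#
      bounded n       []             _        _ = R.refl
      bounded (suc n) p@((d , m) ∷ r) (s≤s le) z = begin
        linear f p                                    ≈⟨ linear-split f m p ⟩
        to (coef p m) R.* f m R.+ linear f (drop m p) ≈⟨ R.+-cong (z m) (bounded n (drop m p) shorter dropped) ⟩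
        R.0# R.+ R.0#                                 ≈⟨ R.+-identityˡ _ ⟩
        R.0#                                          ∎
        where
        shorter : length (drop m p) ≤ n
        shorter rewrite sameExp-true {m} ≡.refl = ℕₚ.≤-trans (drop-length m r) le
        dropped : ∀ k → to (coef (drop m p) k) R.* f k R.≈ R.0#
        dropped k = cases (sameExp m k) (coef-drop m p k) (z k)
          where
          cases : ∀ b {x y} → x ≈ (if b then 0# else y) → to y R.* f k R.≈ R.0# → to x R.* f k R.≈ R.0#
          cases true  e _ = R.trans (R.*-congʳ (R.trans (to-cong e) 0-homo)) (R.zeroˡ _)
          cases false e z = R.trans (R.*-congʳ (to-cong e)) z

    -- The difference has only zero coefficients. This is what makes multiplication and every
    -- substitution well defined for equality of coefficients.
    linear-resp : ∀ f {p r} → p ≋ r → linear f p R.≈ linear f r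
    linear-resp f {p} {r} e = x∙y⁻¹≈ε⇒x≈y _ _ (begin
      linear f p R.+ R.- linear f r       ≈⟨ R.+-congˡ (linear-neg f r) ⟨
      linear f p R.+ linear f (neg r)     ≈⟨ linear-⊞ f p (neg r) ⟨
      linear f (p ⊞ neg r)                ≈⟨ linear-vanish f (p ⊞ neg r) (λ m → R.trans (R.*-congʳ
          (R.trans (to-cong (trans (coef-⊞ p (neg r) m) (trans (+-cong (coeffs e m) (coef-neg r m)) (-‿inverseʳ _)))) 0-homo)) (R.zeroˡ _)) ⟩
      R.0#                                ∎)

    linear-scale : ∀ f x p → linear (λ m → x R.* f m) p R.≈ x R.* linear f p
    linear-scale f x []            = R.sym (R.zeroʳ x)
    linear-scale f x ((d , m) ∷ p) = R.trans (R.+-congˡ (linear-scale f x p))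
      (solve 4 (λ d x y z → d :* (x :* y) :+ x :* z := x :* (d :* y :+ z)) R.refl _ _ _ _)

    linear-add : ∀ f g p → linear (λ m → f m R.+ g m) p R.≈ linear f p R.+ linear g p
    linear-add f g []            = R.sym (R.+-identityˡ _)
    linear-add f g ((d , m) ∷ p) = R.trans (R.+-congˡ (linear-add f g p))
      (solve 5 (λ d x y z w → d :* (x :+ y) :+ (z :+ w) := (d :* x :+ z) :+ (d :* y :+ w)) R.refl _ _ _ _ _)

    linear-const0 : ∀ p → linear (λ _ → R.0#) p R.≈ R.0#
    linear-const0 []            = R.refl
    linear-const0 ((d , m) ∷ p) = R.trans (R.+-cong (R.zeroʳ _) (linear-const0 p)) (R.+-identityˡ _)

    linear-swap : ∀ (f : Exponent → Exponent → R.Carrier) p r →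
      linear (λ m → linear (f m) r) p R.≈ linear (λ n → linear (λ m → f m n) p) r
    linear-swap f []            r = R.sym (linear-const0 r)
    linear-swap f ((d , m) ∷ p) r = begin
      to d R.* linear (f m) r R.+ linear (λ m → linear (f m) r) p
        ≈⟨ R.+-cong (R.sym (linear-scale (f m) (to d) r)) (linear-swap f p r) ⟩
      linear (λ n → to d R.* f m n) r R.+ linear (λ n → linear (λ m → f m n) p) r
        ≈⟨ linear-add _ _ r ⟨
      linear (λ n → to d R.* f m n R.+ linear (λ m → f m n) p) r ∎

    shifted : Carrier → Exponent → Polynomial → Polynomial
    shifted d m = map (λ u → d * proj₁ u , m ⊕ proj₂ u)

    linear-shifted : ∀ f d m r → linear f (shifted d m r) R.≈ to d R.* linear (λ n → f (m ⊕ n)) r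
    linear-shifted f d m []            = R.sym (R.zeroʳ _)
    linear-shifted f d m ((e , n) ∷ r) = R.trans (R.+-cong (R.*-congʳ (*-homo d e)) (linear-shifted f d m r))
      (solve 4 (λ d e x y → (d :* e) :* x :+ d :* y := d :* (e :* x :+ y)) R.refl _ _ _ _)

    opaque
      unfolding _⊠_

      linear-⊠ : ∀ f p r → linear f (p ⊠ r) R.≈ linear (λ m → linear (λ n → f (m ⊕ n)) r) p
      linear-⊠ f []            r = R.refl
      linear-⊠ f ((d , m) ∷ p) r = R.trans (linear-++ f (shifted d m r) _)
        (R.+-cong (linear-shifted f d m r) (linear-⊠ f p r))

  open Linear commRing (identityMap commRing) public

  kronecker : Exponent → Exponent → Carrier
  kronecker m n = if sameExp n m then 1# else 0#

  coef-linear : ∀ p m → coef p m ≈ linear (kronecker m) p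
  coef-linear []            m = refl
  coef-linear ((d , n) ∷ p) m with sameExp n m
  ... | true  = +-cong (sym (*-identityʳ d)) (coef-linear p m)
  ... | false = trans (coef-linear p m) (sym (trans (+-congʳ (zeroʳ d)) (+-identityˡ _)))

  -- Reading off a coefficient is itself one of these functionals. Ring laws thus reduce to
  -- identities between iterated sums in the field, for instance commutativity to `linear-swap`.
  linear-ext : ∀ {p r} → (∀ f → linear f p ≈ linear f r) → p ≋ r
  linear-ext {p} {r} e = mk≋ λ m → trans (coef-linear p m) (trans (e (kronecker m)) (sym (coef-linear r m)))

  linear-≡ : ∀ {f g : Exponent → Carrier} p → (∀ m → f m ≡ g m) → linear f p ≈ linear g p
  linear-≡ p e = linear-cong (λ m → reflexive (e m)) p

  ⊞-cong : ∀ {p p' r r'} → p ≋ p' → r ≋ r' → p ⊞ r ≋ p' ⊞ r'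
  ⊞-cong {p} {p'} {r} {r'} e e' = mk≋ λ m → trans (coef-⊞ p r m) (trans (+-cong (coeffs e m) (coeffs e' m)) (sym (coef-⊞ p' r' m)))

  ⊠-cong : ∀ {p p' r r'} → p ≋ p' → r ≋ r' → p ⊠ r ≋ p' ⊠ r'
  ⊠-cong {p} {p'} {r} {r'} e e' = linear-ext λ f → trans (linear-⊠ f p r) (trans
    (trans (linear-resp _ e) (linear-cong (λ m → linear-resp _ e') p')) (sym (linear-⊠ f p' r')))

  ⊠-comm : ∀ p r → p ⊠ r ≋ r ⊠ p
  ⊠-comm p r = linear-ext λ f → trans (linear-⊠ f p r) (trans (linear-swap (λ m n → f (m ⊕ n)) p r)
    (trans (linear-cong (λ n → linear-≡ p (λ m → cong f (⊕-comm m n))) r) (sym (linear-⊠ f r p))))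

  ⊠-assoc : ∀ p r s → (p ⊠ r) ⊠ s ≋ p ⊠ (r ⊠ s)
  ⊠-assoc p r s = linear-ext λ f → trans (linear-⊠ f (p ⊠ r) s) (trans (linear-⊠ _ p r)
    (sym (trans (linear-⊠ f p (r ⊠ s)) (linear-cong (λ l → trans (linear-⊠ (λ n → f (l ⊕ n)) r s)
      (linear-cong (λ m → linear-≡ s (λ n → cong f (≡.sym (⊕-assoc l m n)))) r)) p))))

  ⊠-identityˡ : ∀ p → const 1# ⊠ p ≋ p
  ⊠-identityˡ p = linear-ext λ f → trans (linear-⊠ f (const 1#) p) (trans (linear-const _ 1#) (*-identityˡ _))

  ⊠-distribʳ : ∀ p r s → (r ⊞ s) ⊠ p ≋ r ⊠ p ⊞ s ⊠ p
  ⊠-distribʳ p r s = linear-ext λ f → trans (linear-⊠ f (r ⊞ s) p) (trans (linear-⊞ _ r s)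
    (sym (trans (linear-⊞ f (r ⊠ p) (s ⊠ p)) (+-cong (linear-⊠ f r p) (linear-⊠ f s p)))))

  ≋-isEquivalence : IsEquivalence _≋_
  ≋-isEquivalence = record
    { refl = mk≋ λ m → refl ; sym = λ e → mk≋ λ m → sym (coeffs e m) ; trans = λ e e' → mk≋ λ m → trans (coeffs e m) (coeffs e' m) }

  open IsEquivalence ≋-isEquivalence public using () renaming (refl to ≋-refl; sym to ≋-sym; trans to ≋-trans)

  ⊞-comm : ∀ p r → p ⊞ r ≋ r ⊞ p
  ⊞-comm p r = mk≋ λ m → trans (coef-⊞ p r m) (trans (+-comm _ _) (sym (coef-⊞ r p m)))

  ⊞-assoc : ∀ p r s → (p ⊞ r) ⊞ s ≋ p ⊞ (r ⊞ s)
  ⊞-assoc p r s = mk≋ λ m → trans (coef-⊞ (p ⊞ r) s m) (trans (+-congʳ (coef-⊞ p r m)) (trans (+-assoc _ _ _)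
    (sym (trans (coef-⊞ p (r ⊞ s) m) (+-congˡ (coef-⊞ r s m))))))

  ⊞-inverseʳ : ∀ p → p ⊞ neg p ≋ []
  ⊞-inverseʳ p = mk≋ λ m → trans (coef-⊞ p (neg p) m) (trans (+-congˡ (coef-neg p m)) (-‿inverseʳ _))

  ⊞-identityˡ : ∀ p → [] ⊞ p ≋ p
  ⊞-identityˡ p = mk≋ λ m → trans (coef-⊞ [] p m) (+-identityˡ _)

  neg-cong : ∀ {p r} → p ≋ r → neg p ≋ neg r
  neg-cong {p} {r} e = mk≋ λ m → trans (coef-neg p m) (trans (-‿cong (coeffs e m)) (sym (coef-neg r m)))

  polyRing : CommutativeRing c ℓ
  polyRing = record
    { Carrier = Polynomial ; _≈_ = _≋_ ; _+_ = _⊞_ ; _*_ = _⊠_ ; -_ = neg ; 0# = [] ; 1# = const 1#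
    ; isCommutativeRing = record
      { isRing = record
        { +-isAbelianGroup = record
          { isGroup = record
            { isMonoid = record
              { isSemigroup = record
                { isMagma = record { isEquivalence = ≋-isEquivalence ; ∙-cong = ⊞-cong }
                ; assoc = ⊞-assoc }
              ; identity = ⊞-identityˡ , λ p → ≋-trans (⊞-comm p []) (⊞-identityˡ p) }
            ; inverse = (λ p → ≋-trans (⊞-comm (neg p) p) (⊞-inverseʳ p)) , ⊞-inverseʳ
            ; ⁻¹-cong = neg-cong }
          ; comm = ⊞-comm }
        ; *-cong = ⊠-cong
        ; *-assoc = ⊠-assoc
        ; *-identity = ⊠-identityˡ , λ p → ≋-trans (⊠-comm p (const 1#)) (⊠-identityˡ p)
        ; distrib = (λ p r s → ≋-trans (⊠-comm p (r ⊞ s)) (≋-trans (⊠-distribʳ p r s) (⊞-cong (⊠-comm r p) (⊠-comm s p)))) , ⊠-distribʳ }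
      ; *-comm = ⊠-comm } }

  constMap : RingMap commRing polyRing
  constMap = record
    { to = const
    ; to-cong = λ {x} {y} e → linear-ext λ f → trans (linear-const f x) (trans (*-congʳ e) (sym (linear-const f y)))
    ; +-homo = λ x y → linear-ext λ f → trans (linear-const f (x + y)) (trans (distribʳ _ _ _)
        (sym (trans (linear-⊞ f (const x) (const y)) (+-cong (linear-const f x) (linear-const f y)))))
    ; *-homo = λ x y → linear-ext λ f → trans (linear-const f (x * y)) (trans (*-assoc _ _ _)
        (sym (trans (linear-⊠ f (const x) (const y)) (trans (linear-const _ x) (*-congˡ (linear-const _ y))))))
    ; 1-homo = ≋-refl }

-- Substitution, congruences, cancellation and the Frobenius identity

module PolynomialEvaluation {c ℓ} {q : ℕ} (𝔽 : FiniteField c ℓ q) where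
  open FiniteField 𝔽 hiding (_≟_)
  open PolynomialRing 𝔽
  private module S = CommutativeRing polyRing

  module Evaluate {c' ℓ'} (R : CommutativeRing c' ℓ') (ι : RingMap commRing R)
                  (x y z : CommutativeRing.Carrier R) where
    private module R = CommutativeRing R
    open RingMap ι
    open Linear R ι using () renaming (linear to linearR; linear-cong to linearR-cong; linear-resp to linearR-resp;
      linear-⊞ to linearR-⊞; linear-⊠ to linearR-⊠; linear-const to linearR-const; linear-scale to linearR-scale)
    open IntegerSolver R
    open Binomials R using (_^_; ^-homo-*)

    monomialValue : Exponent → R.Carrier
    monomialValue (i , j , k) = x ^ i R.* (y ^ j R.* z ^ k)

    monomialValue-⊕ : ∀ m n → monomialValue (m ⊕ n) R.≈ monomialValue m R.* monomialValue n
    monomialValue-⊕ (i , j , k) (i' , j' , k') = R.trans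
      (R.*-cong (^-homo-* x i i') (R.*-cong (^-homo-* y j j') (^-homo-* z k k')))
      (solve 6 (λ a a' b b' c c' → (a :* a') :* ((b :* b') :* (c :* c')) := (a :* (b :* c)) :* (a' :* (b' :* c'))) R.refl
        _ _ _ _ _ _)

    opaque
      eval : Polynomial → R.Carrier
      eval = linearR monomialValue

      eval-cong : ∀ {p r} → p ≋ r → eval p R.≈ eval r
      eval-cong = linearR-resp monomialValue

      eval-[] : eval [] R.≈ R.0#
      eval-[] = R.refl

      eval-∷ : ∀ d m p → eval ((d , m) ∷ p) R.≈ to d R.* monomialValue m R.+ eval p
      eval-∷ d m p = R.refl

      eval-const : ∀ d → eval (const d) R.≈ to d
      eval-const d = R.trans (linearR-const monomialValue d)
        (solve 1 (λ d → d :* (:1 :* (:1 :* :1)) := d) R.refl (to d))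

      eval-monomial : ∀ m → eval ((1# , m) ∷ []) R.≈ monomialValue m
      eval-monomial m = R.trans (R.+-identityʳ _) (R.trans (R.*-congʳ 1-homo) (R.*-identityˡ _))

      eval-⊞ : ∀ p r → eval (p ⊞ r) R.≈ eval p R.+ eval r
      eval-⊞ = linearR-⊞ monomialValue

      eval-⊠ : ∀ p r → eval (p ⊠ r) R.≈ eval p R.* eval r
      eval-⊠ p r = R.trans (linearR-⊠ monomialValue p r) (R.trans
        (linearR-cong (λ m → R.trans (linearR-cong (λ n → monomialValue-⊕ m n) r)
          (R.trans (linearR-scale monomialValue (monomialValue m) r) (R.*-comm _ _))) p)
        (R.trans (linearR-scale monomialValue (eval r) p) (R.*-comm _ _)))

      eval-linP : ∀ α → eval (linP 𝔽 α) R.≈ to (proj₁ α) R.* x R.+ to (proj₁ (proj₂ α)) R.* y R.+ to (proj₂ (proj₂ α)) R.* z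
      eval-linP (a , b , d) = solve 6 (λ a b d x y z →
        a :* ((x :* :1) :* (:1 :* :1)) :+ (b :* (:1 :* ((y :* :1) :* :1))
          :+ (d :* (:1 :* (:1 :* (z :* :1))) :+ :0))
        := a :* x :+ b :* y :+ d :* z) R.refl (to a) (to b) (to d) x y z

    evalMap : RingMap polyRing R
    evalMap = record
      { to = eval ; to-cong = eval-cong ; +-homo = eval-⊞ ; *-homo = eval-⊠ ; 1-homo = R.trans (eval-const 1#) 1-homo }

  monomial : Exponent → Polynomial
  monomial m = (1# , m) ∷ []

  monomial-⊕ : ∀ m n → monomial m ⊠ monomial n ≋ monomial (m ⊕ n)
  monomial-⊕ m n = linear-ext λ f → trans (linear-⊠ f (monomial m) (monomial n)) (+-congʳ (trans (*-identityˡ _) (+-identityʳ _)))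

  1≋monomial : const 1# ≋ monomial (0 , 0 , 0)
  1≋monomial = linear-ext λ f → trans (linear-const f 1#) (sym (+-identityʳ _))

  const-monomial : ∀ d m → const d ⊠ monomial m ≋ (d , m) ∷ []
  const-monomial d m = linear-ext λ f → trans (linear-⊠ f (const d) (monomial m))
    (trans (linear-const _ d) (trans (*-congˡ (trans (+-identityʳ _) (*-identityˡ _))) (sym (+-identityʳ _))))

  X₁ X₂ X₃ : Polynomial
  X₁ = monomial (1 , 0 , 0)
  X₂ = monomial (0 , 1 , 0)
  X₃ = monomial (0 , 0 , 1)

  open Binomials polyRing using (_^_; ^-congˡ; ^-distrib-*; binomial-split; middleTerm; sum) renaming (_⊗_ to _⊗S_)
  open Binomials commRing using () renaming (_⊗_ to _⊗F_; _^_ to _^F_)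

  X₁^ : ∀ i → X₁ ^ i ≋ monomial (i , 0 , 0)
  X₁^ zero    = 1≋monomial
  X₁^ (suc i) = ≋-trans (S.*-congˡ (X₁^ i)) (monomial-⊕ (1 , 0 , 0) (i , 0 , 0))

  X₂^ : ∀ i → X₂ ^ i ≋ monomial (0 , i , 0)
  X₂^ zero    = 1≋monomial
  X₂^ (suc i) = ≋-trans (S.*-congˡ (X₂^ i)) (monomial-⊕ (0 , 1 , 0) (0 , i , 0))

  X₃^ : ∀ i → X₃ ^ i ≋ monomial (0 , 0 , i)
  X₃^ zero    = 1≋monomial
  X₃^ (suc i) = ≋-trans (S.*-congˡ (X₃^ i)) (monomial-⊕ (0 , 0 , 1) (0 , 0 , i))

  ∷-⊞ : ∀ t p → (t ∷ []) ⊞ p ≋ t ∷ p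
  ∷-⊞ t p = linear-ext λ f → trans (linear-⊞ f (t ∷ []) p) (+-congʳ (+-identityʳ _))

  module Substitute (f g h : Polynomial) = Evaluate polyRing constMap f g h

  private module Id = Substitute X₁ X₂ X₃

  monomial-product : ∀ m → Id.monomialValue m ≋ monomial m
  monomial-product m@(i , j , k) = ≋-trans (S.*-cong (X₁^ i) (S.*-cong (X₂^ j) (X₃^ k)))
    (≋-trans (S.*-congˡ (monomial-⊕ (0 , j , 0) (0 , 0 , k))) (≋-trans (monomial-⊕ (i , 0 , 0) (0 , j ℕ.+ 0 , k))
      (S.reflexive (≡.cong₂ (λ a b → monomial (a , b , k)) (ℕₚ.+-identityʳ i) (ℕₚ.+-identityʳ j)))))

  eval-identity : ∀ p → Id.eval p ≋ p
  eval-identity []            = Id.eval-[]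
  eval-identity ((d , m) ∷ p) = ≋-trans (Id.eval-∷ d m p) (≋-trans
    (S.+-cong (≋-trans (S.*-congˡ (monomial-product m)) (const-monomial d m)) (eval-identity p)) (∷-⊞ (d , m) p))

  open RingVectors polyRing public using (_∣_; ∣-+; ∣-*ʳ; ∣-*ˡ; ∣-self; ∣-resp; _∙_; det; _×³_; _≈³_; Vec3; ∙-cong; det-cong; ×³-cong)

  𝐱 𝐱^q : Vec3
  𝐱   = X₁ , X₂ , X₃
  𝐱^q = monomial (q , 0 , 0) , monomial (0 , q , 0) , monomial (0 , 0 , q)

  const³ : V3 𝔽 → Vec3
  const³ (a , b , d) = const a , const b , const d

  linP-∙ : ∀ α → linP 𝔽 α ≋ const³ α ∙ 𝐱
  linP-∙ α = ≋-trans (≋-sym (eval-identity (linP 𝔽 α))) (Id.eval-linP α)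

  private
    module Solver = IntegerSolver polyRing

  _≡_mod_ : Polynomial → Polynomial → Polynomial → Set (c ⊔ ℓ)
  f ≡ g mod a = a ∣ (f ⊞ neg g)

  mod-refl : ∀ {a} f → f ≡ f mod a
  mod-refl {a} f = [] , ≋-trans (S.-‿inverseʳ f) (≋-sym (S.zeroʳ a))

  mod-cong : ∀ {a f f' g g'} → f ≋ f' → g ≋ g' → f ≡ g mod a → f' ≡ g' mod a
  mod-cong p r = ∣-resp (S.+-cong p (S.-‿cong r))

  mod-+ : ∀ {a f f' g g'} → f ≡ f' mod a → g ≡ g' mod a → (f ⊞ g) ≡ (f' ⊞ g') mod a
  mod-+ {a} {f} {f'} {g} {g'} p r = ∣-resp
    (Solver.solve 4 (λ f f' g g' → (f :- f') :+ (g :- g') := (f :+ g) :- (f' :+ g')) ≋-refl f f' g g') (∣-+ p r)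
    where open Solver

  mod-* : ∀ {a f f' g g'} → f ≡ f' mod a → g ≡ g' mod a → (f ⊠ g) ≡ (f' ⊠ g') mod a
  mod-* {a} {f} {f'} {g} {g'} p r = ∣-resp
    (Solver.solve 4 (λ f f' g g' → (f :- f') :* g :+ f' :* (g :- g') := (f :* g) :- (f' :* g')) ≋-refl f f' g g')
    (∣-+ (∣-*ʳ g p) (∣-*ˡ f' r))
    where open Solver

  mod-^ : ∀ {a f g} n → f ≡ g mod a → (f ^ n) ≡ (g ^ n) mod a
  mod-^ zero    p = mod-refl (const 1#)
  mod-^ (suc n) p = mod-* p (mod-^ n p)

  -- Congruent values of the variables give congruent results. Substituting the variables for
  -- themselves returns p, so p itself is congruent to its image under the other substitution.
  substitute-mod : ∀ {a f g h} → X₁ ≡ f mod a → X₂ ≡ g mod a → X₃ ≡ h mod a → ∀ p → p ≡ Substitute.eval f g h p mod a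
  substitute-mod {a} {f} {g} {h} pf pg ph p = ∣-resp (S.+-congʳ (eval-identity p)) (go p)
    where
    go : ∀ p → Id.eval p ≡ Substitute.eval f g h p mod a
    go []                      = mod-cong (≋-sym Id.eval-[]) (≋-sym (Substitute.eval-[] f g h)) (mod-refl [])
    go ((d , m@(i , j , k)) ∷ p) = mod-cong (≋-sym (Id.eval-∷ d m p)) (≋-sym (Substitute.eval-∷ f g h d m p))
      (mod-+ (mod-* (mod-refl (const d)) (mod-* (mod-^ i pf) (mod-* (mod-^ j pg) (mod-^ k ph)))) (go p))

  kronecker-⊕ : ∀ m₀ m l → kronecker (m₀ ⊕ m) (m₀ ⊕ l) ≡ kronecker m l
  kronecker-⊕ m₀@(i , j , k) m@(a , b , d) l@(a' , b' , d') with sameExp l m in e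
  ... | true with sameExp-sound l m e
  ...   | ≡.refl rewrite sameExp-true {m₀ ⊕ m} ≡.refl = ≡.refl
  kronecker-⊕ m₀@(i , j , k) m@(a , b , d) l@(a' , b' , d') | false
    with sameExp (m₀ ⊕ l) (m₀ ⊕ m) in e'
  ... | false = ≡.refl
  ... | true  = ⊥-elim (absurd (≡.trans (≡.sym (sameExp-true (cancelled (sameExp-sound (m₀ ⊕ l) (m₀ ⊕ m) e')))) e))
    where
    cancelled : m₀ ⊕ l ≡ m₀ ⊕ m → l ≡ m
    cancelled p = ≡.cong₂ _,_ (ℕₚ.+-cancelˡ-≡ i a' a (cong proj₁ p))
      (≡.cong₂ _,_ (ℕₚ.+-cancelˡ-≡ j b' b (cong (λ t → proj₁ (proj₂ t)) p)) (ℕₚ.+-cancelˡ-≡ k d' d (cong (λ t → proj₂ (proj₂ t)) p)))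
    absurd : true ≢ false
    absurd ()

  -- Coefficients are compared from the heaviest monomial downwards.
  module Cancellation (w : Exponent → ℕ) (w-⊕ : ∀ m n → w (m ⊕ n) ≡ w m ℕ.+ w n) where
    open FieldPolynomials 𝔽 using (*-cancelˡ-0)

    coef-bound : ∀ f → Σ ℕ λ B → ∀ m → B ≤ w m → coef f m ≈ 0#
    coef-bound []            = 0 , λ _ _ → refl
    coef-bound ((d , n) ∷ f) with coef-bound f
    ... | B , b = suc (w n) ℕ.⊔ B , heavy
      where
      heavy : ∀ m → suc (w n) ℕ.⊔ B ≤ w m → coef ((d , n) ∷ f) m ≈ 0#
      heavy m le with sameExp n m in e
      ... | false = b m (ℕₚ.≤-trans (ℕₚ.m≤n⊔m (suc (w n)) B) le)
      ... | true with sameExp-sound n m e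
      ...   | ≡.refl = ⊥-elim (ℕₚ.<-irrefl ≡.refl (ℕₚ.≤-trans (ℕₚ.m≤m⊔n (suc (w n)) B) le))

    -- Suppose the coefficients of f at monomials heavier than m vanish. In the coefficient of g f
    -- at m₀ + m, a term of g lighter than m₀ can meet only monomials of f heavier than m, so what
    -- remains is u times the coefficient of f at m.
    cancel : ∀ {g u m₀ g'} → g ≋ (u , m₀) ∷ g' → ¬ (u ≈ 0#) → All (λ t → w (proj₂ t) ℕ.< w m₀) g' →
             ∀ {f} → g ⊠ f ≋ [] → f ≋ []
    cancel {g} {u} {m₀} {g'} g≋ u≉0 light {f} gf≋0 = mk≋ λ m →
      down B m (ℕₚ.m≤n+m B (w m))
      where
      B = proj₁ (coef-bound f)
      tail-zero : ∀ m h → All (λ t → w (proj₂ t) ℕ.< w m₀) h → (∀ l → w m ℕ.< w l → coef f l ≈ 0#) →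
                  linear (λ n → linear (λ l → kronecker (m₀ ⊕ m) (n ⊕ l)) f) h ≈ 0#
      tail-zero m []            []        z = refl
      tail-zero m ((d , n) ∷ h) (lt ∷ lts) z =
        trans (+-cong (trans (*-congˡ (linear-vanish _ f vanish)) (zeroʳ d)) (tail-zero m h lts z)) (+-identityˡ _)
        where
        vanish : ∀ l → coef f l * kronecker (m₀ ⊕ m) (n ⊕ l) ≈ 0#
        vanish l with sameExp (n ⊕ l) (m₀ ⊕ m) in e
        ... | false = zeroʳ _
        ... | true  = trans (*-congʳ (z l heavier)) (zeroˡ _)
          where
          heavier : w m ℕ.< w l
          heavier = ℕₚ.+-cancelˡ-< (w n) (w m) (w l) (ℕₚ.<-≤-trans (ℕₚ.+-monoˡ-< (w m) lt)
            (ℕₚ.≤-reflexive (≡.trans (≡.sym (w-⊕ m₀ m)) (≡.trans (cong w (≡.sym (sameExp-sound _ _ e))) (w-⊕ n l)))))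
      leading : ∀ m → (∀ l → w m ℕ.< w l → coef f l ≈ 0#) → coef f m ≈ 0#
      leading m z = *-cancelˡ-0 u≉0 (trans (sym (begin
        coef (((u , m₀) ∷ g') ⊠ f) (m₀ ⊕ m)
          ≈⟨ coef-linear (((u , m₀) ∷ g') ⊠ f) (m₀ ⊕ m) ⟩
        linear (kronecker (m₀ ⊕ m)) (((u , m₀) ∷ g') ⊠ f)
          ≈⟨ linear-⊠ (kronecker (m₀ ⊕ m)) ((u , m₀) ∷ g') f ⟩
        u * linear (λ l → kronecker (m₀ ⊕ m) (m₀ ⊕ l)) f + linear (λ n → linear (λ l → kronecker (m₀ ⊕ m) (n ⊕ l)) f) g'
          ≈⟨ +-cong (*-congˡ (trans (linear-≡ f (kronecker-⊕ m₀ m)) (sym (coef-linear f m)))) (tail-zero m g' light z) ⟩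
        u * coef f m + 0#   ≈⟨ +-identityʳ _ ⟩
        u * coef f m ∎)) (coeffs (≋-trans (S.*-congʳ (≋-sym g≋)) gf≋0) (m₀ ⊕ m)))
        where open Relation.Binary.Reasoning.Setoid setoid
      -- Here `k` bounds how far the weight of `m` lies below `B`, and no coefficient of f survives
      -- at weight `B` or more. Passing to a heavier monomial consumes one unit of `k`.
      down : ∀ k m → B ≤ w m ℕ.+ k → coef f m ≈ 0#
      down zero    m le = proj₂ (coef-bound f) m (≡.subst (B ≤_) (ℕₚ.+-identityʳ (w m)) le)
      down (suc k) m le = leading m λ l lt → down k l
        (ℕₚ.≤-trans le (≡.subst (_≤ w l ℕ.+ k) (≡.sym (ℕₚ.+-suc (w m) k)) (ℕₚ.+-monoˡ-≤ k lt)))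

  private
    module By₁ = Cancellation (λ m → proj₁ m) (λ _ _ → ≡.refl)
    module By₂ = Cancellation (λ m → proj₁ (proj₂ m)) (λ _ _ → ≡.refl)
    module By₃ = Cancellation (λ m → proj₂ (proj₂ m)) (λ _ _ → ≡.refl)

  Pivot : V3 𝔽 → Set ℓ
  Pivot (a , b , d) = ¬ (a ≈ 0#) ⊎ ¬ (b ≈ 0#) ⊎ ¬ (d ≈ 0#)

  pivot : ∀ {α} → NonzeroForm 𝔽 α → Pivot α
  pivot {a , b , d} nz with FiniteField._≟_ 𝔽 a 0# | FiniteField._≟_ 𝔽 b 0# | FiniteField._≟_ 𝔽 d 0#
  ... | no a≉0  | _       | _       = inj₁ a≉0
  ... | yes _   | no b≉0  | _       = inj₂ (inj₁ b≉0)
  ... | yes _   | yes _   | no d≉0  = inj₂ (inj₂ d≉0)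
  ... | yes a≈0 | yes b≈0 | yes d≈0 = ⊥-elim (nz (a≈0 , b≈0 , d≈0))

  cancel-linP : ∀ {α} → Pivot α → ∀ {f} → linP 𝔽 α ⊠ f ≋ [] → f ≋ []
  cancel-linP {a , b , d} (inj₁ a≉0)        = By₁.cancel ≋-refl a≉0 (s≤s z≤n ∷ s≤s z≤n ∷ [])
  cancel-linP {a , b , d} (inj₂ (inj₁ b≉0)) = By₂.cancel {g' = (a , 1 , 0 , 0) ∷ (d , 0 , 0 , 1) ∷ []}
    (linear-ext λ f → solve 3 (λ x y z → x :+ (y :+ z) := y :+ (x :+ z)) refl _ _ _) b≉0 (s≤s z≤n ∷ s≤s z≤n ∷ [])
    where open IntegerSolver commRing
  cancel-linP {a , b , d} (inj₂ (inj₂ d≉0)) = By₃.cancel {g' = (a , 1 , 0 , 0) ∷ (b , 0 , 1 , 0) ∷ []}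
    (linear-ext λ f → solve 4 (λ x y z w → x :+ (y :+ (z :+ w)) := z :+ (x :+ (y :+ w))) refl _ _ _ _) d≉0 (s≤s z≤n ∷ s≤s z≤n ∷ [])
    where open IntegerSolver commRing

  minors : Vec3
  minors = 𝐱 ×³ 𝐱^q

  binomial-list : ∀ m n → (monomial m ⊞ neg (monomial n)) ≋ (1# , m) ∷ (- 1# , n) ∷ []
  binomial-list m n = linear-ext λ f → trans (linear-⊞ f (monomial m) (neg (monomial n)))
    (trans (+-congˡ (linear-neg f (monomial n))) (solve 2 (λ x y →
      (:1 :* x :+ :0) :- (:1 :* y :+ :0) := :1 :* x :+ ((:- :1) :* y :+ :0))
      refl (f m) (f n)))
    where open IntegerSolver commRing

  minors-binomial : minors ≈³ ( monomial (0 , 1 , q) ⊞ neg (monomial (0 , q , 1))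
                              , monomial (q , 0 , 1) ⊞ neg (monomial (1 , 0 , q))
                              , monomial (1 , q , 0) ⊞ neg (monomial (q , 1 , 0)))
  minors-binomial = minor (0 , 1 , 0) (0 , 0 , q) (0 , 0 , 1) (0 , q , 0)
    , minor (0 , 0 , 1) (q , 0 , 0) (1 , 0 , 0) (0 , 0 , q)
    , minor (1 , 0 , 0) (0 , q , 0) (0 , 1 , 0) (q , 0 , 0)
    where
    minor : ∀ k l m n → (monomial k ⊠ monomial l) ⊞ neg (monomial m ⊠ monomial n) ≋ monomial (k ⊕ l) ⊞ neg (monomial (m ⊕ n))
    minor k l m n = S.+-cong (monomial-⊕ k l) (S.-‿cong (monomial-⊕ m n))

  private
    1<q : 1 ℕ.< q
    1<q = ≡.subst (1 ℕ.<_) (≡.sym (proj₂ (FieldPolynomials.q≡2+ 𝔽))) (s≤s (s≤s z≤n))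

  -- The minor is x₂ x₃^q - x₂^q x₃; weighing monomials by the exponent of x₃ makes the first term
  -- strictly heavier because q > 1. The other two minors are treated with x₁ and x₂ in the role of
  -- x₃.
  cancel-minor₁ : ∀ {f} → proj₁ minors ⊠ f ≋ [] → f ≋ []
  cancel-minor₁ = By₃.cancel (≋-trans (proj₁ minors-binomial) (binomial-list (0 , 1 , q) (0 , q , 1))) 1≉0 (1<q ∷ [])

  cancel-minor₂ : ∀ {f} → proj₁ (proj₂ minors) ⊠ f ≋ [] → f ≋ []
  cancel-minor₂ = By₁.cancel (≋-trans (proj₁ (proj₂ minors-binomial)) (binomial-list (q , 0 , 1) (1 , 0 , q))) 1≉0 (1<q ∷ [])

  cancel-minor₃ : ∀ {f} → proj₂ (proj₂ minors) ⊠ f ≋ [] → f ≋ []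
  cancel-minor₃ = By₂.cancel (≋-trans (proj₂ (proj₂ minors-binomial)) (binomial-list (1 , q , 0) (q , 1 , 0))) 1≉0 (1<q ∷ [])

  ⊗-const : ∀ n f → n ⊗S f ≋ const (n ⊗F 1#) ⊠ f
  ⊗-const zero    f = ≋-sym (≋-trans (S.*-congʳ (RingMap.0-homo constMap)) (S.zeroˡ f))
  ⊗-const (suc n) f = ≋-trans (S.+-cong (≋-sym (S.*-identityˡ f)) (⊗-const n f))
    (≋-trans (≋-sym (S.distribʳ f (const 1#) (const (n ⊗F 1#)))) (S.*-congʳ (≋-sym (RingMap.+-homo constMap 1# (n ⊗F 1#)))))

  private
    sum-zero : ∀ {n} (t : Fin n → Polynomial) → (∀ k → t k ≋ []) → sum t ≋ []
    sum-zero {zero}  t z = ≋-refl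
    sum-zero {suc n} t z = ≋-trans (S.+-cong (z Fin.zero) (sum-zero (λ k → t (Fin.suc k)) (λ k → z (Fin.suc k)))) (S.+-identityˡ [])

  -- The interior terms of the binomial expansion vanish because their coefficients are zero in the
  -- field. The exponent is q itself, so no induction over powers of the characteristic is made.
  frobenius : ∀ f g → (f ⊞ g) ^ q ≋ f ^ q ⊞ g ^ q
  frobenius f g with FieldPolynomials.q≡2+ 𝔽
  ... | n , e = ≡.subst (λ k → (f ⊞ g) ^ k ≋ f ^ k ⊞ g ^ k) (≡.sym e) (≋-trans (binomial-split (suc n) f g)
    (≋-trans (S.+-congˡ (S.+-congʳ (sum-zero (middleTerm (suc n) f g) middle)))
      (≋-trans (S.+-congˡ (S.+-identityˡ _)) (S.+-comm _ _))))
    where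
    middle : ∀ k → middleTerm (suc n) f g k ≋ []
    middle k = ≋-trans (⊗-const (suc (suc n) C suc (toℕ k)) _) (≋-trans
      (S.*-congʳ (≋-trans (RingMap.to-cong constMap (≡.subst (λ i → (i C suc (toℕ k)) ⊗F 1# ≈ 0#) e (FieldPolynomials.binomial-vanishes 𝔽 e k)))
        (RingMap.0-homo constMap))) (S.zeroˡ _))

  const-^ : ∀ d n → const d ^ n ≋ const (d ^F n)
  const-^ d zero    = ≋-refl
  const-^ d (suc n) = ≋-trans (S.*-congˡ (const-^ d n)) (≋-sym (RingMap.*-homo constMap d (d ^F n)))

  const^q : ∀ d → const d ^ q ≋ const d
  const^q d = ≋-trans (const-^ d q) (RingMap.to-cong constMap (FieldPolynomials.x^q≈x 𝔽 d))

  -- The q-th power is additive and fixes the coefficients of α, so α^q = α(x₁^q, x₂^q, x₃^q). Hence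
  -- α divides α(x^q), which puts x^q in D(A).
  linP^q : ∀ α → linP 𝔽 α ^ q ≋ const³ α ∙ 𝐱^q
  linP^q α@(a , b , d) = ≋-trans (^-congˡ q (linP-∙ α)) (≋-trans (frobenius _ _) (S.+-cong
    (≋-trans (frobenius _ _) (S.+-cong (term a (X₁^ q)) (term b (X₂^ q)))) (term d (X₃^ q))))
    where
    term : ∀ d {f g} → f ^ q ≋ g → (const d ⊠ f) ^ q ≋ const d ⊠ g
    term d {f} e = ≋-trans (^-distrib-* (const d) f q) (S.*-cong (const^q d) e)

-- Linear forms as primes, the defining polynomial, and Saito's criterion

module LinearForms {c ℓ} {q : ℕ} (𝔽 : FiniteField c ℓ q) where
  open FiniteField 𝔽 hiding (_≟_)
  open PolynomialRing 𝔽
  open PolynomialEvaluation 𝔽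
  open RingVectors polyRing using (scale; _+³_; 0³; cramer; det-combination; det-rotate; det-adjoint₁; det-adjoint₂; det-adjoint₃; *-cancel-unit)
  open Algebra.Properties.Ring ring using (x∙y⁻¹≈ε⇒x≈y)
  private module S = CommutativeRing polyRing
  private module C = RingMap constMap
  open Binomials polyRing using (_^_; ^-congˡ)

  -- The vector is supported on the pivot coordinate, so the substitution x ↦ x - α(x) v changes
  -- that variable only. The minor in which that variable does not occur is then left fixed.
  dualVector : ∀ {α} → Pivot α → Σ (V3 𝔽) λ v → dot 𝔽 α v ≈ 1#
  dualVector {a , b , d} (inj₁ a≉0) = (proj₁ (inverse a a≉0) , 0# , 0#) ,
    trans (solve 4 (λ a e b d → a :* e :+ b :* :0 :+ d :* :0 := a :* e) refl a _ b d) (proj₂ (inverse a a≉0))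
    where open IntegerSolver commRing
  dualVector {a , b , d} (inj₂ (inj₁ b≉0)) = (0# , proj₁ (inverse b b≉0) , 0#) ,
    trans (solve 4 (λ a e b d → a :* :0 :+ b :* e :+ d :* :0 := b :* e) refl a _ b d) (proj₂ (inverse b b≉0))
    where open IntegerSolver commRing
  dualVector {a , b , d} (inj₂ (inj₂ d≉0)) = (0# , 0# , proj₁ (inverse d d≉0)) ,
    trans (solve 4 (λ a e b d → a :* :0 :+ b :* :0 :+ d :* e := d :* e) refl a _ b d) (proj₂ (inverse d d≉0))
    where open IntegerSolver commRing

  linP-zero : ∀ {α} → proj₁ α ≈ 0# → proj₁ (proj₂ α) ≈ 0# → proj₂ (proj₂ α) ≈ 0# → linP 𝔽 α ≋ []
  linP-zero {a , b , d} a≈0 b≈0 d≈0 = linear-ext λ f →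
    trans (+-cong (trans (*-congʳ a≈0) (zeroˡ _)) (+-cong (trans (*-congʳ b≈0) (zeroˡ _)) (+-congʳ (trans (*-congʳ d≈0) (zeroˡ _)))))
      (trans (+-identityˡ _) (trans (+-identityˡ _) (+-identityˡ _)))

  -- The substitution x ↦ x − α(x) v kills α and is the identity modulo α.
  module Reduction (α v : V3 𝔽) (αv≈1 : dot 𝔽 α v ≈ 1#) where
    L : Polynomial
    L = linP 𝔽 α

    module Shift = Substitute (X₁ ⊞ neg (const (proj₁ v) ⊠ L)) (X₂ ⊞ neg (const (proj₁ (proj₂ v)) ⊠ L))
                              (X₃ ⊞ neg (const (proj₂ (proj₂ v)) ⊠ L))
    module ρ = RingMap Shift.evalMap

    ρ : Polynomial → Polynomial
    ρ = Shift.eval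

    ρ-mod : ∀ f → f ≡ ρ f mod L
    ρ-mod = substitute-mod (shift-mod X₁ _) (shift-mod X₂ _) (shift-mod X₃ _)
      where
      open IntegerSolver polyRing
      shift-mod : ∀ x d → x ≡ (x ⊞ neg (d ⊠ L)) mod L
      shift-mod x d = d , solve 3 (λ x d l → x :- (x :- d :* l) := l :* d) ≋-refl x d L

    reduced : V3 𝔽 → V3 𝔽
    reduced β@(b₁ , b₂ , b₃) = b₁ - dot 𝔽 β v * proj₁ α , b₂ - dot 𝔽 β v * proj₁ (proj₂ α) , b₃ - dot 𝔽 β v * proj₂ (proj₂ α)

    ρ-linP : ∀ β → ρ (linP 𝔽 β) ≋ linP 𝔽 (reduced β)
    ρ-linP β@(b₁ , b₂ , b₃) = ≋-trans (Shift.eval-linP β) (≋-trans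
      (S.+-cong (S.+-cong (S.*-congˡ (via X₁ _)) (S.*-congˡ (via X₂ _))) (S.*-congˡ (via X₃ _))) (≋-trans
      (solve 12 (λ b₁ b₂ b₃ a₁ a₂ a₃ v₁ v₂ v₃ x₁ x₂ x₃ →
        let l = a₁ :* x₁ :+ a₂ :* x₂ :+ a₃ :* x₃ ; w = b₁ :* v₁ :+ b₂ :* v₂ :+ b₃ :* v₃ in
        b₁ :* (x₁ :- v₁ :* l) :+ b₂ :* (x₂ :- v₂ :* l) :+ b₃ :* (x₃ :- v₃ :* l)
        := (b₁ :- w :* a₁) :* x₁ :+ (b₂ :- w :* a₂) :* x₂ :+ (b₃ :- w :* a₃) :* x₃) ≋-refl
        (const b₁) (const b₂) (const b₃) (const (proj₁ α)) (const (proj₁ (proj₂ α))) (const (proj₂ (proj₂ α)))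
        (const (proj₁ v)) (const (proj₁ (proj₂ v))) (const (proj₂ (proj₂ v))) X₁ X₂ X₃)
      (≋-sym (≋-trans (linP-∙ (reduced β)) (S.+-cong (S.+-cong (S.*-congʳ (coordinate _ _)) (S.*-congʳ (coordinate _ _))) (S.*-congʳ (coordinate _ _)))))))
      where
      open IntegerSolver polyRing
      via : ∀ x d → x ⊞ neg (d ⊠ L) ≋ x ⊞ neg (d ⊠ (const³ α ∙ 𝐱))
      via x d = S.+-congˡ (S.-‿cong (S.*-congˡ (linP-∙ α)))
      coordinate : ∀ b a → const (b - dot 𝔽 β v * a) ≋ const b ⊞ neg ((const³ β ∙ const³ v) ⊠ const a)
      coordinate b a = ≋-trans (C.+-homo b _) (S.+-congˡ (≋-trans (C.-‿homo _) (S.-‿cong (≋-trans (C.*-homo _ a) (S.*-congʳ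
        (≋-trans (C.+-homo _ _) (S.+-cong (≋-trans (C.+-homo _ _) (S.+-cong (C.*-homo _ _) (C.*-homo _ _))) (C.*-homo _ _))))))))

    ρL≋0 : ρ L ≋ []
    ρL≋0 = ≋-trans (ρ-linP α) (linP-zero (vanish _) (vanish _) (vanish _))
      where
      vanish : ∀ a → a - dot 𝔽 α v * a ≈ 0#
      vanish a = trans (+-congˡ (-‿cong (trans (*-congʳ αv≈1) (*-identityˡ a)))) (-‿inverseʳ a)

    ∣⇒ρ≋0 : ∀ {f} → L ∣ f → ρ f ≋ []
    ∣⇒ρ≋0 {f} (g , e) = ≋-trans (ρ.to-cong e) (≋-trans (ρ.*-homo L g) (≋-trans (S.*-congʳ ρL≋0) (S.zeroˡ _)))

    -- Together with `∣⇒ρ≋0` this identifies the kernel of `ρ` with the ideal (α). Computations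
    -- modulo α become computations in S, where the cancellation lemmas apply.
    ρ≋0⇒∣ : ∀ {f} → ρ f ≋ [] → L ∣ f
    ρ≋0⇒∣ {f} z = ∣-resp (≋-trans (S.+-congˡ (≋-trans (S.-‿cong z) (Algebra.Properties.Ring.-0#≈0# S.ring))) (S.+-identityʳ f)) (ρ-mod f)

    ρ-monomial : ∀ i j k → i ≡ 0 ⊎ proj₁ v ≈ 0# → j ≡ 0 ⊎ proj₁ (proj₂ v) ≈ 0# → k ≡ 0 ⊎ proj₂ (proj₂ v) ≈ 0# →
                 ρ (monomial (i , j , k)) ≋ monomial (i , j , k)
    ρ-monomial i j k p₁ p₂ p₃ = ≋-trans (Shift.eval-monomial (i , j , k))
      (≋-trans (S.*-cong (power i p₁) (S.*-cong (power j p₂) (power k p₃))) (monomial-product (i , j , k)))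
      where
      power : ∀ i {d x} → i ≡ 0 ⊎ d ≈ 0# → (x ⊞ neg (const d ⊠ L)) ^ i ≋ x ^ i
      power i {d} {x} (inj₁ ≡.refl) = ≋-refl
      power i {d} {x} (inj₂ d≈0)    = ^-congˡ i (≋-trans (S.+-congˡ (S.-‿cong (≋-trans (S.*-congʳ (≋-trans (C.to-cong d≈0) C.0-homo)) (S.zeroˡ L))))
        (≋-trans (S.+-congˡ (Algebra.Properties.Ring.-0#≈0# S.ring)) (S.+-identityʳ x)))

    ρ-fixed : ∀ {f m n} → f ≋ monomial m ⊞ neg (monomial n) → ρ (monomial m) ≋ monomial m → ρ (monomial n) ≋ monomial n → ρ f ≋ f
    ρ-fixed e p r = ≋-trans (ρ.to-cong e) (≋-trans (ρ.+-homo _ _) (≋-trans (S.+-cong p (≋-trans (ρ.-‿homo _) (S.-‿cong r))) (≋-sym e)))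

    -- Applying `ρ` to f m gives ρ(f) m = 0, since m is fixed; cancelling m leaves ρ(f) = 0.
    ∣-cancel-fixed : ∀ {f m} → (m ⊠ ρ f ≋ [] → ρ f ≋ []) → ρ m ≋ m → L ∣ (f ⊠ m) → L ∣ f
    ∣-cancel-fixed {f} {m} cancel fixed L∣fm = ρ≋0⇒∣ (cancel (≋-trans (S.*-comm _ _)
      (≋-trans (S.*-congˡ (≋-sym fixed)) (≋-trans (≋-sym (ρ.*-homo f m)) (∣⇒ρ≋0 L∣fm)))))

    -- If β - β(v) α vanished, β would be β(v) times α, with a factor that is nonzero because β is.
    -- The two hyperplanes would then coincide.
    reduced-nonzero : ∀ {β} → NonzeroForm 𝔽 β → DistinctHyperplanes 𝔽 β α → NonzeroForm 𝔽 (reduced β)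
    reduced-nonzero {β@(b₁ , b₂ , b₃)} β≉0 distinctβα (z₁ , z₂ , z₃) = distinctβα λ w →
        mk⇔ (λ βw≈0 → *-cancelˡ-0 βv≉0 (trans (sym (proportional w)) βw≈0))
            (λ αw≈0 → trans (proportional w) (trans (*-congˡ αw≈0) (zeroʳ _)))
      where
      open FieldPolynomials 𝔽 using (*-cancelˡ-0)
      open IntegerSolver commRing
      e₁ = x∙y⁻¹≈ε⇒x≈y _ _ z₁
      e₂ = x∙y⁻¹≈ε⇒x≈y _ _ z₂
      e₃ = x∙y⁻¹≈ε⇒x≈y _ _ z₃
      βv≉0 : ¬ (dot 𝔽 β v ≈ 0#)
      βv≉0 z = β≉0 (trans e₁ (trans (*-congʳ z) (zeroˡ _)) , trans e₂ (trans (*-congʳ z) (zeroˡ _)) , trans e₃ (trans (*-congʳ z) (zeroˡ _)))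
      proportional : ∀ w → dot 𝔽 β w ≈ dot 𝔽 β v * dot 𝔽 α w
      proportional w@(w₁ , w₂ , w₃) = trans (+-cong (+-cong (*-congʳ e₁) (*-congʳ e₂)) (*-congʳ e₃))
        (solve 7 (λ s a b c x y z → (s :* a) :* x :+ (s :* b) :* y :+ (s :* c) :* z := s :* (a :* x :+ b :* y :+ c :* z)) refl _ _ _ _ w₁ w₂ w₃)

  -- Modulo α the form β becomes the form `reduced β`, which is nonzero for distinct hyperplanes and
  -- can therefore be cancelled.
  linP-prime : ∀ {α β} → NonzeroForm 𝔽 α → NonzeroForm 𝔽 β → DistinctHyperplanes 𝔽 β α → ∀ {g} →
               linP 𝔽 α ∣ (linP 𝔽 β ⊠ g) → linP 𝔽 α ∣ g
  linP-prime {α} {β} α≉0 β≉0 dβα {g} α∣βg with dualVector (pivot α≉0)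
  ... | v , αv≈1 = ρ≋0⇒∣ (cancel-linP (pivot (reduced-nonzero β≉0 dβα))
                      (≋-trans (S.*-congʳ (≋-sym (ρ-linP β))) (≋-trans (≋-sym (ρ.*-homo (linP 𝔽 β) g)) (∣⇒ρ≋0 α∣βg))))
    where open Reduction α v αv≈1

  definingPolynomial : List (V3 𝔽) → Polynomial
  definingPolynomial = foldr (λ α p → linP 𝔽 α ⊠ p) (const 1#)

  -- After the quotient g by α is taken, each remaining β divides α g and hence g, as the two forms
  -- are coprime. This induction takes the place of unique factorisation.
  product-∣ : ∀ {A} → IsArrangement 𝔽 A → ∀ {f} → All (λ α → linP 𝔽 α ∣ f) A → definingPolynomial A ∣ f
  product-∣ {[]}    _ {f} _ = f , ≋-sym (S.*-identityˡ f)
  product-∣ {α ∷ A} (α≉0 ∷ A≉0 , dα ∷ dA) {f} ((g , e) ∷ ds)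
    with product-∣ (A≉0 , dA) {g} (others A≉0 dα ds)
    where
    others : ∀ {B} → All (NonzeroForm 𝔽) B → All (DistinctHyperplanes 𝔽 α) B → All (λ β → linP 𝔽 β ∣ f) B → All (λ β → linP 𝔽 β ∣ g) B
    others []       []         []       = []
    others (n ∷ ns) (d ∷ ds') (p ∷ ps) = linP-prime n α≉0 d (∣-resp e p) ∷ others ns ds' ps
  ... | h , e' = h , ≋-trans e (≋-trans (S.*-congˡ e') (≋-sym (S.*-assoc _ _ _)))

  cancel-product : ∀ {A} → All (NonzeroForm 𝔽) A → ∀ {f} → definingPolynomial A ⊠ f ≋ [] → f ≋ []
  cancel-product []       {f} z = ≋-trans (≋-sym (S.*-identityˡ f)) z
  cancel-product (n ∷ ns) {f} z = cancel-product ns (cancel-linP (pivot n) (≋-trans (≋-sym (S.*-assoc _ _ _)) z))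

  cancel-product-≋ : ∀ {A} → All (NonzeroForm 𝔽) A → ∀ {f g} → definingPolynomial A ⊠ f ≋ definingPolynomial A ⊠ g → f ≋ g
  cancel-product-≋ {A} ns {f} {g} e = Algebra.Properties.Ring.x∙y⁻¹≈ε⇒x≈y S.ring f g (cancel-product ns
    (≋-trans (solve 3 (λ a f g → a :* (f :- g) := a :* f :- a :* g) ≋-refl (definingPolynomial A) f g)
      (≋-trans (S.+-congʳ e) (S.-‿inverseʳ _))))
    where open IntegerSolver polyRing

  factors-∣ : ∀ A → All (λ α → linP 𝔽 α ∣ definingPolynomial A) A
  factors-∣ []      = []
  factors-∣ (α ∷ A) = ∣-self _ ∷ All.map (∣-*ˡ (linP 𝔽 α)) (factors-∣ A)

  -- For δ = Σ uᵢ ∂ᵢ the value δ(α) is the pairing of α with u, so this is membership in D(A),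
  -- written with the opaque ring operations.
  Logarithmic : List (V3 𝔽) → Vec3 → Set _
  Logarithmic A u = All (λ α → linP 𝔽 α ∣ (const³ α ∙ u)) A

  descale : ∀ {l d a x y z r s t} → ¬ (a ≈ 0#) → d ⊠ const a ≋ x ⊠ r ⊞ y ⊠ s ⊞ z ⊠ t → l ∣ x → l ∣ y → l ∣ z → l ∣ d
  descale {a = a} {r = r} {s} {t} a≉0 e px py pz with inverse a a≉0
  ... | b , ab≈1 = ∣-resp (*-cancel-unit _ (≋-trans (≋-sym (C.*-homo a b)) (C.to-cong ab≈1)))
                     (∣-*ʳ (const b) (∣-resp (≋-sym e) (∣-+ (∣-+ (∣-*ʳ r px) (∣-*ʳ s py)) (∣-*ʳ t pz))))

  det-∣ : ∀ {α} → NonzeroForm 𝔽 α → ∀ {u v w} → linP 𝔽 α ∣ (const³ α ∙ u) → linP 𝔽 α ∣ (const³ α ∙ v) → linP 𝔽 α ∣ (const³ α ∙ w) →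
          linP 𝔽 α ∣ det u v w
  det-∣ {α} α≉0 {u} {v} {w} pu pv pw with pivot α≉0
  ... | inj₁ a≉0        = descale a≉0 (det-adjoint₁ (const³ α) u v w) pu pv pw
  ... | inj₂ (inj₁ b≉0) = descale b≉0 (det-adjoint₂ (const³ α) u v w) pu pv pw
  ... | inj₂ (inj₂ d≉0) = descale d≉0 (det-adjoint₃ (const³ α) u v w) pu pv pw

  product-∣-det : ∀ {A} → IsArrangement 𝔽 A → ∀ {u v w} → Logarithmic A u → Logarithmic A v → Logarithmic A w →
                  definingPolynomial A ∣ det u v w
  product-∣-det arr@(ns , _) {u} {v} {w} pu pv pw = product-∣ arr (go ns pu pv pw)
    where
    go : ∀ {B} → All (NonzeroForm 𝔽) B → Logarithmic B u → Logarithmic B v → Logarithmic B w → All (λ α → linP 𝔽 α ∣ det u v w) B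
    go []       []       []       []       = []
    go (n ∷ ns) (a ∷ as) (b ∷ bs) (d ∷ ds) = det-∣ n {u} {v} {w} a b d ∷ go ns as bs ds

  euler-∣ : ∀ α → linP 𝔽 α ∣ (const³ α ∙ 𝐱)
  euler-∣ α = const 1# , ≋-trans (≋-sym (linP-∙ α)) (≋-sym (S.*-identityʳ _))

  frobenius-∣ : ∀ α → linP 𝔽 α ∣ (const³ α ∙ 𝐱^q)
  frobenius-∣ α with FieldPolynomials.q≡2+ 𝔽
  ... | n , e = linP 𝔽 α ^ suc n , ≋-trans (≋-sym (linP^q α)) (S.reflexive (cong (linP 𝔽 α ^_) e))

  euler-logarithmic : ∀ A → Logarithmic A 𝐱
  euler-logarithmic A = All.tabulate λ {α} _ → euler-∣ α

  frobenius-logarithmic : ∀ A → Logarithmic A 𝐱^q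
  frobenius-logarithmic A = All.tabulate λ {α} _ → frobenius-∣ α

  -- Modulo α the fields 𝐱 and 𝐱^q both become tangent to the hyperplane, so a third
  -- field completing them to a determinant divisible by α must be tangent as well.
  third-∣ : ∀ {α} → NonzeroForm 𝔽 α → ∀ w → linP 𝔽 α ∣ det 𝐱 𝐱^q w → linP 𝔽 α ∣ (const³ α ∙ w)
  third-∣ {α} α≉0 w α∣det = cases (pivot α≉0)
    where
    remainder : ∀ {d a x y z r s t} → d ⊠ a ≋ x ⊠ r ⊞ y ⊠ s ⊞ z ⊠ t → linP 𝔽 α ∣ d → linP 𝔽 α ∣ x → linP 𝔽 α ∣ y → linP 𝔽 α ∣ (z ⊠ t)
    remainder {d} {a} {x} {y} {z} {r} {s} {t} e pd px py = ∣-resp (≋-trans (S.+-congʳ (S.+-congʳ e))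
      (solve 6 (λ x y z r s t → (x :* r :+ y :* s :+ z :* t) :+ x :* (:- r) :+ y :* (:- s) := z :* t) ≋-refl x y z r s t))
      (∣-+ (∣-+ (∣-*ʳ a pd) (∣-*ʳ (neg r) px)) (∣-*ʳ (neg s) py))
      where open IntegerSolver polyRing
    cases : Pivot α → linP 𝔽 α ∣ (const³ α ∙ w)
    -- If the first coefficient of α is nonzero, the first coordinate of the cofactor identity
    -- leaves α dividing (α∙w) times the first minor. That minor is free of x₁, the only variable
    -- moved by `ρ`, so it is fixed and can be cancelled. The two remaining cases permute the
    -- coordinates.
    cases p@(inj₁ _) = ∣-cancel-fixed cancel-minor₁
        (ρ-fixed (proj₁ minors-binomial) (ρ-monomial 0 1 q (inj₁ ≡.refl) (inj₂ refl) (inj₂ refl)) (ρ-monomial 0 q 1 (inj₁ ≡.refl) (inj₂ refl) (inj₂ refl)))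
        (remainder (det-adjoint₁ (const³ α) 𝐱 𝐱^q w) α∣det (euler-∣ α) (frobenius-∣ α))
      where open Reduction α (proj₁ (dualVector p)) (proj₂ (dualVector p))
    cases p@(inj₂ (inj₁ _)) = ∣-cancel-fixed cancel-minor₂
        (ρ-fixed (proj₁ (proj₂ minors-binomial)) (ρ-monomial q 0 1 (inj₂ refl) (inj₁ ≡.refl) (inj₂ refl)) (ρ-monomial 1 0 q (inj₂ refl) (inj₁ ≡.refl) (inj₂ refl)))
        (remainder (det-adjoint₂ (const³ α) 𝐱 𝐱^q w) α∣det (euler-∣ α) (frobenius-∣ α))
      where open Reduction α (proj₁ (dualVector p)) (proj₂ (dualVector p))
    cases p@(inj₂ (inj₂ _)) = ∣-cancel-fixed cancel-minor₃
        (ρ-fixed (proj₂ (proj₂ minors-binomial)) (ρ-monomial 1 q 0 (inj₂ refl) (inj₂ refl) (inj₁ ≡.refl)) (ρ-monomial q 1 0 (inj₂ refl) (inj₂ refl) (inj₁ ≡.refl)))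
        (remainder (det-adjoint₃ (const³ α) 𝐱 𝐱^q w) α∣det (euler-∣ α) (frobenius-∣ α))
      where open Reduction α (proj₁ (dualVector p)) (proj₂ (dualVector p))

  record DerivationBasis (A : List (V3 𝔽)) (u v w : Vec3) : Set (c ⊔ ℓ) where
    field
      spanning    : ∀ d → Logarithmic A d → Σ Vec3 λ (f , g , h) → d ≈³ (scale f u +³ (scale g v +³ scale h w))
      independent : ∀ f g h → (scale f u +³ (scale g v +³ scale h w)) ≈³ 0³ → (f ≋ []) × (g ≋ []) × (h ≋ [])

  -- Cramer's rule expresses Q δ through u, v, w with determinants of logarithmic fields as
  -- coefficients. Each of these is divisible by Q, and cancelling Q gives the coordinates of δ. For
  -- independence, the determinant with one column replaced by the vanishing combination is a
  -- coefficient times Q.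
  saito : ∀ {A} → IsArrangement 𝔽 A → ∀ {u v w} → Logarithmic A u → Logarithmic A v → Logarithmic A w →
          det u v w ≋ definingPolynomial A → DerivationBasis A u v w
  saito {A} arr {u} {v} {w} pu pv pw e = record { spanning = spanning ; independent = independent }
    where
    Q = definingPolynomial A
    spanning : ∀ d → Logarithmic A d → Σ Vec3 λ (f , g , h) → d ≈³ (scale f u +³ (scale g v +³ scale h w))
    spanning d pd with product-∣-det arr {d} {v} {w} pd pv pw | product-∣-det arr {u} {d} {w} pu pd pw | product-∣-det arr {u} {v} {d} pu pv pd
    ... | f , ef | g , eg | h , eh = (f , g , h) , coordinate (proj₁ cr) , coordinate (proj₁ (proj₂ cr)) , coordinate (proj₂ (proj₂ cr))
      where
      open IntegerSolver polyRing
      cr = cramer d u v w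
      coordinate : ∀ {x a b k} → det u v w ⊠ x ≋ det d v w ⊠ a ⊞ (det u d w ⊠ b ⊞ det u v d ⊠ k) → x ≋ f ⊠ a ⊞ (g ⊠ b ⊞ h ⊠ k)
      coordinate {x} {a} {b} {k} cr = cancel-product-≋ (proj₁ arr) (≋-trans (S.*-congʳ (≋-sym e)) (≋-trans cr (≋-trans
        (S.+-cong (S.*-congʳ ef) (S.+-cong (S.*-congʳ eg) (S.*-congʳ eh)))
        (solve 7 (λ q f g h a b k → (q :* f) :* a :+ ((q :* g) :* b :+ (q :* h) :* k) := q :* (f :* a :+ (g :* b :+ h :* k))) ≋-refl Q f g h a b k))))
    independent : ∀ f g h → (scale f u +³ (scale g v +³ scale h w)) ≈³ 0³ → (f ≋ []) × (g ≋ []) × (h ≋ [])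
    -- `first` treats only the coefficient of the leading vector; cyclic rotation brings the other
    -- two to the front without changing the determinant.
    independent f g h z@(z₁ , z₂ , z₃) = first f z e
        , first g (rotate z₁ , rotate z₂ , rotate z₃) (≋-trans (≋-sym (det-rotate u v w)) e)
        , first h (rotate′ z₁ , rotate′ z₂ , rotate′ z₃) (≋-trans (det-rotate w u v) e)
      where
      open IntegerSolver polyRing
      rotate : ∀ {x y k} → x ⊞ (y ⊞ k) ≋ [] → y ⊞ (k ⊞ x) ≋ []
      rotate {x} {y} {k} = ≋-trans (solve 3 (λ x y k → y :+ (k :+ x) := x :+ (y :+ k)) ≋-refl x y k)
      rotate′ : ∀ {x y k} → x ⊞ (y ⊞ k) ≋ [] → k ⊞ (x ⊞ y) ≋ []
      rotate′ {x} {y} {k} = ≋-trans (solve 3 (λ x y k → k :+ (x :+ y) := x :+ (y :+ k)) ≋-refl x y k)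
      first : ∀ {g h u v w} f → (scale f u +³ (scale g v +³ scale h w)) ≈³ 0³ → det u v w ≋ Q → f ≋ []
      first {g} {h} {u} {v} {w} f z e = cancel-product (proj₁ arr) (≋-trans (S.*-comm Q f) (≋-trans (S.*-congˡ (≋-sym e))
        (≋-trans (≋-sym (det-combination f g h u v w)) (≋-trans (det-cong {v = v} {v} {w} {w} z v≈v w≈w) zero-det))))
        where
        v≈v : v ≈³ v
        v≈v = ≋-refl , ≋-refl , ≋-refl
        w≈w : w ≈³ w
        w≈w = ≋-refl , ≋-refl , ≋-refl
        zero-det : det 0³ v w ≋ []
        zero-det = ≋-trans (S.+-cong (S.+-cong (S.zeroˡ _) (S.zeroˡ _)) (S.zeroˡ _)) (≋-trans (S.+-identityʳ _) (S.+-identityʳ _))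

-- Polynomials vanishing on V as combinations of the minors

module VanishingIdeal {c ℓ} {q : ℕ} (𝔽 : FiniteField c ℓ q) where
  open FiniteField 𝔽 hiding (_≟_)
  open PolynomialRing 𝔽
  open PolynomialEvaluation 𝔽
  open FieldPolynomials 𝔽 using (vanishing-terms; value; coefficient; x^q≈x; one^; q≡2+; Term)
  open RingVectors polyRing using (0³)
  open Binomials commRing using (_^_)
  private module S = CommutativeRing polyRing

  degree : Exponent → ℕ
  degree = deg 𝔽

  ++≋⊞ : ∀ p r → p ++ r ≋ p ⊞ r
  ++≋⊞ p r = S.reflexive (≡.sym (⊞-def p r))

  infixl 6 _⧺_
  _⧺_ : Vec3 → Vec3 → Vec3
  (f₁ , f₂ , f₃) ⧺ (g₁ , g₂ , g₃) = f₁ ++ g₁ , f₂ ++ g₂ , f₃ ++ g₃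

  ⧺-∙ : ∀ f g h → (f ⧺ g) ∙ h ≋ f ∙ h ⊞ g ∙ h
  ⧺-∙ (f₁ , f₂ , f₃) (g₁ , g₂ , g₃) (h₁ , h₂ , h₃) = ≋-trans
    (S.+-cong (S.+-cong (S.*-congʳ (++≋⊞ f₁ g₁)) (S.*-congʳ (++≋⊞ f₂ g₂))) (S.*-congʳ (++≋⊞ f₃ g₃)))
    (solve 9 (λ f₁ f₂ f₃ g₁ g₂ g₃ h₁ h₂ h₃ → (f₁ :+ g₁) :* h₁ :+ (f₂ :+ g₂) :* h₂ :+ (f₃ :+ g₃) :* h₃
      := (f₁ :* h₁ :+ f₂ :* h₂ :+ f₃ :* h₃) :+ (g₁ :* h₁ :+ g₂ :* h₂ :+ g₃ :* h₃)) ≋-refl f₁ f₂ f₃ g₁ g₂ g₃ h₁ h₂ h₃)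
    where open IntegerSolver polyRing

  -- The normal monomials for the rewriting rules x_i^q x_j → x_i x_j^q (i < j),
  -- sorted by the last variable that occurs.
  Pure Edge Inner : ℕ → Exponent → Set
  Pure  n (i , j , k) = i ≡ n × j ≡ 0 × k ≡ 0
  Edge  n (i , j , k) = i < q × 1 ≤ j × k ≡ 0 × i ℕ.+ j ≡ n
  Inner n (i , j , k) = i < q × j < q × 1 ≤ k × i ℕ.+ j ℕ.+ k ≡ n

  HasDegree : ℕ → Carrier × Exponent → Set
  HasDegree n t = degree (proj₂ t) ≡ n

  -- The degree n - q - 1, written as a sum to avoid truncated subtraction. It is demanded of every
  -- listed term, even of those that cancel, so that a single term determines the common degree.
  QuotientDegree : ℕ → Vec3 → Set c
  QuotientDegree n (g₁ , g₂ , g₃) = All P g₁ × All P g₂ × All P g₃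
    where
    P : Carrier × Exponent → Set
    P t = suc q ℕ.+ degree (proj₂ t) ≡ n

  record Reduced (n : ℕ) (f : Polynomial) : Set (c ⊔ ℓ) where
    field
      pure edge inner : Polynomial
      quotient        : Vec3
      all-pure        : All (λ t → Pure n (proj₂ t)) pure
      all-edge        : All (λ t → Edge n (proj₂ t)) edge
      all-inner       : All (λ t → Inner n (proj₂ t)) inner
      quotient-degree : QuotientDegree n quotient
      decomposition   : f ≋ pure ⊞ (edge ⊞ (inner ⊞ quotient ∙ minors))

  without-quotient : ∀ {f g h k} → f ≋ g ⊞ (h ⊞ (k ⊞ [])) → f ≋ g ⊞ (h ⊞ (k ⊞ 0³ ∙ minors))
  without-quotient e = ≋-trans e (S.+-congˡ (S.+-congˡ (S.+-congˡ
    (let (m₁ , m₂ , m₃) = minors in solve 3 (λ x y z → :0 := :0 :* x :+ :0 :* y :+ :0 :* z) ≋-refl m₁ m₂ m₃))))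
    where open IntegerSolver polyRing

  reduced-[] : ∀ {n} → Reduced n []
  reduced-[] = record
    { pure = [] ; edge = [] ; inner = [] ; quotient = 0³ ; all-pure = [] ; all-edge = [] ; all-inner = []
    ; quotient-degree = [] , [] , []
    ; decomposition = without-quotient (solve 0 (:0 := :0 :+ (:0 :+ (:0 :+ :0))) ≋-refl) }
    where open IntegerSolver polyRing

  quotient-degree-⧺ : ∀ {n} f g → QuotientDegree n f → QuotientDegree n g → QuotientDegree n (f ⧺ g)
  quotient-degree-⧺ _ _ (a₁ , a₂ , a₃) (b₁ , b₂ , b₃) = Allₚ.++⁺ a₁ b₁ , Allₚ.++⁺ a₂ b₂ , Allₚ.++⁺ a₃ b₃

  reduced-++ : ∀ {n f g} → Reduced n f → Reduced n g → Reduced n (f ++ g)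
  reduced-++ {n} {f} {g} r s = record
    { pure = r.pure ++ s.pure ; edge = r.edge ++ s.edge ; inner = r.inner ++ s.inner ; quotient = r.quotient ⧺ s.quotient
    ; all-pure = Allₚ.++⁺ r.all-pure s.all-pure ; all-edge = Allₚ.++⁺ r.all-edge s.all-edge
    ; all-inner = Allₚ.++⁺ r.all-inner s.all-inner
    ; quotient-degree = quotient-degree-⧺ r.quotient s.quotient r.quotient-degree s.quotient-degree
    ; decomposition = ≋-trans (++≋⊞ f g) (≋-trans (S.+-cong r.decomposition s.decomposition) (≋-trans
        (solve 8 (λ a b c d a' b' c' d' → (a :+ (b :+ (c :+ d))) :+ (a' :+ (b' :+ (c' :+ d')))
          := (a :+ a') :+ ((b :+ b') :+ ((c :+ c') :+ (d :+ d')))) ≋-refl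
          r.pure r.edge r.inner (r.quotient ∙ minors) s.pure s.edge s.inner (s.quotient ∙ minors))
        (S.+-cong (≋-sym (++≋⊞ _ _)) (S.+-cong (≋-sym (++≋⊞ _ _)) (S.+-cong (≋-sym (++≋⊞ _ _)) (≋-sym (⧺-∙ r.quotient s.quotient minors))))))) }
    where
    module r = Reduced r
    module s = Reduced s
    open IntegerSolver polyRing

  reduced-step : ∀ {n f f'} g → QuotientDegree n g → f ≋ f' ⊞ g ∙ minors → Reduced n f' → Reduced n f
  reduced-step {n} {f} {f'} g dg e r = record
    { Reduced r ; quotient = r.quotient ⧺ g ; quotient-degree = quotient-degree-⧺ r.quotient g r.quotient-degree dg
    ; decomposition = ≋-trans e (≋-trans (S.+-congʳ r.decomposition) (≋-trans
        (solve 5 (λ a b c d e → (a :+ (b :+ (c :+ d))) :+ e := a :+ (b :+ (c :+ (d :+ e)))) ≋-refl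
          r.pure r.edge r.inner (r.quotient ∙ minors) (g ∙ minors))
        (S.+-congˡ (S.+-congˡ (S.+-congˡ (≋-sym (⧺-∙ r.quotient g minors))))))) }
    where
    module r = Reduced r
    open IntegerSolver polyRing

  linear-binomial : ∀ (h : Exponent → Carrier) m n → linear h (monomial m ⊞ neg (monomial n)) ≈ h m - h n
  linear-binomial h m n = trans (linear-⊞ h (monomial m) (neg (monomial n)))
    (+-cong (simplify m) (trans (linear-neg h (monomial n)) (-‿cong (simplify n))))
    where
    simplify : ∀ m → linear h (monomial m) ≈ h m
    simplify m = trans (+-identityʳ _) (*-identityˡ _)

  private
    -- The weights 2, 1, 0 of x₁, x₂, x₃. Each rewriting rule moves q - 1 exponents to a later
    -- variable at constant degree, so this number drops strictly.
    measure : Exponent → ℕ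
    measure (i , j , k) = i ℕ.+ (i ℕ.+ j)

    1<q : 1 < q
    1<q = ≡.subst (1 ℕ.<_) (≡.sym (proj₂ q≡2+)) (s≤s (s≤s z≤n))

  degree-⊕ : ∀ m n → degree (m ⊕ n) ≡ degree n ℕ.+ degree m
  degree-⊕ (i , j , k) (i' , j' , k') = lemma i j k i' j' k'
    where
    lemma : ∀ i j k i' j' k' → (i ℕ.+ i') ℕ.+ (j ℕ.+ j') ℕ.+ (k ℕ.+ k') ≡ (i' ℕ.+ j' ℕ.+ k') ℕ.+ (i ℕ.+ j ℕ.+ k)
    lemma = ℕ-Solver.solve-∀

  -- `place` puts the multiplier into the slot of the minor behind the rule, and `sign` corrects for
  -- the order of its two terms: it negates when the monomial to be replaced is the subtracted one.
  -- Both degrees equal q + 1, which keeps every rewriting homogeneous.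
  record Rule (m n : Exponent) : Set (c ⊔ ℓ) where
    field
      place        : Polynomial → Vec3
      place-degree : ∀ {d p} → All (λ t → suc q ℕ.+ degree (proj₂ t) ≡ d) p → QuotientDegree d (place p)
      sign         : Carrier → Carrier
      rewrites     : ∀ e l → ((e , l ⊕ m) ∷ []) ≋ ((e , l ⊕ n) ∷ []) ⊞ place ((sign e , l) ∷ []) ∙ minors
      degree-from  : degree m ≡ suc q
      degree-to    : degree n ≡ suc q
      decreases    : ∀ l → measure (l ⊕ n) < measure (l ⊕ m)

  private
    rewrite-term : ∀ e l {f g m n} → f ≋ monomial m ⊞ neg (monomial n) → ((e , l) ∷ []) ⊠ f ≋ g →
      ((e , l ⊕ m) ∷ []) ≋ ((e , l ⊕ n) ∷ []) ⊞ g
    rewrite-term e l {f} {g} {m} {n} f≋ g≋ = ≋-trans (linear-ext λ h → sym (trans (linear-⊞ h ((e , l ⊕ n) ∷ []) _)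
      (trans (+-congˡ (trans (linear-⊠ h ((e , l) ∷ []) f) (+-congʳ (*-congˡ (trans (linear-resp _ f≋) (linear-binomial _ m n))))))
      (solve 3 (λ e x y → (e :* y :+ :0) :+ (e :* (x :- y) :+ :0) := e :* x :+ :0) refl e (h (l ⊕ m)) (h (l ⊕ n))))))
      (S.+-congˡ g≋)
      where open IntegerSolver commRing

    rewrite-term⁻ : ∀ e l {f g m n} → f ≋ monomial n ⊞ neg (monomial m) → ((- e , l) ∷ []) ⊠ f ≋ g →
      ((e , l ⊕ m) ∷ []) ≋ ((e , l ⊕ n) ∷ []) ⊞ g
    rewrite-term⁻ e l {f} {g} {m} {n} f≋ g≋ = ≋-trans (linear-ext λ h → sym (trans (linear-⊞ h ((e , l ⊕ n) ∷ []) _)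
      (trans (+-congˡ (trans (linear-⊠ h ((- e , l) ∷ []) f) (+-congʳ (*-congˡ (trans (linear-resp _ f≋) (linear-binomial _ n m))))))
      (solve 3 (λ e x y → (e :* y :+ :0) :+ ((:- e) :* (y :- x) :+ :0) := e :* x :+ :0) refl e (h (l ⊕ m)) (h (l ⊕ n))))))
      (S.+-congˡ g≋)
      where open IntegerSolver commRing

  rule₁ : Rule (0 , q , 1) (0 , 1 , q)
  rule₁ = record
    { place = λ p → p , [] , [] ; place-degree = λ d → d , [] , [] ; sign = -_
    ; rewrites = λ e l → rewrite-term⁻ e l (proj₁ minors-binomial)
        (solve 4 (λ f x y z → f :* x := f :* x :+ :0 :* y :+ :0 :* z) ≋-refl _ _ _ _)
    ; degree-from = ℕₚ.+-comm q 1 ; degree-to = ≡.refl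
    ; decreases = λ (i , j , _) → ℕₚ.+-monoʳ-< (i ℕ.+ 0) (ℕₚ.+-monoʳ-< (i ℕ.+ 0) (ℕₚ.+-monoʳ-< j 1<q)) }
    where open IntegerSolver polyRing

  rule₂ : Rule (q , 0 , 1) (1 , 0 , q)
  rule₂ = record
    { place = λ p → [] , p , [] ; place-degree = λ d → [] , d , [] ; sign = λ e → e
    ; rewrites = λ e l → rewrite-term e l (proj₁ (proj₂ minors-binomial))
        (solve 4 (λ f x y z → f :* y := :0 :* x :+ f :* y :+ :0 :* z) ≋-refl _ _ _ _)
    ; degree-from = ≡.trans (cong (ℕ._+ 1) (ℕₚ.+-identityʳ q)) (ℕₚ.+-comm q 1) ; degree-to = ≡.refl
    ; decreases = λ (i , j , _) → ℕₚ.+-mono-< (ℕₚ.+-monoʳ-< i 1<q) (ℕₚ.+-monoˡ-< (j ℕ.+ 0) (ℕₚ.+-monoʳ-< i 1<q)) }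
    where open IntegerSolver polyRing

  rule₃ : Rule (q , 1 , 0) (1 , q , 0)
  rule₃ = record
    { place = λ p → [] , [] , p ; place-degree = λ d → [] , [] , d ; sign = -_
    ; rewrites = λ e l → rewrite-term⁻ e l (proj₂ (proj₂ minors-binomial))
        (solve 4 (λ f x y z → f :* z := :0 :* x :+ :0 :* y :+ f :* z) ≋-refl _ _ _ _)
    ; degree-from = ≡.trans (ℕₚ.+-identityʳ (q ℕ.+ 1)) (ℕₚ.+-comm q 1) ; degree-to = ℕₚ.+-identityʳ (suc q)
    ; decreases = λ (i , j , _) → ≡.subst₂ _<_ (lhs i j q) (rhs i j q) (ℕₚ.+-monoʳ-< (i ℕ.+ (i ℕ.+ j) ℕ.+ suc q) 1<q) }
    where
    open IntegerSolver polyRing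
    lhs : ∀ i j q → (i ℕ.+ (i ℕ.+ j) ℕ.+ suc q) ℕ.+ 1 ≡ i ℕ.+ 1 ℕ.+ (i ℕ.+ 1 ℕ.+ (j ℕ.+ q))
    lhs = ℕ-Solver.solve-∀
    rhs : ∀ i j q → (i ℕ.+ (i ℕ.+ j) ℕ.+ suc q) ℕ.+ q ≡ i ℕ.+ q ℕ.+ (i ℕ.+ q ℕ.+ (j ℕ.+ 1))
    rhs = ℕ-Solver.solve-∀

  data Kind (n : ℕ) : Exponent → Set (c ⊔ ℓ) where
    is-pure   : ∀ {m} → Pure n m → Kind n m
    is-edge   : ∀ {m} → Edge n m → Kind n m
    is-inner  : ∀ {m} → Inner n m → Kind n m
    reducible : ∀ {m m'} → Rule m m' → ∀ l → Kind n (l ⊕ m)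

  kind : ∀ {n} m → degree m ≡ n → Kind n m
  kind (i , 0 , 0) e = is-pure (≡.trans (≡.sym (≡.trans (ℕₚ.+-identityʳ (i ℕ.+ 0)) (ℕₚ.+-identityʳ i))) e , ≡.refl , ≡.refl)
  kind (i , suc j , 0) e with i ℕ.<? q
  ... | yes i<q = is-edge (i<q , s≤s z≤n , ≡.refl , ≡.trans (≡.sym (ℕₚ.+-identityʳ _)) e)
  ... | no i≮q  = ≡.subst (Kind _) (≡.cong₂ _,_ (ℕₚ.m∸n+n≡m (ℕₚ.≮⇒≥ i≮q)) (≡.cong₂ _,_ (ℕₚ.+-comm j 1) ≡.refl)) (reducible rule₃ (i ℕ.∸ q , j , 0))
  kind (i , j , suc k) e with i ℕ.<? q | j ℕ.<? q
  ... | yes i<q | yes j<q = is-inner (i<q , j<q , s≤s z≤n , e)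
  ... | yes _   | no j≮q  = ≡.subst (Kind _) (≡.cong₂ _,_ (ℕₚ.+-identityʳ i) (≡.cong₂ _,_ (ℕₚ.m∸n+n≡m (ℕₚ.≮⇒≥ j≮q)) (ℕₚ.+-comm k 1)))
                              (reducible rule₁ (i , j ℕ.∸ q , k))
  ... | no i≮q  | _       = ≡.subst (Kind _) (≡.cong₂ _,_ (ℕₚ.m∸n+n≡m (ℕₚ.≮⇒≥ i≮q)) (≡.cong₂ _,_ (ℕₚ.+-identityʳ j) (ℕₚ.+-comm k 1)))
                              (reducible rule₂ (i ℕ.∸ q , j , k))

  reduce-term : ∀ {n} fuel d m → measure m < fuel → degree m ≡ n → Reduced n ((d , m) ∷ [])
  reduce-term {n} (suc fuel) d m (s≤s lt) e with kind m e
  ... | is-pure p  = record { Reduced (reduced-[] {n}) ; pure = (d , m) ∷ [] ; all-pure = p ∷ []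
                            ; decomposition = without-quotient (solve 1 (λ t → t := t :+ (:0 :+ (:0 :+ :0))) ≋-refl _) }
    where open IntegerSolver polyRing
  ... | is-edge p  = record { Reduced (reduced-[] {n}) ; edge = (d , m) ∷ [] ; all-edge = p ∷ []
                            ; decomposition = without-quotient (solve 1 (λ t → t := :0 :+ (t :+ (:0 :+ :0))) ≋-refl _) }
    where open IntegerSolver polyRing
  ... | is-inner p = record { Reduced (reduced-[] {n}) ; inner = (d , m) ∷ [] ; all-inner = p ∷ []
                            ; decomposition = without-quotient (solve 1 (λ t → t := :0 :+ (:0 :+ (t :+ :0))) ≋-refl _) }
    where open IntegerSolver polyRing
  ... | reducible {m₁} {m₂} rule l = reduced-step (place ((sign d , l) ∷ [])) (place-degree (≡.trans (≡.sym (total degree-from)) e ∷ []))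
        (rewrites d l) (reduce-term fuel d _ (ℕₚ.<-≤-trans (decreases l) lt) (≡.trans (≡.trans (total degree-to) (≡.sym (total degree-from))) e))
    where
    open Rule rule
    total : ∀ {m} → degree m ≡ suc q → degree (l ⊕ m) ≡ suc q ℕ.+ degree l
    total {m} e = ≡.trans (degree-⊕ l m) (cong (ℕ._+ degree l) e)

  reduce : ∀ {n} f → All (HasDegree n) f → Reduced n f
  reduce []            []       = reduced-[]
  reduce ((d , m) ∷ f) (e ∷ es) = reduced-++ (reduce-term (suc (measure m)) d m ℕₚ.≤-refl e) (reduce f es)

  module At (x y z : Carrier) = Evaluate commRing (identityMap commRing) x y z

  minors-vanish : ∀ x y z g → At.eval x y z (g ∙ minors) ≈ 0#
  minors-vanish x y z (g₁ , g₂ , g₃) = trans (ev.+-homo _ _) (trans (+-cong (trans (ev.+-homo _ _) (+-cong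
      (zero-factor g₁ y z (proj₁ minors-binomial)
        (solve 4 (λ y z y' z' → :1 :* ((y :* :1) :* z') :- :1 :* (y' :* (z :* :1)) := y :* z' :- y' :* z) refl y z (y ^ q) (z ^ q)))
      (zero-factor g₂ z x (proj₁ (proj₂ minors-binomial))
        (solve 4 (λ x z x' z' → x' :* (:1 :* (z :* :1)) :- (x :* :1) :* (:1 :* z') := z :* x' :- z' :* x) refl x z (x ^ q) (z ^ q)))))
      (zero-factor g₃ x y (proj₂ (proj₂ minors-binomial))
        (solve 4 (λ x y x' y' → (x :* :1) :* (y' :* :1) :- x' :* ((y :* :1) :* :1) := x :* y' :- x' :* y) refl x y (x ^ q) (y ^ q))))
      (trans (+-identityʳ _) (+-identityʳ _)))
    where
    module ev = RingMap (At.evalMap x y z)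
    open IntegerSolver commRing
    zero-factor : ∀ g a b {f m n} → f ≋ monomial m ⊞ neg (monomial n) →
      At.monomialValue x y z m - At.monomialValue x y z n ≈ a * b ^ q - a ^ q * b → At.eval x y z (g ⊠ f) ≈ 0#
    zero-factor g a b f≋ e = trans (ev.*-homo g _) (trans (*-congˡ (trans (ev.to-cong f≋) (trans (ev.+-homo _ _)
      (trans (+-cong (At.eval-monomial x y z _) (trans (ev.-‿homo _) (-‿cong (At.eval-monomial x y z _))))
      (trans e (trans (+-cong (*-congˡ (x^q≈x b)) (-‿cong (*-congʳ (x^q≈x a)))) (-‿inverseʳ _))))))) (zeroʳ _))

  coef-off : ∀ p m → All (λ t → proj₂ t ≢ m) p → coef p m ≈ 0#
  coef-off []            m []       = refl
  coef-off ((d , n) ∷ p) m (n≢m ∷ a) rewrite sameExp-false n≢m = coef-off p m a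

  eval-off : ∀ x y z p → All (λ t → At.monomialValue x y z (proj₂ t) ≈ 0#) p → At.eval x y z p ≈ 0#
  eval-off x y z []            []       = At.eval-[] x y z
  eval-off x y z ((d , m) ∷ p) (e ∷ es) = trans (At.eval-∷ x y z d m p)
    (trans (+-cong (trans (*-congˡ e) (zeroʳ d)) (eval-off x y z p es)) (+-identityˡ _))

  zero^ : ∀ {j} → 1 ≤ j → 0# ^ j ≈ 0#
  zero^ (s≤s _) = zeroˡ _

  -- In degree n the only pure monomial is x₁^n, so the value at (1,0,0) is its total coefficient.
  pure-zero : ∀ {n} p → All (λ t → Pure n (proj₂ t)) p → At.eval 1# 0# 0# p ≈ 0# → p ≋ []
  pure-zero {n} p a v = mk≋ coefficients
    where
    total : ∀ p → All (λ t → Pure n (proj₂ t)) p → At.eval 1# 0# 0# p ≈ coef p (n , 0 , 0)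
    total [] [] = At.eval-[] 1# 0# 0#
    total ((d , m) ∷ p) ((≡.refl , ≡.refl , ≡.refl) ∷ a) rewrite sameExp-true {m} ≡.refl =
      trans (At.eval-∷ 1# 0# 0# d m p) (+-cong (trans (*-congˡ (trans (*-congʳ (one^ n))
        (trans (*-identityˡ _) (*-identityˡ _)))) (*-identityʳ d)) (total p a))
    coefficients : ∀ m → coef p m ≈ 0#
    coefficients m with sameExp (n , 0 , 0) m in e
    ... | true with sameExp-sound (n , 0 , 0) m e
    ...   | ≡.refl = trans (sym (total p a)) v
    coefficients m | false = coef-off p m (All.map (λ { (≡.refl , ≡.refl , ≡.refl) m≡ → absurd (≡.trans (≡.sym (sameExp-true m≡)) e) }) a)
      where
      absurd : true ≢ false
      absurd ()

  sameExp-does : ∀ m m' {i i'} → (m ≡ m' → i ≡ i') → (i ≡ i' → m ≡ m') → sameExp m m' ≡ does (i ℕ.≟ i')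
  sameExp-does m m' {i} {i'} f g with i ℕ.≟ i'
  ... | yes e = ≡.trans (sameExp-true (g e)) (≡.sym (dec-true (i ℕ.≟ i') e))
  ... | no ne = ≡.trans (sameExp-false (λ e → ne (f e))) (≡.sym (dec-false (i ℕ.≟ i') ne))

  if-cong : ∀ {b b' : Bool} {x y x' y' : Carrier} → b ≡ b' → x ≈ x' → y ≈ y' → (if b then x else y) ≈ (if b' then x' else y')
  if-cong {true}  ≡.refl p r = p
  if-cong {false} ≡.refl p r = r

  -- In a fixed degree an edge monomial is determined by its exponent of x₁, which is below q.
  -- Setting x₂ = 1 therefore merges no two monomials, and the root bound applies.
  edge-zero : ∀ {n} p → All (λ t → Edge n (proj₂ t)) p → (∀ x → At.eval x 1# 0# p ≈ 0#) → p ≋ []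
  edge-zero {n} p a v = mk≋ coefficients
    where
    terms : Polynomial → List Term
    terms = map (λ t → proj₁ t , proj₁ (proj₂ t))
    values : ∀ p → All (λ t → Edge n (proj₂ t)) p → ∀ x → value (terms p) x ≈ At.eval x 1# 0# p
    values [] [] x = sym (At.eval-[] x 1# 0#)
    values ((d , (i , j , k)) ∷ p) ((_ , _ , ≡.refl , _) ∷ a) x = sym (trans (At.eval-∷ x 1# 0# d (i , j , 0) p)
      (+-cong (*-congˡ (trans (*-congˡ (trans (*-congʳ (one^ j)) (*-identityˡ _))) (*-identityʳ _))) (sym (values p a x))))
    terms-zero : ∀ i → coefficient (terms p) i ≈ 0#
    terms-zero = vanishing-terms (terms p) (Allₚ.map⁺ (All.map proj₁ a)) (λ x → trans (values p a x) (v x))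
    on : ∀ i j → i ℕ.+ j ≡ n → ∀ p → All (λ t → Edge n (proj₂ t)) p → coef p (i , j , 0) ≈ coefficient (terms p) i
    on i j e []            []                  = refl
    on i j e ((d , (i' , j' , k')) ∷ p) ((_ , _ , ≡.refl , e') ∷ a) = if-cong
      (sameExp-does (i' , j' , 0) (i , j , 0) (cong proj₁) (λ { ≡.refl → cong (λ l → i , l , 0) (ℕₚ.+-cancelˡ-≡ i j' j (≡.trans e' (≡.sym e))) }))
      (+-congˡ (on i j e p a)) (on i j e p a)
    coefficients : ∀ m → coef p m ≈ 0#
    coefficients (i , j , suc k) = coef-off p _ (All.map (λ { (_ , _ , () , _) ≡.refl }) a)
    coefficients (i , j , zero) with i ℕ.+ j ℕ.≟ n
    ... | yes e = trans (on i j e p a) (terms-zero i)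
    ... | no ne = coef-off p _ (All.map (λ { (_ , _ , _ , e) ≡.refl → ne e }) a)

  -- With x₃ = 1 a monomial of degree n is still determined by its first two exponents, both below
  -- q. The root bound is applied twice: first in x, with the powers of y absorbed into the
  -- coefficients (`terms y`), and then to the polynomial in y that multiplies x^i (`column i`).
  inner-zero : ∀ {n} p → All (λ t → Inner n (proj₂ t)) p → (∀ x y → At.eval x y 1# p ≈ 0#) → p ≋ []
  inner-zero {n} p a v = mk≋ coefficients
    where
    terms : Carrier → Polynomial → List Term
    terms y = map (λ t → proj₁ t * y ^ proj₁ (proj₂ (proj₂ t)) , proj₁ (proj₂ t))
    column : ℕ → Polynomial → List Term
    column i = foldr (λ t acc → if does (proj₁ (proj₂ t) ℕ.≟ i) then (proj₁ t , proj₁ (proj₂ (proj₂ t))) ∷ acc else acc) []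
    values : ∀ p x y → value (terms y p) x ≈ At.eval x y 1# p
    values [] x y = sym (At.eval-[] x y 1#)
    values ((d , (i , j , k)) ∷ p) x y = sym (trans (At.eval-∷ x y 1# d (i , j , k) p)
      (+-cong (trans (*-congˡ (trans (*-congˡ (trans (*-congˡ (one^ k)) (*-identityʳ _))) (*-comm _ _))) (sym (*-assoc _ _ _))) (sym (values p x y))))
    terms-zero : ∀ y i → coefficient (terms y p) i ≈ 0#
    terms-zero y = vanishing-terms (terms y p) (Allₚ.map⁺ (All.map proj₁ a)) (λ x → trans (values p x y) (v x y))
    column-values : ∀ i p y → value (column i p) y ≈ coefficient (terms y p) i
    column-values i []            y = refl
    column-values i ((d , (i' , j' , k')) ∷ p) y with does (i' ℕ.≟ i)
    ... | true  = +-congˡ (column-values i p y)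
    ... | false = column-values i p y
    column-bound : ∀ i p → All (λ t → Inner n (proj₂ t)) p → All (λ t → proj₂ t < q) (column i p)
    column-bound i []            []       = []
    column-bound i ((d , (i' , j' , k')) ∷ p) ((_ , j'<q , _) ∷ a) with does (i' ℕ.≟ i)
    ... | true  = j'<q ∷ column-bound i p a
    ... | false = column-bound i p a
    column-zero : ∀ i j → coefficient (column i p) j ≈ 0#
    column-zero i = vanishing-terms (column i p) (column-bound i p a) (λ y → trans (column-values i p y) (terms-zero y i))
    on : ∀ i j k → i ℕ.+ j ℕ.+ k ≡ n → ∀ p → All (λ t → Inner n (proj₂ t)) p → coef p (i , j , k) ≈ coefficient (column i p) j
    on i j k e []            []                  = refl
    on i j k e ((d , (i' , j' , k')) ∷ p) ((_ , _ , _ , e') ∷ a) with i' ℕ.≟ i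
    ... | no ne rewrite sameExp-false {i' , j' , k'} {i , j , k} (λ e → ne (cong proj₁ e)) | dec-false (i' ℕ.≟ i) ne = on i j k e p a
    ... | yes ≡.refl = trans (if-cong
      (sameExp-does (i , j' , k') (i , j , k) {j'} {j} (cong (λ m → proj₁ (proj₂ m)))
        (λ { ≡.refl → cong (λ l → i , j , l) (ℕₚ.+-cancelˡ-≡ (i ℕ.+ j) k' k (≡.trans e' (≡.sym e))) }))
      (+-congˡ (on i j k e p a)) (on i j k e p a))
      (reflexive (cong (λ T → coefficient T j) (≡.sym column-∷)))
      where
      column-∷ : column i ((d , (i , j' , k')) ∷ p) ≡ (d , j') ∷ column i p
      column-∷ rewrite dec-true (i ℕ.≟ i) ≡.refl = ≡.refl
    coefficients : ∀ m → coef p m ≈ 0#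
    coefficients (i , j , k) with i ℕ.+ j ℕ.+ k ℕ.≟ n
    ... | yes e = trans (on i j k e p a) (column-zero i j)
    ... | no ne = coef-off p _ (All.map (λ { (_ , _ , _ , e) ≡.refl → ne e }) a)

  -- The normal form is tested on ever larger sets of points. At (1,0,0) the edge and inner terms
  -- vanish, which kills the pure part; at (x,1,0) the inner terms vanish, which kills the edge
  -- part; the points (x,y,1) kill the rest. Only the multiple of the minors remains.
  vanishing-ideal : ∀ {n} f → All (HasDegree n) f → (∀ x y z → At.eval x y z f ≈ 0#) →
                    Σ Vec3 λ g → QuotientDegree n g × f ≋ g ∙ minors
  vanishing-ideal {n} f homogeneous v = quotient , quotient-degree , ≋-trans decomposition
      (drop-zero pure≋0 (drop-zero edge≋0 (drop-zero inner≋0 ≋-refl)))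
    where
    open Reduced (reduce f homogeneous)
    drop-zero : ∀ {p r s} → p ≋ [] → r ≋ s → p ⊞ r ≋ s
    drop-zero e e' = ≋-trans (S.+-cong e e') (S.+-identityˡ _)
    sum-zero : ∀ x y z → At.eval x y z pure + (At.eval x y z edge + At.eval x y z inner) ≈ 0#
    sum-zero x y z = trans (+-congˡ (+-congˡ (sym (trans (+-congˡ (minors-vanish x y z quotient)) (+-identityʳ _)))))
      (trans (sym (trans (ev.to-cong decomposition) (trans (ev.+-homo _ _) (+-congˡ (trans (ev.+-homo _ _) (+-congˡ (ev.+-homo _ _))))))) (v x y z))
      where module ev = RingMap (At.evalMap x y z)
    inner-at-0 : ∀ x y → At.eval x y 0# inner ≈ 0#
    inner-at-0 x y = eval-off x y 0# inner (All.map (λ { (_ , _ , 1≤k , _) → trans (*-congˡ (trans (*-congˡ (zero^ 1≤k)) (zeroʳ _))) (zeroʳ _) }) all-inner)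
    edge-at-00 : ∀ x → At.eval x 0# 0# edge ≈ 0#
    edge-at-00 x = eval-off x 0# 0# edge (All.map (λ { (_ , 1≤j , _) → trans (*-congˡ (trans (*-congʳ (zero^ 1≤j)) (zeroˡ _))) (zeroʳ _) }) all-edge)
    pure≋0 : pure ≋ []
    pure≋0 = pure-zero pure all-pure (trans (sym (trans (+-congˡ (trans (+-cong (edge-at-00 1#) (inner-at-0 1# 0#)) (+-identityˡ _))) (+-identityʳ _))) (sum-zero 1# 0# 0#))
    pure-at : ∀ x y z → At.eval x y z pure ≈ 0#
    pure-at x y z = trans (At.eval-cong x y z pure≋0) (At.eval-[] x y z)
    edge≋0 : edge ≋ []
    edge≋0 = edge-zero edge all-edge (λ x → trans (sym (trans (+-cong (pure-at x 1# 0#) (trans (+-congˡ (inner-at-0 x 1#)) (+-identityʳ _))) (+-identityˡ _))) (sum-zero x 1# 0#))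
    inner≋0 : inner ≋ []
    inner≋0 = inner-zero inner all-inner (λ x y → trans (sym (trans (+-cong (pure-at x y 1#)
      (trans (+-congʳ (trans (At.eval-cong x y 1# edge≋0) (At.eval-[] x y 1#))) (+-identityˡ _))) (+-identityˡ _))) (sum-zero x y 1#))

-- Translation between derivations and vectors over S

module Derivations {c ℓ} {q : ℕ} (𝔽 : FiniteField c ℓ q) where
  open FiniteField 𝔽 hiding (_≟_)
  open PolynomialRing 𝔽
  open PolynomialEvaluation 𝔽
  open LinearForms 𝔽
  open RingVectors polyRing using (scale; _+³_; 0³)
  private module S = CommutativeRing polyRing

  combination : ∀ k → (Fin k → Polynomial) → (Fin k → Vec3) → Vec3
  combination zero    g θ = 0³
  combination (suc k) g θ = scale (g Fin.zero) (θ Fin.zero) +³ combination k (λ j → g (Fin.suc j)) (λ j → θ (Fin.suc j))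

  -- `IsBasis` restated with the opaque ring operations and the record equality `_≋_`, where ring
  -- reasoning and unification work smoothly.
  IsLogarithmicBasis : List (V3 𝔽) → (k : ℕ) → (Fin k → Vec3) → Set (c ⊔ ℓ)
  IsLogarithmicBasis A k θ =
      (∀ j → Logarithmic A (θ j))
    × (∀ δ → Logarithmic A δ → Σ (Fin k → Polynomial) λ g → δ ≈³ combination k g θ)
    × (∀ g → combination k g θ ≈³ 0³ → ∀ j → g j ≋ [])

  opaque
    unfolding _⊞_ _⊠_ const

    sumD-combination : ∀ k g θ → sumD 𝔽 k (λ j → _·D_ 𝔽 (g j) (θ j)) ≡ combination k g θ
    sumD-combination zero    g θ = ≡.refl
    sumD-combination (suc k) g θ = cong (scale (g Fin.zero) (θ Fin.zero) +³_) (sumD-combination k (λ j → g (Fin.suc j)) (λ j → θ (Fin.suc j)))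

    InD⇒logarithmic : ∀ {A δ} → InD 𝔽 A δ → Logarithmic A δ
    InD⇒logarithmic {δ = f₁ , f₂ , f₃} = All.map λ { {a , b , d} (g , e) →
      g , ≋-trans (⊞-assoc (const a ⊠ f₁) (const b ⊠ f₂) (const d ⊠ f₃)) (mk≋ e) }

    logarithmic⇒InD : ∀ {A δ} → Logarithmic A δ → InD 𝔽 A δ
    logarithmic⇒InD {δ = f₁ , f₂ , f₃} = All.map λ { {a , b , d} (g , e) →
      g , coeffs (≋-trans (≋-sym (⊞-assoc (const a ⊠ f₁) (const b ⊠ f₂) (const d ⊠ f₃))) e) }

  ≈³⇒≈D : ∀ {u v} → u ≈³ v → _≈D_ 𝔽 u v
  ≈³⇒≈D (a , b , d) = coeffs a , coeffs b , coeffs d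

  ≈D⇒≈³ : ∀ {u v} → _≈D_ 𝔽 u v → u ≈³ v
  ≈D⇒≈³ (a , b , d) = mk≋ a , mk≋ b , mk≋ d

  toIsBasis : ∀ {A k θ} → IsLogarithmicBasis A k θ → IsBasis 𝔽 A k θ
  toIsBasis {A} {k} {θ} (log , span , indep) =
      (λ j → logarithmic⇒InD (log j))
    , (λ δ δ∈D → let (g , e) = span δ (InD⇒logarithmic δ∈D) in
         g , ≡.subst (_≈D_ 𝔽 δ) (≡.sym (sumD-combination k g θ)) (≈³⇒≈D {δ} {combination k g θ} e))
    , (λ g e j → coeffs (indep g (≈D⇒≈³ {combination k g θ} {0³} (≡.subst (λ u → _≈D_ 𝔽 u (0D 𝔽)) (sumD-combination k g θ) e)) j))

  fromIsBasis : ∀ {A k θ} → IsBasis 𝔽 A k θ → IsLogarithmicBasis A k θ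
  fromIsBasis {A} {k} {θ} (log , span , indep) =
      (λ j → InD⇒logarithmic (log j))
    , (λ δ δ∈D → let (g , e) = span δ (logarithmic⇒InD δ∈D) in
         g , ≈D⇒≈³ {δ} {combination k g θ} (≡.subst (_≈D_ 𝔽 δ) (sumD-combination k g θ) e))
    , (λ g e j → mk≋ (indep g (≡.subst (λ u → _≈D_ 𝔽 u (0D 𝔽)) (≡.sym (sumD-combination k g θ)) (≈³⇒≈D {combination k g θ} {0³} e)) j))

-- Arrangements covering V are free

module CoveringArrangements {c ℓ} {q : ℕ} (𝔽 : FiniteField c ℓ q) where
  open FiniteField 𝔽 hiding (_≟_)
  open PolynomialRing 𝔽
  open PolynomialEvaluation 𝔽
  open LinearForms 𝔽
  open VanishingIdeal 𝔽
  open Derivations 𝔽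
  open RingVectors polyRing using (det-rotate)
  private module S = CommutativeRing polyRing

  Covered : List (V3 𝔽) → V3 𝔽 → Set _
  Covered A v = Any (λ α → dot 𝔽 α v ≈ 0#) A

  eval-covered : ∀ {A} x y z → Covered A (x , y , z) → At.eval x y z (definingPolynomial A) ≈ 0#
  eval-covered x y z (here {α} αv≈0) = trans (At.eval-⊠ x y z (linP 𝔽 α) _)
    (trans (*-congʳ (trans (At.eval-linP x y z α) αv≈0)) (zeroˡ _))
  eval-covered x y z (there {α} p) = trans (At.eval-⊠ x y z (linP 𝔽 α) _) (trans (*-congˡ (eval-covered x y z p)) (zeroʳ _))

  opaque
    unfolding _⊠_ const

    ⊠-degree : ∀ {a b p r} → All (HasDegree a) p → All (HasDegree b) r → All (HasDegree (a ℕ.+ b)) (p ⊠ r)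
    ⊠-degree [] _ = []
    ⊠-degree {a} {b} {(d , m) ∷ p} {r} (e ∷ es) er = Allₚ.++⁺ (Allₚ.map⁺ (All.map (λ { {_ , n} e' →
      ≡.trans (≡.trans (degree-⊕ m n) (ℕₚ.+-comm (degree n) (degree m))) (≡.cong₂ ℕ._+_ e e') }) er)) (⊠-degree es er)

    const-degree : ∀ d → All (HasDegree 0) (const d)
    const-degree d = ≡.refl ∷ []

  definingPolynomial-degree : ∀ A → All (HasDegree (length A)) (definingPolynomial A)
  definingPolynomial-degree []      = const-degree 1#
  definingPolynomial-degree (α ∷ A) = ⊠-degree (≡.refl ∷ ≡.refl ∷ ≡.refl ∷ []) (definingPolynomial-degree A)

  homogeneous : ∀ {d p} → All (HasDegree d) p → HomogeneousOfDeg 𝔽 p d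
  homogeneous {d} {p} a m nz with degree m ℕ.≟ d
  ... | yes e = e
  ... | no ne = ⊥-elim (nz (coef-off p m (All.map (λ { e ≡.refl → ne e }) a)))

  const1≉0 : ¬ (const 1# ≋ [])
  const1≉0 z = 1≉0 (trans (sym (At.eval-const 0# 0# 0# 1#)) (trans (At.eval-cong 0# 0# 0# z) (At.eval-[] 0# 0# 0#)))

  -- A nonzero combination has at least one listed term in g. Its degree e satisfies q + 1 + e = n,
  -- and cancelling q + 1 shows that all other terms share it. For n = |A| this is the third
  -- exponent, and |A| ≥ q + 1 comes with it.
  quotient-degree : ∀ {n} g → ¬ ((g ∙ minors) ≋ []) → QuotientDegree n g →
    Σ ℕ λ e → (1 ℕ.+ q ℕ.+ e ≡ n) × All (HasDegree e) (proj₁ g) × All (HasDegree e) (proj₁ (proj₂ g)) × All (HasDegree e) (proj₂ (proj₂ g))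
  quotient-degree {n} g@(g₁ , g₂ , g₃) nz (d₁ , d₂ , d₃) = pick g₁ g₂ g₃ nz (d₁ , d₂ , d₃)
    where
    exponent : ∀ t → suc q ℕ.+ degree (proj₂ t) ≡ n →
      Σ ℕ λ e → (1 ℕ.+ q ℕ.+ e ≡ n) × All (HasDegree e) g₁ × All (HasDegree e) g₂ × All (HasDegree e) g₃
    exponent t et = degree (proj₂ t) , et , All.map (λ {u} → same u) d₁ , All.map (λ {u} → same u) d₂ , All.map (λ {u} → same u) d₃
      where
      same : ∀ u → suc q ℕ.+ degree (proj₂ u) ≡ n → HasDegree (degree (proj₂ t)) u
      same u eu = ℕₚ.+-cancelˡ-≡ (suc q) _ _ (≡.trans eu (≡.sym et))
    pick : ∀ f₁ f₂ f₃ → ¬ (((f₁ , f₂ , f₃) ∙ minors) ≋ []) → QuotientDegree n (f₁ , f₂ , f₃) →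
      Σ ℕ λ e → (1 ℕ.+ q ℕ.+ e ≡ n) × All (HasDegree e) g₁ × All (HasDegree e) g₂ × All (HasDegree e) g₃
    pick (t ∷ _) _       _       _  (e ∷ _ , _ , _) = exponent t e
    pick []      (t ∷ _) _       _  (_ , e ∷ _ , _) = exponent t e
    pick []      []      (t ∷ _) _  (_ , _ , e ∷ _) = exponent t e
    pick []      []      []      nz _ = ⊥-elim (nz (≋-trans (S.+-cong (S.+-cong (S.zeroˡ _) (S.zeroˡ _)) (S.zeroˡ _))
                                           (≋-trans (S.+-identityʳ _) (S.+-identityʳ _))))

  module ThirdDerivation (A : List (V3 𝔽)) (arr : IsArrangement 𝔽 A) (g : Vec3) (Q≋g∙m : definingPolynomial A ≋ g ∙ minors) where
    θ : Fin 3 → Vec3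
    θ Fin.zero                       = 𝐱
    θ (Fin.suc Fin.zero)             = 𝐱^q
    θ (Fin.suc (Fin.suc Fin.zero))   = g
    det≋Q : det 𝐱 𝐱^q g ≋ definingPolynomial A
    det≋Q = ≋-trans (≋-sym (det-rotate g 𝐱 𝐱^q)) (≋-sym Q≋g∙m)
    third : Logarithmic A g
    third = All.zipWith (λ { (α≉0 , α∣Q) → third-∣ α≉0 g (∣-resp (≋-sym det≋Q) α∣Q) }) (proj₁ arr , factors-∣ A)
    log : ∀ j → Logarithmic A (θ j)
    log Fin.zero                     = euler-logarithmic A
    log (Fin.suc Fin.zero)           = frobenius-logarithmic A
    log (Fin.suc (Fin.suc Fin.zero)) = third
    open DerivationBasis (saito arr {𝐱} {𝐱^q} {g} (log Fin.zero) (log (Fin.suc Fin.zero)) third det≋Q)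
    pad : ∀ {a x y z} → a ≋ x ⊞ (y ⊞ z) → a ≋ x ⊞ (y ⊞ (z ⊞ []))
    pad p = ≋-trans p (S.+-congˡ (S.+-congˡ (≋-sym (S.+-identityʳ _))))
    unpad : ∀ {x y z} → x ⊞ (y ⊞ (z ⊞ [])) ≋ [] → x ⊞ (y ⊞ z) ≋ []
    unpad p = ≋-trans (S.+-congˡ (S.+-congˡ (≋-sym (S.+-identityʳ _)))) p
    basis : IsLogarithmicBasis A 3 θ
    basis = log
      , (λ δ δ∈D → let ((a , b , d) , (e₁ , e₂ , e₃)) = spanning δ δ∈D in
           (λ { Fin.zero → a ; (Fin.suc Fin.zero) → b ; (Fin.suc (Fin.suc Fin.zero)) → d }) , pad e₁ , pad e₂ , pad e₃)
      , (λ { a (e₁ , e₂ , e₃) → let (z₁ , z₂ , z₃) = independent (a Fin.zero) (a (Fin.suc Fin.zero)) (a (Fin.suc (Fin.suc Fin.zero))) (unpad e₁ , unpad e₂ , unpad e₃) in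
           λ { Fin.zero → z₁ ; (Fin.suc Fin.zero) → z₂ ; (Fin.suc (Fin.suc Fin.zero)) → z₃ } })

  covering⇒free : ∀ A → IsArrangement 𝔽 A → (∀ v → Covered A v) → Σ ℕ λ e → (1 ℕ.+ q ℕ.+ e ≡ length A) × FreeWithExponents 𝔽 A 1 q e
  covering⇒free A arr covered = assemble (vanishing-ideal (definingPolynomial A) (definingPolynomial-degree A)
      (λ x y z → eval-covered x y z (covered (x , y , z))))
    where
    assemble : (Σ Vec3 λ g → QuotientDegree (length A) g × definingPolynomial A ≋ g ∙ minors) →
               Σ ℕ λ e → (1 ℕ.+ q ℕ.+ e ≡ length A) × FreeWithExponents 𝔽 A 1 q e
    assemble (g , dg , Q≋g∙m) = conclude (quotient-degree g nonzero dg)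
      where
      open ThirdDerivation A arr g Q≋g∙m
      -- The defining polynomial is a product of nonzero linear forms, so Q · 1 = 0 would give 1 =
      -- 0.
      nonzero : ¬ ((g ∙ minors) ≋ [])
      nonzero z = const1≉0 (cancel-product (proj₁ arr) (≋-trans (S.*-identityʳ _) (≋-trans Q≋g∙m z)))
      conclude : (Σ ℕ λ e → (1 ℕ.+ q ℕ.+ e ≡ length A) × All (HasDegree e) (proj₁ g) × All (HasDegree e) (proj₁ (proj₂ g)) × All (HasDegree e) (proj₂ (proj₂ g))) →
                 Σ ℕ λ e → (1 ℕ.+ q ℕ.+ e ≡ length A) × FreeWithExponents 𝔽 A 1 q e
      conclude (e , size≡ , h₁ , h₂ , h₃) = e , size≡ , θ , toIsBasis {A} {3} {θ} basis
        , (homogeneous {1} {X₁} (≡.refl ∷ []) , homogeneous {1} {X₂} (≡.refl ∷ []) , homogeneous {1} {X₃} (≡.refl ∷ []))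
        , ( homogeneous {q} {monomial (q , 0 , 0)} (≡.trans (ℕₚ.+-identityʳ (q ℕ.+ 0)) (ℕₚ.+-identityʳ q) ∷ [])
          , homogeneous {q} {monomial (0 , q , 0)} (ℕₚ.+-identityʳ q ∷ []) , homogeneous {q} {monomial (0 , 0 , q)} (≡.refl ∷ []))
        , (homogeneous {e} {proj₁ g} h₁ , homogeneous {e} {proj₁ (proj₂ g)} h₂ , homogeneous {e} {proj₂ (proj₂ g)} h₃)

-- Linear combinations of a basis of arbitrary length

module Combinations {c ℓ} {q : ℕ} (𝔽 : FiniteField c ℓ q) where
  open FiniteField 𝔽 hiding (_≟_)
  open PolynomialRing 𝔽
  open PolynomialEvaluation 𝔽
  open LinearForms 𝔽
  open Derivations 𝔽
  open RingVectors polyRing using (scale; _+³_; 0³)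
  private module S = CommutativeRing polyRing

  ≈³-refl : ∀ {u} → u ≈³ u
  ≈³-refl = ≋-refl , ≋-refl , ≋-refl

  ≈³-sym : ∀ {u v} → u ≈³ v → v ≈³ u
  ≈³-sym (a , b , d) = ≋-sym a , ≋-sym b , ≋-sym d

  ≈³-trans : ∀ {u v w} → u ≈³ v → v ≈³ w → u ≈³ w
  ≈³-trans (a , b , d) (a' , b' , d') = ≋-trans a a' , ≋-trans b b' , ≋-trans d d'

  +³-cong : ∀ {u u' v v'} → u ≈³ u' → v ≈³ v' → (u +³ v) ≈³ (u' +³ v')
  +³-cong (a , b , d) (a' , b' , d') = S.+-cong a a' , S.+-cong b b' , S.+-cong d d'

  scale-cong : ∀ {f g u v} → f ≋ g → u ≈³ v → scale f u ≈³ scale g v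
  scale-cong e (a , b , d) = S.*-cong e a , S.*-cong e b , S.*-cong e d

  private
    open IntegerSolver polyRing
    interchange : ∀ f g x y z → (f ⊞ g) ⊠ x ⊞ (y ⊞ z) ≋ (f ⊠ x ⊞ y) ⊞ (g ⊠ x ⊞ z)
    interchange = solve 5 (λ f g x y z → (f :+ g) :* x :+ (y :+ z) := (f :* x :+ y) :+ (g :* x :+ z)) ≋-refl
    factor : ∀ h f x y → (h ⊠ f) ⊠ x ⊞ h ⊠ y ≋ h ⊠ (f ⊠ x ⊞ y)
    factor = solve 4 (λ h f x y → (h :* f) :* x :+ h :* y := h :* (f :* x :+ y)) ≋-refl

  combination-cong : ∀ k {g g'} θ → (∀ j → g j ≋ g' j) → combination k g θ ≈³ combination k g' θ
  combination-cong zero    θ e = ≈³-refl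
  combination-cong (suc k) θ e = +³-cong
    (scale-cong (e Fin.zero) (≈³-refl)) (combination-cong k (λ j → θ (Fin.suc j)) (λ j → e (Fin.suc j)))

  combination-+ : ∀ k g g' θ → combination k (λ j → g j ⊞ g' j) θ ≈³ (combination k g θ +³ combination k g' θ)
  combination-+ zero    g g' θ = ≋-sym (S.+-identityˡ []) , ≋-sym (S.+-identityˡ []) , ≋-sym (S.+-identityˡ [])
  combination-+ (suc k) g g' θ with combination-+ k (λ j → g (Fin.suc j)) (λ j → g' (Fin.suc j)) (λ j → θ (Fin.suc j))
  ... | e₁ , e₂ , e₃ = ≋-trans (S.+-congˡ e₁) (interchange _ _ _ _ _) , ≋-trans (S.+-congˡ e₂) (interchange _ _ _ _ _) , ≋-trans (S.+-congˡ e₃) (interchange _ _ _ _ _)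

  combination-scale : ∀ k h g θ → combination k (λ j → h ⊠ g j) θ ≈³ scale h (combination k g θ)
  combination-scale zero    h g θ = ≋-sym (S.zeroʳ h) , ≋-sym (S.zeroʳ h) , ≋-sym (S.zeroʳ h)
  combination-scale (suc k) h g θ with combination-scale k h (λ j → g (Fin.suc j)) (λ j → θ (Fin.suc j))
  ... | e₁ , e₂ , e₃ = ≋-trans (S.+-congˡ e₁) (factor _ _ _ _) , ≋-trans (S.+-congˡ e₂) (factor _ _ _ _) , ≋-trans (S.+-congˡ e₃) (factor _ _ _ _)

  combination-unique : ∀ {A k θ} → IsLogarithmicBasis A k θ → ∀ g g' → combination k g θ ≈³ combination k g' θ → ∀ j → g j ≋ g' j
  combination-unique {A} {k} {θ} (_ , _ , indep) g g' (e₁ , e₂ , e₃) j =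
    ≋-trans (solve 2 (λ x y → x := (x :+ (:- :1) :* y) :+ y) ≋-refl (g j) (g' j)) (≋-trans (S.+-congʳ (indep (λ j → g j ⊞ neg (const 1#) ⊠ g' j) difference j)) (S.+-identityˡ _))
    where
    difference : combination k (λ j → g j ⊞ neg (const 1#) ⊠ g' j) θ ≈³ 0³
    difference = ≈³-trans
      (≈³-trans
        (combination-+ k g (λ j → neg (const 1#) ⊠ g' j) θ)
        (+³-cong (≈³-refl) (combination-scale k (neg (const 1#)) g' θ)))
      (cancel e₁ , cancel e₂ , cancel e₃)
      where
      cancel : ∀ {x y} → x ≋ y → x ⊞ neg (const 1#) ⊠ y ≋ []
      cancel {x} {y} e = ≋-trans (S.+-congʳ e) (solve 1 (λ y → y :+ (:- :1) :* y := :0) ≋-refl y)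

  logarithmic-+ : ∀ {A} u v → Logarithmic A u → Logarithmic A v → Logarithmic A (u +³ v)
  logarithmic-+ (u₁ , u₂ , u₃) (v₁ , v₂ , v₃) pu pv = All.zipWith (λ { {a , b , d} (p , r) → ∣-resp
    (solve 9 (λ a b d u₁ u₂ u₃ v₁ v₂ v₃ → (a :* u₁ :+ b :* u₂ :+ d :* u₃) :+ (a :* v₁ :+ b :* v₂ :+ d :* v₃)
      := a :* (u₁ :+ v₁) :+ b :* (u₂ :+ v₂) :+ d :* (u₃ :+ v₃)) ≋-refl (const a) (const b) (const d) u₁ u₂ u₃ v₁ v₂ v₃) (∣-+ p r) }) (pu , pv)

  ∙-scale : ∀ a g u → g ⊠ (a ∙ u) ≋ a ∙ scale g u
  ∙-scale (a , b , d) g (u₁ , u₂ , u₃) = solve 7 (λ a b d g u₁ u₂ u₃ → g :* (a :* u₁ :+ b :* u₂ :+ d :* u₃)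
      := a :* (g :* u₁) :+ b :* (g :* u₂) :+ d :* (g :* u₃)) ≋-refl a b d g u₁ u₂ u₃

  scale-∙ : ∀ g u v → scale g u ∙ v ≋ g ⊠ (u ∙ v)
  scale-∙ g (u₁ , u₂ , u₃) (v₁ , v₂ , v₃) = solve 7 (λ g u₁ u₂ u₃ v₁ v₂ v₃ → (g :* u₁) :* v₁ :+ (g :* u₂) :* v₂ :+ (g :* u₃) :* v₃
      := g :* (u₁ :* v₁ :+ u₂ :* v₂ :+ u₃ :* v₃)) ≋-refl g u₁ u₂ u₃ v₁ v₂ v₃

  logarithmic-scale : ∀ {A} g u → Logarithmic A u → Logarithmic A (scale g u)
  logarithmic-scale g u = All.map λ {α} p → ∣-resp (∙-scale (const³ α) g u) (∣-*ˡ g p)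

  logarithmic-combination : ∀ {A} k g θ → (∀ j → Logarithmic A (θ j)) → Logarithmic A (combination k g θ)
  logarithmic-combination zero    g θ log = All.tabulate λ {α} _ → [] ,
    ≋-trans (S.+-cong (S.+-cong (S.zeroʳ _) (S.zeroʳ _)) (S.zeroʳ _)) (≋-trans (S.+-identityʳ _) (≋-trans (S.+-identityʳ _) (≋-sym (S.zeroʳ _))))
  logarithmic-combination (suc k) g θ log = logarithmic-+ (scale (g Fin.zero) (θ Fin.zero)) (combination k _ _)
    (logarithmic-scale (g Fin.zero) (θ Fin.zero) (log Fin.zero)) (logarithmic-combination k (λ j → g (Fin.suc j)) (λ j → θ (Fin.suc j)) (λ j → log (Fin.suc j)))

  product-logarithmic : ∀ A u → Logarithmic A (scale (definingPolynomial A) u)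
  product-logarithmic A u = All.map (λ {α} α∣Q → ∣-resp (∙-scale (const³ α) (definingPolynomial A) u) (∣-*ʳ _ α∣Q)) (factors-∣ A)

-- Coefficients of low degree and the final comparison

module LowCoefficients {c ℓ} {q : ℕ} (𝔽 : FiniteField c ℓ q) where
  open FiniteField 𝔽 hiding (_≟_)
  open PolynomialRing 𝔽
  open PolynomialEvaluation 𝔽
  open LinearForms 𝔽
  open VanishingIdeal 𝔽
  private module S = CommutativeRing polyRing

  -- The coefficient of m in x^a f. Expressed by a functional, it needs no subtraction of exponents
  -- when a does not divide m.
  shifted-coef : Exponent → Exponent → Polynomial → Carrier
  shifted-coef a m f = linear (λ l → kronecker m (a ⊕ l)) f

  shifted-hit : ∀ a l {m} f → a ⊕ l ≡ m → shifted-coef a m f ≈ coef f l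
  shifted-hit a l f ≡.refl = trans (linear-≡ f (kronecker-⊕ a l)) (sym (coef-linear f l))

  shifted-vanish : ∀ a m f → (∀ l → a ⊕ l ≡ m → coef f l ≈ 0#) → shifted-coef a m f ≈ 0#
  shifted-vanish a m f z = linear-vanish _ f vanish
    where
    vanish : ∀ l → coef f l * kronecker m (a ⊕ l) ≈ 0#
    vanish l with sameExp (a ⊕ l) m in e
    ... | false = zeroʳ _
    ... | true  = trans (*-congʳ (z l (sameExp-sound (a ⊕ l) m e))) (zeroˡ _)

  coef-⊠ : ∀ g f m → coef (g ⊠ f) m ≈ linear (λ n → shifted-coef n m f) g
  coef-⊠ g f m = trans (coef-linear (g ⊠ f) m) (linear-⊠ (kronecker m) g f)

  coef-monomial-⊠ : ∀ a f m → coef (monomial a ⊠ f) m ≈ shifted-coef a m f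
  coef-monomial-⊠ a f m = trans (coef-⊠ (monomial a) f m) (trans (+-identityʳ _) (*-identityˡ _))

  coef-binomial-⊠ : ∀ {g a b} f m → g ≋ monomial a ⊞ neg (monomial b) → coef (f ⊠ g) m ≈ shifted-coef a m f - shifted-coef b m f
  coef-binomial-⊠ {g} {a} {b} f m e = trans (coeffs (⊠-comm f g) m) (trans (coef-⊠ g f m)
    (trans (linear-resp _ e) (linear-binomial (λ n → shifted-coef n m f) a b)))

  Low : ℕ → Polynomial → Set ℓ
  Low d f = ∀ m → degree m ≤ d → coef f m ≈ 0#

  low-linP : ∀ {d f} α → Low d f → Low (suc d) (linP 𝔽 α ⊠ f)
  low-linP {d} {f} (a , b , e) low m m≤ = trans (coef-⊠ _ f m) (trans
      (+-cong (kill (1 , 0 , 0) ≡.refl) (+-cong (kill (0 , 1 , 0) ≡.refl) (+-congʳ (kill (0 , 0 , 1) ≡.refl))))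
      (trans (+-identityˡ _) (trans (+-identityˡ _) (+-identityˡ _))))
    where
    kill : ∀ u {s} → degree u ≡ 1 → s * shifted-coef u m f ≈ 0#
    kill u {s} u≡1 = trans (*-congˡ (shifted-vanish u m f λ l e → low l (ℕₚ.≤-pred
      (≡.subst (_≤ suc d) (≡.trans (cong degree (≡.sym e)) (≡.trans (degree-⊕ u l) (≡.trans (cong (degree l ℕ.+_) u≡1) (ℕₚ.+-comm (degree l) 1)))) m≤)))) (zeroʳ s)

  -- `Low d` says that f has order greater than d at the origin. Every linear factor raises the
  -- order by one, so a cofactor without constant term ends up with order greater than |A|.
  low-product : ∀ A {h} → Low 0 h → Low (length A) (definingPolynomial A ⊠ h)
  low-product []      {h} low m m≤ = trans (coeffs (S.*-identityˡ h) m) (low m m≤)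
  low-product (α ∷ A) {h} low m m≤ = trans (coeffs (S.*-assoc (linP 𝔽 α) (definingPolynomial A) h) m)
    (low-linP α (low-product A low) m m≤)

  constantTerm : Polynomial → Carrier
  constantTerm = At.eval 0# 0# 0#

  constantTerm-coef : ∀ f → constantTerm f ≈ coef f (0 , 0 , 0)
  constantTerm-coef []            = At.eval-[] 0# 0# 0#
  constantTerm-coef ((d , m) ∷ f) = trans (At.eval-∷ 0# 0# 0# d m f) (trans (+-congˡ (constantTerm-coef f)) (head m))
    where
    head : ∀ m → d * At.monomialValue 0# 0# 0# m + coef f (0 , 0 , 0) ≈ coef ((d , m) ∷ f) (0 , 0 , 0)
    head (suc i , j , k)     = trans (+-congʳ (trans (*-congˡ (trans (*-congʳ (zeroˡ _)) (zeroˡ _))) (zeroʳ d))) (+-identityˡ _)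
    head (0 , suc j , k)     = trans (+-congʳ (trans (*-congˡ (trans (*-congˡ (trans (*-congʳ (zeroˡ _)) (zeroˡ _))) (zeroʳ _))) (zeroʳ d))) (+-identityˡ _)
    head (0 , 0 , suc k)     = trans (+-congʳ (trans (*-congˡ (trans (*-congˡ (trans (*-congˡ (zeroˡ _)) (zeroʳ _))) (zeroʳ _))) (zeroʳ d))) (+-identityˡ _)
    head (0 , 0 , 0)         = +-congʳ (trans (*-congˡ (trans (*-identityˡ _) (*-identityˡ _))) (*-identityʳ d))

  low-constant : ∀ {f} → constantTerm f ≈ 0# → Low 0 f
  low-constant {f} z (zero , zero , zero) _ = trans (sym (constantTerm-coef f)) z

  -- The ideal of the origin is generated by the variables: each nonconstant term is charged to the
  -- first variable that occurs in it.
  constant-split : ∀ f → Σ Carrier λ d → Σ Vec3 λ g → f ≋ const d ⊞ g ∙ 𝐱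
  constant-split [] = 0# , ([] , [] , []) , ≋-sym (≋-trans (S.+-cong (RingMap.0-homo constMap)
    (S.+-cong (S.+-cong (S.zeroˡ X₁) (S.zeroˡ X₂)) (S.zeroˡ X₃))) (solve 0 (:0 :+ (:0 :+ :0 :+ :0) := :0) ≋-refl))
    where open IntegerSolver polyRing
  constant-split ((d , m) ∷ f) = extend m (constant-split f)
    where
    open IntegerSolver polyRing
    term : ∀ n l → ((d , n ⊕ l) ∷ []) ≋ ((d , l) ∷ []) ⊠ monomial n
    term n l = linear-ext λ h → sym (trans (linear-⊠ h ((d , l) ∷ []) (monomial n)) (+-congʳ (*-congˡ
      (trans (+-identityʳ _) (trans (*-identityˡ _) (reflexive (cong h (⊕-comm l n))))))))
    extend : ∀ m → (Σ Carrier λ e → Σ Vec3 λ g → f ≋ const e ⊞ g ∙ 𝐱) → Σ Carrier λ e → Σ Vec3 λ g → (d , m) ∷ f ≋ const e ⊞ g ∙ 𝐱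
    extend (suc i , j , k) (e , (g₁ , g₂ , g₃) , p) = e , (((d , i , j , k) ∷ []) ⊞ g₁ , g₂ , g₃) ,
      ≋-trans (≋-sym (∷-⊞ _ f)) (≋-trans (S.+-cong (term (1 , 0 , 0) (i , j , k)) p)
      (solve 8 (λ t e a b c x y z → t :* x :+ (e :+ (a :* x :+ b :* y :+ c :* z)) := e :+ ((t :+ a) :* x :+ b :* y :+ c :* z)) ≋-refl _ (const e) g₁ g₂ g₃ X₁ X₂ X₃))
    extend (0 , suc j , k) (e , (g₁ , g₂ , g₃) , p) = e , (g₁ , ((d , 0 , j , k) ∷ []) ⊞ g₂ , g₃) ,
      ≋-trans (≋-sym (∷-⊞ _ f)) (≋-trans (S.+-cong (term (0 , 1 , 0) (0 , j , k)) p)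
      (solve 8 (λ t e a b c x y z → t :* y :+ (e :+ (a :* x :+ b :* y :+ c :* z)) := e :+ (a :* x :+ (t :+ b) :* y :+ c :* z)) ≋-refl _ (const e) g₁ g₂ g₃ X₁ X₂ X₃))
    extend (0 , 0 , suc k) (e , (g₁ , g₂ , g₃) , p) = e , (g₁ , g₂ , ((d , 0 , 0 , k) ∷ []) ⊞ g₃) ,
      ≋-trans (≋-sym (∷-⊞ _ f)) (≋-trans (S.+-cong (term (0 , 0 , 1) (0 , 0 , k)) p)
      (solve 8 (λ t e a b c x y z → t :* z :+ (e :+ (a :* x :+ b :* y :+ c :* z)) := e :+ (a :* x :+ b :* y :+ (t :+ c) :* z)) ≋-refl _ (const e) g₁ g₂ g₃ X₁ X₂ X₃))
    extend (0 , 0 , 0) (e , g , p) = d + e , g , ≋-trans (≋-sym (∷-⊞ _ f))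
      (≋-trans (S.+-cong (≋-trans (≋-sym (const-monomial d _)) (≋-trans (S.*-congˡ (≋-sym 1≋monomial)) (S.*-identityʳ _))) p)
      (≋-trans (≋-sym (S.+-assoc _ _ _)) (S.+-congʳ (≋-sym (RingMap.+-homo constMap d e)))))

  -- The coefficient 1 of x₁^q is followed through η₁ and η₂ until it has to vanish.
  no-expansion : ∀ {r} → q ≡ suc (suc r) → ∀ (η₁ η₂ η₃ : Vec3) →
    𝐱^q ≈³ ( X₁ ⊠ proj₁ η₁ ⊞ X₂ ⊠ proj₁ η₂ ⊞ X₃ ⊠ proj₁ η₃
           , X₁ ⊠ proj₁ (proj₂ η₁) ⊞ X₂ ⊠ proj₁ (proj₂ η₂) ⊞ X₃ ⊠ proj₁ (proj₂ η₃)
           , X₁ ⊠ proj₂ (proj₂ η₁) ⊞ X₂ ⊠ proj₂ (proj₂ η₂) ⊞ X₃ ⊠ proj₂ (proj₂ η₃)) →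
    Low (2 ℕ.* q) (η₁ ∙ minors) → Low (2 ℕ.* q) (η₂ ∙ minors) → ⊥
  no-expansion {r} ≡.refl η₁@(a₁ , a₂ , a₃) η₂@(b₁ , b₂ , b₃) (d₁ , d₂ , d₃) (e₁ , e₂ , _) low₁ low₂ =
      1≉0 (trans (trans (sym first) second) (trans (sym (+-identityʳ _)) (trans (+-congˡ (sym fourth)) third)))
    where
    coef-sum : ∀ f g h m → coef (f ⊞ g ⊞ h) m ≈ coef f m + coef g m + coef h m
    coef-sum f g h m = trans (coef-⊞ (f ⊞ g) h m) (+-congʳ (coef-⊞ f g m))
    three : ∀ {x y z} → y ≈ 0# → z ≈ 0# → x + y + z ≈ x
    three y z = trans (+-cong (+-congˡ y) z) (trans (+-identityʳ _) (+-identityʳ _))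
    -- At x₁^q in the first coordinate only X₁ η₁ contributes, so the coefficient of x₁^(q-1) in a₁
    -- is 1; here `suc r` is q - 1.
    first : coef a₁ (suc r , 0 , 0) ≈ 1#
    first = trans (sym (trans (coef-sum (X₁ ⊠ a₁) (X₂ ⊠ b₁) (X₃ ⊠ d₁) (q , 0 , 0)) (trans
      (three (trans (coef-monomial-⊠ _ b₁ _) (shifted-vanish (0 , 1 , 0) (q , 0 , 0) b₁ λ _ ()))
             (trans (coef-monomial-⊠ _ d₁ _) (shifted-vanish (0 , 0 , 1) (q , 0 , 0) d₁ λ _ ())))
      (trans (coef-monomial-⊠ _ a₁ _) (shifted-hit (1 , 0 , 0) (suc r , 0 , 0) a₁ ≡.refl)))))
      (trans (sym (coeffs e₁ (q , 0 , 0))) (leading (q , 0 , 0)))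
      where
      leading : ∀ m → coef (monomial m) m ≈ 1#
      leading m rewrite sameExp-true {m} ≡.refl = +-identityʳ 1#
    -- At x₁^(q-1) x₂ in the second coordinate the left side x₂^q contributes nothing, since q - 1
    -- is positive. Only X₁ η₁ and X₂ η₂ reach this monomial.
    third : coef a₂ (r , 1 , 0) + coef b₂ (suc r , 0 , 0) ≈ 0#
    third = trans (sym (trans (coef-sum (X₁ ⊠ a₂) (X₂ ⊠ b₂) (X₃ ⊠ d₂) m) (trans
      (+-congˡ (trans (coef-monomial-⊠ _ d₂ m) (shifted-vanish (0 , 0 , 1) m d₂ λ _ ()))) (trans (+-identityʳ _)
      (+-cong (trans (coef-monomial-⊠ _ a₂ m) (shifted-hit (1 , 0 , 0) (r , 1 , 0) a₂ ≡.refl))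
              (trans (coef-monomial-⊠ _ b₂ m) (shifted-hit (0 , 1 , 0) (suc r , 0 , 0) b₂ ≡.refl)))))))
      (sym (coeffs e₂ m))
      where m = (suc r , 1 , 0)
    miss₁ : ∀ {l₁} → q ℕ.+ l₁ ≢ suc r
    miss₁ {l₁} e = ℕₚ.<⇒≢ (ℕₚ.m≤m+n (suc (suc r)) l₁) (≡.sym e)
    -- The monomial x₁^(q-1) x₂ x₃^q has degree exactly 2q. It is reached only through x₂ x₃^q in
    -- the first minor and -x₁ x₃^q in the second, because its exponent of x₁ is below q.
    second : coef a₁ (suc r , 0 , 0) ≈ coef a₂ (r , 1 , 0)
    second = Algebra.Properties.Ring.x∙y⁻¹≈ε⇒x≈y ring _ _ (trans (sym (trans
      (coef-sum (a₁ ⊠ proj₁ minors) (a₂ ⊠ proj₁ (proj₂ minors)) (a₃ ⊠ proj₂ (proj₂ minors)) m)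
      (trans (three′
        (trans (coef-binomial-⊠ a₁ m (proj₁ minors-binomial)) (trans (+-cong (shifted-hit (0 , 1 , q) (suc r , 0 , 0) a₁ (cong (λ k → suc r , 1 , k) (ℕₚ.+-identityʳ q)))
          (trans (-‿cong (shifted-vanish (0 , q , 1) m a₁ λ _ ())) -0≈0)) (+-identityʳ _)))
        (trans (coef-binomial-⊠ a₂ m (proj₁ (proj₂ minors-binomial))) (trans (+-cong (shifted-vanish (q , 0 , 1) m a₂ λ l e → ⊥-elim (miss₁ (cong proj₁ e)))
          (-‿cong (shifted-hit (1 , 0 , q) (r , 1 , 0) a₂ (cong (λ k → suc r , 1 , k) (ℕₚ.+-identityʳ q))))) (+-identityˡ _)))
        (trans (coef-binomial-⊠ a₃ m (proj₂ (proj₂ minors-binomial))) (trans (+-cong (shifted-vanish (1 , q , 0) m a₃ λ _ ())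
          (trans (-‿cong (shifted-vanish (q , 1 , 0) m a₃ λ l e → ⊥-elim (miss₁ (cong proj₁ e)))) -0≈0)) (+-identityʳ _))))
      refl)))
      (low₁ m (ℕₚ.≤-reflexive (deg-eq r))))
      where
      m = (suc r , 1 , q)
      -0≈0 = Algebra.Properties.Ring.-0#≈0# ring
      three′ : ∀ {x y z x' y'} → x ≈ x' → y ≈ - y' → z ≈ 0# → x + y + z ≈ x' - y'
      three′ p r s = trans (+-cong (+-cong p r) s) (+-identityʳ _)
      deg-eq : ∀ r → suc r ℕ.+ 1 ℕ.+ suc (suc r) ≡ 2 ℕ.* suc (suc r)
      deg-eq = ℕ-Solver.solve-∀
    -- The monomial x₁^(2q-1) x₃, again of degree 2q, is reached only through x₁^q x₃ in the second
    -- minor.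
    fourth : coef b₂ (suc r , 0 , 0) ≈ 0#
    fourth = trans (sym (trans (coef-sum (b₁ ⊠ proj₁ minors) (b₂ ⊠ proj₁ (proj₂ minors)) (b₃ ⊠ proj₂ (proj₂ minors)) m)
      (trans (+-cong (+-cong
        (trans (coef-binomial-⊠ b₁ m (proj₁ minors-binomial)) (difference (shifted-vanish (0 , 1 , q) m b₁ λ _ ()) (shifted-vanish (0 , q , 1) m b₁ λ _ ())))
        (trans (coef-binomial-⊠ b₂ m (proj₁ (proj₂ minors-binomial))) (trans (+-cong (shifted-hit (q , 0 , 1) (suc r , 0 , 0) b₂ ≡.refl)
          (trans (-‿cong (shifted-vanish (1 , 0 , q) m b₂ λ _ ())) -0≈0)) (+-identityʳ _))))
        (trans (coef-binomial-⊠ b₃ m (proj₂ (proj₂ minors-binomial))) (difference (shifted-vanish (1 , q , 0) m b₃ λ _ ()) (shifted-vanish (q , 1 , 0) m b₃ λ _ ()))))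
        (trans (+-identityʳ _) (+-identityˡ _)))))
      (low₂ m (ℕₚ.≤-reflexive (deg-eq r)))
      where
      m = (q ℕ.+ suc r , 0 , 1)
      -0≈0 = Algebra.Properties.Ring.-0#≈0# ring
      difference : ∀ {x y} → x ≈ 0# → y ≈ 0# → x - y ≈ 0#
      difference p s = trans (+-cong p (-‿cong s)) (-‿inverseʳ 0#)
      deg-eq : ∀ r → suc (suc r) ℕ.+ suc r ℕ.+ 0 ℕ.+ 1 ≡ 2 ℕ.* suc (suc r)
      deg-eq = ℕ-Solver.solve-∀

-- A point outside A excludes freeness when |A| ≥ 2q

module UncoveredPoint {c ℓ} {q : ℕ} (𝔽 : FiniteField c ℓ q) where
  open FiniteField 𝔽 hiding (_≟_)
  open PolynomialRing 𝔽
  open PolynomialEvaluation 𝔽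
  open LinearForms 𝔽
  open VanishingIdeal 𝔽
  open Derivations 𝔽
  open Combinations 𝔽
  open LowCoefficients 𝔽
  open RingVectors polyRing using (scale; _+³_; det-parallel; det-rotate)
  open Binomials polyRing using (_^_; ^-distrib-*)
  private
    module S = CommutativeRing polyRing
    module C = RingMap constMap

  -- Restriction to the line x = t p, with X₁ serving as the parameter t. Staying inside S keeps the
  -- cancellation lemmas available.
  module LineThrough (p : V3 𝔽) where
    module Line = Substitute (const (proj₁ p) ⊠ X₁) (const (proj₁ (proj₂ p)) ⊠ X₁) (const (proj₂ (proj₂ p)) ⊠ X₁)
    module σ = RingMap Line.evalMap

    σ : Polynomial → Polynomial
    σ = Line.eval

    σ³ : Vec3 → Vec3
    σ³ (f , g , h) = σ f , σ g , σ h

    σ-linP : ∀ α → σ (linP 𝔽 α) ≋ const (dot 𝔽 α p) ⊠ X₁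
    σ-linP (a , b , d) = ≋-trans (Line.eval-linP (a , b , d)) (≋-trans
      (solve 7 (λ a b d u v w x → a :* (u :* x) :+ b :* (v :* x) :+ d :* (w :* x) := (a :* u :+ b :* v :+ d :* w) :* x) ≋-refl
        (const a) (const b) (const d) (const (proj₁ p)) (const (proj₁ (proj₂ p))) (const (proj₂ (proj₂ p))) X₁)
      (S.*-congʳ (≋-sym (≋-trans (C.+-homo _ _) (S.+-cong (≋-trans (C.+-homo _ _) (S.+-cong (C.*-homo _ _) (C.*-homo _ _))) (C.*-homo _ _))))))
      where open IntegerSolver polyRing

    cancel-const-X₁ : ∀ {u} → ¬ (u ≈ 0#) → ∀ {f} → (const u ⊠ X₁) ⊠ f ≋ [] → f ≋ []
    cancel-const-X₁ {u} u≉0 z = cancel-linP {u , 0# , 0#} (inj₁ u≉0) (≋-trans (S.*-congʳ (≋-trans (linP-∙ (u , 0# , 0#))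
      (≋-trans (S.+-cong (S.+-congˡ (≋-trans (S.*-congʳ C.0-homo) (S.zeroˡ _))) (≋-trans (S.*-congʳ C.0-homo) (S.zeroˡ _)))
        (≋-trans (S.+-identityʳ _) (S.+-identityʳ _))))) z)

    -- On the line each α becomes α(p) t, so Q becomes a nonzero constant times a power of t. This
    -- is where it matters that p lies outside A.
    cancel-σ-product : ∀ {A} → All (λ α → ¬ (dot 𝔽 α p ≈ 0#)) A → ∀ {f} → σ (definingPolynomial A) ⊠ f ≋ [] → f ≋ []
    cancel-σ-product []             {f} z = ≋-trans (≋-sym (≋-trans (S.*-congʳ σ.1-homo) (S.*-identityˡ f))) z
    cancel-σ-product (_∷_ {α} n ns) {f} z = cancel-σ-product ns (cancel-const-X₁ n (≋-trans (≋-sym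
      (≋-trans (S.*-congʳ (≋-trans (σ.*-homo (linP 𝔽 α) _) (S.*-congʳ (σ-linP α)))) (S.*-assoc _ _ _))) z))

    σ-X₁ : σ X₁ ≋ const (proj₁ p) ⊠ X₁
    σ-X₁ = ≋-trans (Line.eval-monomial (1 , 0 , 0)) (≋-trans (S.*-congˡ (S.*-identityˡ _)) (≋-trans (S.*-identityʳ _) (S.*-identityʳ _)))

    σ-X₂ : σ X₂ ≋ const (proj₁ (proj₂ p)) ⊠ X₁
    σ-X₂ = ≋-trans (Line.eval-monomial (0 , 1 , 0)) (≋-trans (S.*-identityˡ _) (≋-trans (S.*-identityʳ _) (S.*-identityʳ _)))

    σ-X₃ : σ X₃ ≋ const (proj₂ (proj₂ p)) ⊠ X₁
    σ-X₃ = ≋-trans (Line.eval-monomial (0 , 0 , 1)) (≋-trans (S.*-identityˡ _) (≋-trans (S.*-identityˡ _) (S.*-identityʳ _)))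

    σ-𝐱 : σ³ 𝐱 ≈³ scale X₁ (const³ p)
    σ-𝐱 = ≋-trans σ-X₁ (S.*-comm _ _) , ≋-trans σ-X₂ (S.*-comm _ _) , ≋-trans σ-X₃ (S.*-comm _ _)

    σ-𝐱^q : σ³ 𝐱^q ≈³ scale (X₁ ^ q) (const³ p)
    σ-𝐱^q = ≋-trans (Line.eval-monomial (q , 0 , 0)) (≋-trans (S.*-congˡ (S.*-identityˡ _)) (≋-trans (S.*-identityʳ _) (power _)))
          , ≋-trans (Line.eval-monomial (0 , q , 0)) (≋-trans (S.*-identityˡ _) (≋-trans (S.*-identityʳ _) (power _)))
          , ≋-trans (Line.eval-monomial (0 , 0 , q)) (≋-trans (S.*-identityˡ _) (≋-trans (S.*-identityˡ _) (power _)))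
      where
      power : ∀ d → (const d ⊠ X₁) ^ q ≋ X₁ ^ q ⊠ const d
      power d = ≋-trans (^-distrib-* (const d) X₁ q) (≋-trans (S.*-congʳ (const^q d)) (S.*-comm _ _))

    σ-∙ : ∀ u v → σ (u ∙ v) ≋ σ³ u ∙ σ³ v
    σ-∙ _ _ = ≋-trans (σ.+-homo _ _) (S.+-cong (≋-trans (σ.+-homo _ _) (S.+-cong (σ.*-homo _ _) (σ.*-homo _ _))) (σ.*-homo _ _))

    σ-× : ∀ u v → σ³ (u ×³ v) ≈³ (σ³ u ×³ σ³ v)
    σ-× _ _ = minor , minor , minor
      where
      minor : ∀ {f g h k} → σ (f ⊠ g ⊞ neg (h ⊠ k)) ≋ σ f ⊠ σ g ⊞ neg (σ h ⊠ σ k)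
      minor = ≋-trans (σ.+-homo _ _) (S.+-cong (σ.*-homo _ _) (≋-trans (σ.-‿homo _) (S.-‿cong (σ.*-homo _ _))))

    -- On the line the Euler field and its Frobenius twist are both multiples of p.
    σ-det : ∀ w → σ (det 𝐱 𝐱^q w) ≋ []
    σ-det w = ≋-trans (σ-∙ 𝐱 (𝐱^q ×³ w)) (≋-trans
      (∙-cong σ-𝐱
        (≈³-trans (σ-× 𝐱^q w)
          (×³-cong σ-𝐱^q (≈³-refl))))
      (det-parallel X₁ (X₁ ^ q) (const³ p) (σ³ w)))

    private module cst = RingMap (At.evalMap 0# 0# 0#)

    constantTerm-X₁ : ∀ f → constantTerm (X₁ ⊠ f) ≈ 0#
    constantTerm-X₁ f = trans (cst.*-homo X₁ f) (trans (*-congʳ (trans (At.eval-monomial 0# 0# 0# (1 , 0 , 0)) (trans (*-congʳ (zeroˡ _)) (zeroˡ _)))) (zeroˡ _))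

    constantTerm-∙𝐱 : ∀ g → constantTerm (g ∙ 𝐱) ≈ 0#
    constantTerm-∙𝐱 (g₁ , g₂ , g₃) = trans (cst.+-homo _ _) (trans (+-cong (trans (cst.+-homo _ _)
        (trans (+-cong (vanish g₁ (1 , 0 , 0) refl) (vanish g₂ (0 , 1 , 0) refl)) (+-identityˡ _))) (vanish g₃ (0 , 0 , 1) refl)) (+-identityˡ _))
      where
      vanish : ∀ g m → coef (monomial m) (0 , 0 , 0) ≈ 0# → constantTerm (g ⊠ monomial m) ≈ 0#
      vanish g m z = trans (cst.*-homo g (monomial m)) (trans (*-congˡ (trans (constantTerm-coef (monomial m)) z)) (zeroʳ _))

    constantTerm-𝐱 : ∀ d g → constantTerm (const d ⊞ X₁ ⊠ g) ≈ d
    constantTerm-𝐱 d g = trans (cst.+-homo (const d) (X₁ ⊠ g)) (trans (+-cong (At.eval-const 0# 0# 0# d) (constantTerm-X₁ g)) (+-identityʳ d))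

    -- The line passes through the origin, so restriction preserves the value there.
    σ-constant : ∀ f → constantTerm (σ f) ≈ constantTerm f
    σ-constant f = compare (constant-split f)
      where
      open IntegerSolver polyRing
      compare : (Σ Carrier λ d → Σ Vec3 λ g → f ≋ const d ⊞ g ∙ 𝐱) → constantTerm (σ f) ≈ constantTerm f
      compare (d , g@(g₁ , g₂ , g₃) , e) = trans (trans (cst.to-cong (≋-trans (σ.to-cong e) (≋-trans (σ.+-homo (const d) (g ∙ 𝐱)) (S.+-cong (Line.eval-const d)
          (≋-trans (σ-∙ g 𝐱) (≋-trans (∙-cong (≈³-refl) σ-𝐱) (≋-sym (∙-scale (σ³ g) X₁ (const³ p)))))))))
          (constantTerm-𝐱 d (σ³ g ∙ const³ p)))
        (sym (trans (cst.to-cong e) (trans (cst.+-homo (const d) (g ∙ 𝐱)) (trans (+-cong (At.eval-const 0# 0# 0# d) (constantTerm-∙𝐱 g)) (+-identityʳ d)))))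

  module _ (A : List (V3 𝔽)) (arr : IsArrangement 𝔽 A) (p : V3 𝔽) (uncovered : All (λ α → ¬ (dot 𝔽 α p ≈ 0#)) A)
           (k : ℕ) (θ : Fin k → Vec3) (basis : IsLogarithmicBasis A k θ)
           (r : ℕ) (q≡ : q ≡ suc (suc r)) where
    open LineThrough p
    private
      Q = definingPolynomial A
      logθ = proj₁ basis

      expand : ∀ δ → Logarithmic A δ → Fin k → Polynomial
      expand δ log = proj₁ (proj₁ (proj₂ basis) δ log)

      expand-spec : ∀ δ log → δ ≈³ combination k (expand δ log) θ
      expand-spec δ log = proj₂ (proj₁ (proj₂ basis) δ log)

      e₁ e₂ e₃ : Vec3
      e₁ = const 1# , [] , []
      e₂ = [] , const 1# , []
      e₃ = [] , [] , const 1#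

      expand-Q : Vec3 → Fin k → Polynomial
      expand-Q e = expand (scale Q e) (product-logarithmic A e)

      E : Fin k → Vec3
      E j = expand-Q e₁ j , expand-Q e₂ j , expand-Q e₃ j

      -- Coordinates are given by a matrix with denominator Q, because Q S³ ⊆ D(A).
      coordinates : ∀ δ log j → Q ⊠ expand δ log j ≋ δ ∙ E j
      coordinates δ@(f₁ , f₂ , f₃) log = combination-unique basis (λ j → Q ⊠ expand δ log j) (λ j → δ ∙ E j)
          (≈³-trans (≈³-trans (combination-scale k Q (expand δ log) θ) (scale-cong (≋-refl {Q}) (≈³-sym (expand-spec δ log))))
            (≈³-trans split (≈³-sym (≈³-trans (combination-+ k (λ j → f₁ ⊠ expand-Q e₁ j ⊞ f₂ ⊠ expand-Q e₂ j) (λ j → f₃ ⊠ expand-Q e₃ j) θ)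
              (+³-cong (≈³-trans (combination-+ k (λ j → f₁ ⊠ expand-Q e₁ j) (λ j → f₂ ⊠ expand-Q e₂ j) θ) (+³-cong (part f₁ e₁) (part f₂ e₂))) (part f₃ e₃))))))
        where
        open IntegerSolver polyRing
        part : ∀ f e → combination k (λ j → f ⊠ expand-Q e j) θ ≈³ scale f (scale Q e)
        part f e = ≈³-trans (combination-scale k f (expand-Q e) θ) (scale-cong (≋-refl {f}) (≈³-sym (expand-spec (scale Q e) _)))
        split : scale Q δ ≈³ ((scale f₁ (scale Q e₁) +³ scale f₂ (scale Q e₂)) +³ scale f₃ (scale Q e₃))
        split = solve 4 (λ q f g h → q :* f := f :* (q :* :1) :+ g :* (q :* :0) :+ h :* (q :* :0)) ≋-refl Q f₁ f₂ f₃
              , solve 4 (λ q f g h → q :* g := f :* (q :* :0) :+ g :* (q :* :1) :+ h :* (q :* :0)) ≋-refl Q f₁ f₂ f₃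
              , solve 4 (λ q f g h → q :* h := f :* (q :* :0) :+ g :* (q :* :0) :+ h :* (q :* :1)) ≋-refl Q f₁ f₂ f₃

      a b : Fin k → Polynomial
      a = expand 𝐱 (euler-logarithmic A)
      b = expand 𝐱^q (frobenius-logarithmic A)

      -- On the line 𝐱 becomes t p and 𝐱^q becomes t^q p. By `coordinates`, Q times the j-th
      -- coordinate is then t, respectively t^q, times one common polynomial. Cancelling Q gives b =
      -- t^(q-1) a on the line, and q - 1 is positive.
      b-constant : ∀ j → constantTerm (b j) ≈ 0#
      b-constant j = trans (sym (σ-constant (b j))) (trans (At.eval-cong 0# 0# 0# σb≋)
          (trans (At.eval-cong 0# 0# 0# (S.*-assoc X₁ (X₁ ^ r) (σ (a j)))) (constantTerm-X₁ (X₁ ^ r ⊠ σ (a j)))))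
        where
        open IntegerSolver polyRing
        restricted : ∀ δ log {h} → σ³ δ ≈³ scale h (const³ p) → σ Q ⊠ σ (expand δ log j) ≋ h ⊠ (const³ p ∙ σ³ (E j))
        restricted δ log {h} σδ = ≋-trans (≋-sym (σ.*-homo Q _)) (≋-trans (σ.to-cong (coordinates δ log j)) (≋-trans (σ-∙ δ (E j))
          (≋-trans (∙-cong σδ ≈³-refl) (scale-∙ h (const³ p) (σ³ (E j))))))
        X₁^q : X₁ ^ q ≋ X₁ ^ suc r ⊠ X₁
        X₁^q = ≋-trans (S.reflexive (cong (X₁ ^_) q≡)) (S.*-comm X₁ (X₁ ^ suc r))
        σb≋ : σ (b j) ≋ X₁ ^ suc r ⊠ σ (a j)
        σb≋ = Algebra.Properties.Ring.x∙y⁻¹≈ε⇒x≈y S.ring _ _ (cancel-σ-product uncovered (≋-trans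
          (solve 4 (λ q b w a → q :* (b :- w :* a) := q :* b :- w :* (q :* a)) ≋-refl (σ Q) (σ (b j)) (X₁ ^ suc r) (σ (a j)))
          (≋-trans (S.+-cong (≋-trans (restricted 𝐱^q _ σ-𝐱^q) (S.*-congʳ X₁^q)) (S.-‿cong (S.*-congˡ (restricted 𝐱 _ σ-𝐱))))
            (solve 3 (λ w x e → (w :* x) :* e :- w :* (x :* e) := :0) ≋-refl (X₁ ^ suc r) X₁ (const³ p ∙ σ³ (E j))))))

      g : Fin k → Vec3
      g j = proj₁ (proj₂ (constant-split (b j)))

      b-split : ∀ j → b j ≋ g j ∙ 𝐱
      b-split j = ≋-trans split (≋-trans (S.+-congʳ (≋-trans (C.to-cong d≈0) C.0-homo)) (S.+-identityˡ _))
        where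
        d = proj₁ (constant-split (b j))
        split : b j ≋ const d ⊞ g j ∙ 𝐱
        split = proj₂ (proj₂ (constant-split (b j)))
        module cst = RingMap (At.evalMap 0# 0# 0#)
        d≈0 : d ≈ 0#
        d≈0 = trans (sym (trans (cst.to-cong split) (trans (cst.+-homo (const d) (g j ∙ 𝐱)) (trans
          (+-cong (At.eval-const 0# 0# 0# d) (constantTerm-∙𝐱 (g j))) (+-identityʳ d))))) (b-constant j)

      η₁ η₂ η₃ : Vec3
      η₁ = combination k (λ j → proj₁ (g j)) θ
      η₂ = combination k (λ j → proj₁ (proj₂ (g j))) θ
      η₃ = combination k (λ j → proj₂ (proj₂ (g j))) θ

      -- Each coordinate of 𝐱^q has no constant term and so is a combination of the variables.
      -- Collecting the part of x_i in all coordinates gives η_i, which is logarithmic as a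
      -- combination of the basis.
      expansion : 𝐱^q ≈³ ((scale X₁ η₁ +³ scale X₂ η₂) +³ scale X₃ η₃)
      expansion = ≈³-trans (expand-spec 𝐱^q _) (≈³-trans (combination-cong k θ (λ j → ≋-trans (b-split j) (commute j)))
        (≈³-trans
          (combination-+ k (λ j → X₁ ⊠ proj₁ (g j) ⊞ X₂ ⊠ proj₁ (proj₂ (g j))) (λ j → X₃ ⊠ proj₂ (proj₂ (g j))) θ)
          (+³-cong
            (≈³-trans
              (combination-+ k (λ j → X₁ ⊠ proj₁ (g j)) (λ j → X₂ ⊠ proj₁ (proj₂ (g j))) θ)
              (+³-cong
                (combination-scale k X₁ (λ j → proj₁ (g j)) θ) (combination-scale k X₂ (λ j → proj₁ (proj₂ (g j))) θ)))
            (combination-scale k X₃ (λ j → proj₂ (proj₂ (g j))) θ))))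
        where
        split : Fin k → Polynomial
        split j = X₁ ⊠ proj₁ (g j) ⊞ X₂ ⊠ proj₁ (proj₂ (g j)) ⊞ X₃ ⊠ proj₂ (proj₂ (g j))
        commute : ∀ j → g j ∙ 𝐱 ≋ split j
        commute j = S.+-cong (S.+-cong (S.*-comm _ _) (S.*-comm _ _)) (S.*-comm _ _)

      -- Write det(𝐱, 𝐱^q, η) = Q h. On the line the determinant vanishes and Q cancels, so h
      -- vanishes there and in particular at the origin. Then Q h has order greater than |A|.
      low-minor : 2 ℕ.* q ≤ length A → ∀ η → Logarithmic A η → Low (2 ℕ.* q) (η ∙ minors)
      low-minor size η log = quotient (product-∣-det arr {𝐱} {𝐱^q} {η} (euler-logarithmic A) (frobenius-logarithmic A) log)
        where
        quotient : Q ∣ det 𝐱 𝐱^q η → Low (2 ℕ.* q) (η ∙ minors)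
        quotient (h , det≋Qh) m m≤ = trans (coeffs (≋-trans (det-rotate η 𝐱 𝐱^q) det≋Qh) m)
          (low-product A (low-constant (trans (sym (σ-constant h)) (trans (At.eval-cong 0# 0# 0# σh≋0) (At.eval-[] 0# 0# 0#)))) m (ℕₚ.≤-trans m≤ size))
          where
          σh≋0 : σ h ≋ []
          σh≋0 = cancel-σ-product uncovered (≋-trans (≋-sym (≋-trans (σ.to-cong det≋Qh) (σ.*-homo Q h))) (σ-det η))

    uncovered-not-free : 2 ℕ.* q ≤ length A → ⊥
    uncovered-not-free size = no-expansion q≡ η₁ η₂ η₃ expansion
      (low-minor size η₁ (logarithmic-combination k _ θ logθ)) (low-minor size η₂ (logarithmic-combination k _ θ logθ))

-- Boolean list functions and finite integer sums

module BooleanLists where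
  private variable
    a b : Level
    A : Set a
    B : Set b

  true≢false : true ≢ false
  true≢false ()

  bool-ext : ∀ {x y : Bool} → (x ≡ true → y ≡ true) → (y ≡ true → x ≡ true) → x ≡ y
  bool-ext {true}  {y}     f g = ≡.sym (f ≡.refl)
  bool-ext {false} {true}  f g = g ≡.refl
  bool-ext {false} {false} f g = ≡.refl

  allB-sound : ∀ (p : A → Bool) xs → allB p xs ≡ true → All (λ x → p x ≡ true) xs
  allB-sound p []       e = []
  allB-sound p (x ∷ xs) e with p x in px
  ... | true = px ∷ allB-sound p xs e

  allB-complete : ∀ (p : A → Bool) {xs} → All (λ x → p x ≡ true) xs → allB p xs ≡ true
  allB-complete p []       = ≡.refl
  allB-complete p (e ∷ es) rewrite e = allB-complete p es

  allB-false : ∀ (p : A → Bool) xs → allB p xs ≡ false → Any (λ x → p x ≡ false) xs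
  allB-false p (x ∷ xs) e with p x in px
  ... | true  = there (allB-false p xs e)
  ... | false = here px

  anyB-true : ∀ (p : A → Bool) xs → anyB p xs ≡ true → Any (λ x → p x ≡ true) xs
  anyB-true p (x ∷ xs) e with p x in px
  ... | true  = here px
  ... | false = there (anyB-true p xs e)

  anyB-false : ∀ (p : A → Bool) xs → anyB p xs ≡ false → All (λ x → p x ≡ false) xs
  anyB-false p []       e = []
  anyB-false p (x ∷ xs) e with p x in px
  ... | false = px ∷ anyB-false p xs e

  filterB-All : ∀ (p : A → Bool) xs → All (λ x → p x ≡ true) (filterB p xs)
  filterB-All p []       = []
  filterB-All p (x ∷ xs) with p x in px
  ... | true  = px ∷ filterB-All p xs
  ... | false = filterB-All p xs

  filterB-length : ∀ (p : A → Bool) xs → length (filterB p xs) ≤ length xs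
  filterB-length p []       = z≤n
  filterB-length p (x ∷ xs) with p x
  ... | true  = s≤s (filterB-length p xs)
  ... | false = ℕₚ.m≤n⇒m≤1+n (filterB-length p xs)

  filterB-All⁺ : ∀ {ℓ} {P : A → Set ℓ} (p : A → Bool) {xs} → All P xs → All P (filterB p xs)
  filterB-All⁺ p []                 = []
  filterB-All⁺ p {x ∷ xs} (px ∷ ps) with p x
  ... | true  = px ∷ filterB-All⁺ p ps
  ... | false = filterB-All⁺ p ps

  filterB-All⁻ : ∀ {ℓ} {P : A → Set ℓ} (p : A → Bool) xs → All P (filterB p xs) → All (λ x → p x ≡ true → P x) xs
  filterB-All⁻ p []       ps = []
  filterB-All⁻ p (x ∷ xs) ps with p x in px
  filterB-All⁻ p (x ∷ xs) (px ∷ ps) | true  = (λ _ → px) ∷ filterB-All⁻ p xs ps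
  filterB-All⁻ p (x ∷ xs) ps        | false = (λ e → ⊥-elim (true≢false (≡.trans (≡.sym e) px))) ∷ filterB-All⁻ p xs ps

  filterB-Any⁺ : ∀ {ℓ} {P : A → Set ℓ} (p : A → Bool) {xs} → (∀ {x} → P x → p x ≡ true) → Any P xs → Any P (filterB p xs)
  filterB-Any⁺ p {x ∷ xs} f (here px) rewrite f px = here px
  filterB-Any⁺ p {x ∷ xs} f (there r) with p x
  ... | true  = there (filterB-Any⁺ p f r)
  ... | false = filterB-Any⁺ p f r

  filterB-Any⁻ : ∀ {ℓ} {P : A → Set ℓ} (p : A → Bool) xs → Any P (filterB p xs) → Any (λ x → p x ≡ true × P x) xs
  filterB-Any⁻ p (x ∷ xs) r with p x in px
  filterB-Any⁻ p (x ∷ xs) (here r)  | true  = here (px , r)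
  filterB-Any⁻ p (x ∷ xs) (there r) | true  = there (filterB-Any⁻ p xs r)
  filterB-Any⁻ p (x ∷ xs) r         | false = there (filterB-Any⁻ p xs r)

  filterB-mono : ∀ (p r : A → Bool) {xs} → All (λ x → p x ≡ true → r x ≡ true) xs → length (filterB p xs) ≤ length (filterB r xs)
  filterB-mono p r []                 = z≤n
  filterB-mono p r {x ∷ xs} (i ∷ is) with p x | r x | i
  ... | true  | true  | _ = s≤s (filterB-mono p r is)
  ... | true  | false | j with () ← j ≡.refl
  ... | false | true  | _ = ℕₚ.m≤n⇒m≤1+n (filterB-mono p r is)
  ... | false | false | _ = filterB-mono p r is

  filterB-strict : ∀ (p r : A → Bool) {xs} → All (λ x → p x ≡ true → r x ≡ true) xs → Any (λ x → r x ≡ true × p x ≡ false) xs →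
                   length (filterB p xs) < length (filterB r xs)
  filterB-strict p r {x ∷ xs} (i ∷ is) (here (rx , px)) rewrite rx | px = s≤s (filterB-mono p r is)
  filterB-strict p r {x ∷ xs} (i ∷ is) (there w) with p x | r x | i
  ... | true  | true  | _ = s≤s (filterB-strict p r is w)
  ... | true  | false | j with () ← j ≡.refl
  ... | false | true  | _ = ℕₚ.m≤n⇒m≤1+n (filterB-strict p r is w)
  ... | false | false | _ = filterB-strict p r is w

  ∑ : (A → ℤ) → List A → ℤ
  ∑ f xs = sumℤ (map f xs)

  ∑-cong : ∀ {f g : A → ℤ} {xs} → All (λ x → f x ≡ g x) xs → ∑ f xs ≡ ∑ g xs
  ∑-cong es = cong sumℤ (Listₚ.map-cong-local es)

  ∑-zero : ∀ {f : A → ℤ} {xs} → All (λ x → f x ≡ + 0) xs → ∑ f xs ≡ + 0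
  ∑-zero []       = ≡.refl
  ∑-zero (e ∷ es) rewrite e = ≡.trans (ℤₚ.+-identityˡ _) (∑-zero es)

  ∑-+ : ∀ (f g : A → ℤ) xs → ∑ (λ x → f x ℤ.+ g x) xs ≡ ∑ f xs ℤ.+ ∑ g xs
  ∑-+ f g []       = ≡.refl
  ∑-+ f g (x ∷ xs) = ≡.trans (cong (λ s → f x ℤ.+ g x ℤ.+ s) (∑-+ f g xs)) (interchange (f x) (g x) _ _)
    where
    interchange : ∀ a b c d → a ℤ.+ b ℤ.+ (c ℤ.+ d) ≡ a ℤ.+ c ℤ.+ (b ℤ.+ d)
    interchange = ℤ-Solver.solve-∀

  ∑-swap : ∀ (f : A → B → ℤ) xs ys → ∑ (λ x → ∑ (f x) ys) xs ≡ ∑ (λ y → ∑ (λ x → f x y) xs) ys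
  ∑-swap f []       ys = ≡.sym (∑-zero (All.tabulate {xs = ys} λ _ → ≡.refl))
  ∑-swap f (x ∷ xs) ys = ≡.trans (cong (λ s → ∑ (f x) ys ℤ.+ s) (∑-swap f xs ys)) (≡.sym (∑-+ (f x) (λ y → ∑ (λ x → f x y) xs) ys))

  ∑-filterB : ∀ (f : A → ℤ) p xs → ∑ f (filterB p xs) ≡ ∑ (λ x → if p x then f x else + 0) xs
  ∑-filterB f p []       = ≡.refl
  ∑-filterB f p (x ∷ xs) with p x
  ... | true  = cong (λ s → f x ℤ.+ s) (∑-filterB f p xs)
  ... | false = ≡.trans (∑-filterB f p xs) (≡.sym (ℤₚ.+-identityˡ _))

  ∑-map : ∀ (f : B → ℤ) (h : A → B) xs → ∑ f (map h xs) ≡ ∑ (λ x → f (h x)) xs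
  ∑-map f h xs = cong sumℤ (≡.sym (Listₚ.map-∘ xs))

  ∑-++ : ∀ (f : A → ℤ) xs ys → ∑ f (xs ++ ys) ≡ ∑ f xs ℤ.+ ∑ f ys
  ∑-++ f []       ys = ≡.sym (ℤₚ.+-identityˡ _)
  ∑-++ f (x ∷ xs) ys = ≡.trans (cong (λ s → f x ℤ.+ s) (∑-++ f xs ys)) (≡.sym (ℤₚ.+-assoc (f x) _ _))

  ∑-indicator : ∀ c (p : A → Bool) xs → ∑ (λ x → if p x then c else + 0) xs ≡ c ℤ.* + length (filterB p xs)
  ∑-indicator c p []       = ≡.sym (ℤₚ.*-zeroʳ c)
  ∑-indicator c p (x ∷ xs) with p x
  ... | true  = ≡.trans (cong (λ s → c ℤ.+ s) (∑-indicator c p xs)) (≡.sym (ℤₚ.*-suc c (+ length (filterB p xs))))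
  ... | false = ≡.trans (ℤₚ.+-identityˡ _) (∑-indicator c p xs)

  sameMask : List Bool → List Bool → Bool
  sameMask []          []          = true
  sameMask (true  ∷ m) (true  ∷ n) = sameMask m n
  sameMask (false ∷ m) (false ∷ n) = sameMask m n
  sameMask _           _           = false

  sameMask-refl : ∀ m → sameMask m m ≡ true
  sameMask-refl []          = ≡.refl
  sameMask-refl (true ∷ m)  = sameMask-refl m
  sameMask-refl (false ∷ m) = sameMask-refl m

  sameMask-sound : ∀ m n → sameMask m n ≡ true → m ≡ n
  sameMask-sound []          []          e = ≡.refl
  sameMask-sound (true  ∷ m) (true  ∷ n) e = cong (true ∷_) (sameMask-sound m n e)
  sameMask-sound (false ∷ m) (false ∷ n) e = cong (false ∷_) (sameMask-sound m n e)

  masks-length : ∀ n → All (λ m → length m ≡ n) (masks n)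
  masks-length zero    = ≡.refl ∷ []
  masks-length (suc n) = Allₚ.++⁺ (Allₚ.map⁺ (All.map (cong suc) (masks-length n)))
    (Allₚ.++⁺ (Allₚ.map⁺ (All.map (cong suc) (masks-length n))) [])

  -- Every mask of a given length is enumerated exactly once, so a sum supported on one mask returns
  -- its single value.
  ∑-masks : ∀ c m₀ → ∑ (λ m → if sameMask m m₀ then c else + 0) (masks (length m₀)) ≡ c
  ∑-masks c [] = ℤₚ.+-identityʳ c
  ∑-masks c (b ∷ m₀) = ≡.trans (∑-++ f (map (true ∷_) (masks n)) (map (false ∷_) (masks n) ++ []))
      (≡.trans (≡.cong₂ ℤ._+_ (∑-map f (true ∷_) (masks n)) (≡.trans (∑-++ f (map (false ∷_) (masks n)) []) (≡.trans (ℤₚ.+-identityʳ _) (∑-map f (false ∷_) (masks n)))))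
      (split b))
    where
    n = length m₀
    f : List Bool → ℤ
    f m = if sameMask m (b ∷ m₀) then c else + 0
    split : ∀ b → ∑ (λ m → if sameMask (true ∷ m) (b ∷ m₀) then c else + 0) (masks n) ℤ.+
                  ∑ (λ m → if sameMask (false ∷ m) (b ∷ m₀) then c else + 0) (masks n) ≡ c
    split true  = ≡.trans (≡.cong₂ ℤ._+_ (∑-masks c m₀) (∑-zero {xs = masks n} (All.tabulate λ _ → ≡.refl))) (ℤₚ.+-identityʳ c)
    split false = ≡.trans (≡.cong₂ ℤ._+_ (∑-zero {xs = masks n} (All.tabulate λ _ → ≡.refl)) (∑-masks c m₀)) (ℤₚ.+-identityˡ c)

  length-concatMap : ∀ (f : A → List B) n xs → All (λ x → length (f x) ≡ n) xs → length (concatMap f xs) ≡ length xs ℕ.* n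
  length-concatMap f n []       []       = ≡.refl
  length-concatMap f n (x ∷ xs) (e ∷ es) = ≡.trans (Listₚ.length-++ (f x)) (≡.cong₂ ℕ._+_ e (length-concatMap f n xs es))

-- Points of a subspace and its dimension

module SubspaceCounting {c ℓ} {q : ℕ} (𝔽 : FiniteField c ℓ q) where
  open FiniteField 𝔽
  open BooleanLists
  open IntegerSolver commRing
  open Algebra.Properties.Ring ring using (x∙y⁻¹≈ε⇒x≈y)
  open FieldPolynomials 𝔽 using (*-cancelˡ-0)

  infix 4 _≈V_
  _≈V_ : V3 𝔽 → V3 𝔽 → Set ℓ
  (u₁ , u₂ , u₃) ≈V (v₁ , v₂ , v₃) = (u₁ ≈ v₁) × (u₂ ≈ v₂) × (u₃ ≈ v₃)

  0V : V3 𝔽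
  0V = 0# , 0# , 0#

  V3-setoid : Setoid c ℓ
  V3-setoid = record { Carrier = V3 𝔽 ; _≈_ = _≈V_ ; isEquivalence = record
    { refl = refl , refl , refl
    ; sym = λ (a , b , d) → sym a , sym b , sym d
    ; trans = λ (a , b , d) (a' , b' , d') → trans a a' , trans b b' , trans d d' } }

  private module V = Setoid V3-setoid
  open DistinctLists V3-setoid using (Distinct; length-mono)

  _∈V_ : V3 𝔽 → List (V3 𝔽) → Set _
  v ∈V vs = Any (v ≈V_) vs

  isZero-sound : ∀ {x} → isZero 𝔽 x ≡ true → x ≈ 0#
  isZero-sound {x} e with x ≟ 0#
  ... | yes z = z

  isZero-complete : ∀ {x} → x ≈ 0# → isZero 𝔽 x ≡ true
  isZero-complete {x} z = dec-true (x ≟ 0#) z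

  dot-cong : ∀ α {u v} → u ≈V v → dot 𝔽 α u ≈ dot 𝔽 α v
  dot-cong α (a , b , d) = +-cong (+-cong (*-congˡ a) (*-congˡ b)) (*-congˡ d)

  Zeros : List (V3 𝔽) → V3 𝔽 → Set _
  Zeros X v = All (λ α → dot 𝔽 α v ≈ 0#) X

  inX-sound : ∀ X {v} → inX 𝔽 X v ≡ true → Zeros X v
  inX-sound X e = All.map isZero-sound (allB-sound _ X e)

  inX-complete : ∀ {X v} → Zeros X v → inX 𝔽 X v ≡ true
  inX-complete z = allB-complete _ (All.map isZero-complete z)

  Zeros-cong : ∀ {X u v} → u ≈V v → Zeros X u → Zeros X v
  Zeros-cong e = All.map λ {α} z → trans (sym (dot-cong α e)) z

  concatMap-distinct : ∀ {a b ℓ'} {A : Set a} {B : Set b} {R : A → A → Set ℓ'} {r} {T : B → B → Set r} (f : A → List B) {xs} → AllPairs R xs →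
    All (λ x → AllPairs T (f x)) xs → (∀ {x y} → R x y → All (λ u → All (T u) (f y)) (f x)) → AllPairs T (concatMap f xs)
  concatMap-distinct f dx inner cross = AllPairsₚ.concat⁺ (Allₚ.map⁺ inner) (AllPairsₚ.map⁺ (AllPairs.map cross dx))

  points-complete : ∀ v → v ∈V points 𝔽
  points-complete (a , b , d) = Anyₚ.concat⁺ (Anyₚ.map⁺ (Any.map (λ ea → Anyₚ.concat⁺ (Anyₚ.map⁺ (Any.map (λ eb → Anyₚ.map⁺
    (Any.map (λ ed → ea , eb , ed) (complete d))) (complete b)))) (complete a)))

  row : Carrier → List (V3 𝔽)
  row a = concatMap (λ b → map (λ d → a , b , d) elems) elems

  row-All : ∀ {ℓ'} {P : V3 𝔽 → Set ℓ'} a → (∀ b d → P (a , b , d)) → All P (row a)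
  row-All a f = Allₚ.concat⁺ (Allₚ.map⁺ {f = λ b → map (λ d → a , b , d) elems} (All.tabulate {xs = elems} λ {b} _ → Allₚ.map⁺ (All.tabulate λ {d} _ → f b d)))

  points-distinct : Distinct (points 𝔽)
  points-distinct = concatMap-distinct _ distinct (All.tabulate λ {a} _ →
      concatMap-distinct _ distinct
        (All.tabulate λ {b} _ → AllPairsₚ.map⁺ (AllPairs.map (λ d≉d' e → d≉d' (proj₂ (proj₂ e))) distinct))
        (λ b≉b' → Allₚ.map⁺ (All.tabulate λ _ → Allₚ.map⁺ (All.tabulate λ _ e → b≉b' (proj₁ (proj₂ e))))))
    (λ {a} {a'} a≉a' → row-All a λ _ _ → row-All a' λ _ _ e → a≉a' (proj₁ e))

  points-length : length (points 𝔽) ≡ q ℕ.^ 3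
  points-length = ≡.trans (length-concatMap _ (q ℕ.* q) elems (All.tabulate λ _ → ≡.trans (length-concatMap _ q elems
      (All.tabulate λ _ → ≡.trans (Listₚ.length-map _ elems) size)) (cong (ℕ._* q) size)))
    (≡.trans (cong (ℕ._* (q ℕ.* q)) size) (cong (λ n → q ℕ.* (q ℕ.* n)) (≡.sym (ℕₚ.*-identityʳ q))))

  subsetB-sound : ∀ X Y → subsetB 𝔽 X Y ≡ true → ∀ {v} → Zeros X v → Zeros Y v
  subsetB-sound X Y e {v} z with find (points-complete v)
  ... | u , u∈ , v≈u = Zeros-cong (V.sym {v} {u} v≈u) (inX-sound Y (All.lookup (filterB-All⁻ (inX 𝔽 X) (points 𝔽) (allB-sound (inX 𝔽 Y) _ e)) u∈
                          (inX-complete (Zeros-cong v≈u z))))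

  subsetB-complete : ∀ X Y → (∀ {v} → Zeros X v → Zeros Y v) → subsetB 𝔽 X Y ≡ true
  subsetB-complete X Y f = allB-complete (inX 𝔽 Y) (All.map (λ e → inX-complete (f (inX-sound X e))) (filterB-All (inX 𝔽 X) (points 𝔽)))

  pointsOf : List (V3 𝔽) → List (V3 𝔽)
  pointsOf X = filterB (inX 𝔽 X) (points 𝔽)

  count : List (V3 𝔽) → ℕ
  count X = length (pointsOf X)

  pointsOf-complete : ∀ {X v} → Zeros X v → v ∈V pointsOf X
  pointsOf-complete {X} {v} z = filterB-Any⁺ (inX 𝔽 X) (λ v≈u → inX-complete (Zeros-cong v≈u z)) (points-complete v)

  filterB-distinct : ∀ (p : V3 𝔽 → Bool) {xs} → Distinct xs → Distinct (filterB p xs)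
  filterB-distinct p []                 = []
  filterB-distinct p {x ∷ xs} (d ∷ ds) with p x
  ... | true  = filterB-All⁺ p d ∷ filterB-distinct p ds
  ... | false = filterB-distinct p ds

  tuples-All : ∀ {a ℓ'} {A : Set a} {P : A → Set ℓ'} {xs} → All P xs → ∀ k → All (λ t → All P t × length t ≡ k) (tuples xs k)
  tuples-All ps zero    = ([] , ≡.refl) ∷ []
  tuples-All ps (suc k) = Allₚ.concat⁺ (Allₚ.map⁺ (All.map (λ px → Allₚ.map⁺ (All.map (λ { (pt , e) → px ∷ pt , cong suc e }) (tuples-All ps k))) ps))

  tuples-lengths : ∀ {a} {A : Set a} (xs : List A) k → All (λ t → length t ≡ k) (tuples xs k)
  tuples-lengths xs k = All.map proj₂ (tuples-All {P = λ _ → ⊤} (All.tabulate {xs = xs} λ _ → tt) k)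

  tuples-complete : ∀ as → Any (Pointwise _≈_ as) (tuples elems (length as))
  tuples-complete []       = here []
  tuples-complete (a ∷ as) = Anyₚ.concat⁺ (Anyₚ.map⁺ (Any.map (λ ea → Anyₚ.map⁺ (Any.map (ea ∷_) (tuples-complete as))) (complete a)))

  tuples-length : ∀ {a} {A : Set a} (xs : List A) k → length (tuples xs k) ≡ length xs ℕ.^ k
  tuples-length xs zero    = ≡.refl
  tuples-length xs (suc k) = length-concatMap _ (length xs ℕ.^ k) xs (All.tabulate λ _ → ≡.trans (Listₚ.length-map _ (tuples xs k)) (tuples-length xs k))

  tuples-distinct : ∀ k → AllPairs (λ as bs → length as ≡ k × length bs ≡ k × ¬ Pointwise _≈_ as bs) (tuples elems k)
  tuples-distinct zero    = [] ∷ []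
  tuples-distinct (suc k) = concatMap-distinct _ distinct
    (All.tabulate λ _ → AllPairsₚ.map⁺ (AllPairs.map (λ { (l , l' , n) → cong suc l , cong suc l' , λ { (_ ∷ p) → n p } }) (tuples-distinct k)))
    (λ x≉y → Allₚ.map⁺ (All.map (λ l → Allₚ.map⁺ (All.map (λ l' → cong suc l , cong suc l' , λ { (e ∷ _) → x≉y e }) lengths)) lengths))
    where
    lengths : All (λ t → length t ≡ k) (tuples elems k)
    lengths = tuples-lengths elems k

  tuples-∷⁻ : ∀ {a ℓ'} {A : Set a} {P : List A → Set ℓ'} (xs : List A) k → All P (tuples xs (suc k)) → All (λ x → All (λ t → P (x ∷ t)) (tuples xs k)) xs
  tuples-∷⁻ xs k ps = All.map Allₚ.map⁻ (Allₚ.map⁻ (Allₚ.concat⁻ ps))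

  lincomb-cong : ∀ {as bs} → Pointwise _≈_ as bs → ∀ vs → lincomb 𝔽 as vs ≈V lincomb 𝔽 bs vs
  lincomb-cong []       vs       = V.refl
  lincomb-cong (e ∷ es) []       = V.refl
  lincomb-cong (e ∷ es) (v ∷ vs) with lincomb-cong es vs
  ... | a , b , d = +-cong (*-congʳ e) a , +-cong (*-congʳ e) b , +-cong (*-congʳ e) d

  scaleV : Carrier → V3 𝔽 → V3 𝔽
  scaleV s (a , b , d) = s * a , s * b , s * d

  lincomb-scale : ∀ s as vs → lincomb 𝔽 (map (s *_) as) vs ≈V scaleV s (lincomb 𝔽 as vs)
  lincomb-scale s []       vs       = sym (zeroʳ s) , sym (zeroʳ s) , sym (zeroʳ s)
  lincomb-scale s (a ∷ as) []       = sym (zeroʳ s) , sym (zeroʳ s) , sym (zeroʳ s)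
  lincomb-scale s (a ∷ as) (v ∷ vs) with lincomb-scale s as vs
  ... | e₁ , e₂ , e₃ = step e₁ , step e₂ , step e₃
    where
    step : ∀ {v x y} → x ≈ s * y → (s * a) * v + x ≈ s * (a * v + y)
    step {v} {x} {y} e = trans (+-congˡ e) (solve 4 (λ s a v y → (s :* a) :* v :+ s :* y := s :* (a :* v :+ y)) refl s a v y)

  lincomb-difference : ∀ as bs vs → length as ≡ length vs → length bs ≡ length vs → lincomb 𝔽 as vs ≈V lincomb 𝔽 bs vs →
    lincomb 𝔽 (zipWith _-_ as bs) vs ≈V 0V
  lincomb-difference as bs vs la lb (e₁ , e₂ , e₃) with general as bs vs la lb
    where
    general : ∀ as bs vs → length as ≡ length vs → length bs ≡ length vs → let (x , y , z) = lincomb 𝔽 as vs ; (x' , y' , z') = lincomb 𝔽 bs vs in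
      lincomb 𝔽 (zipWith _-_ as bs) vs ≈V (x - x' , y - y' , z - z')
    general []       []       []       la lb = sym (-‿inverseʳ 0#) , sym (-‿inverseʳ 0#) , sym (-‿inverseʳ 0#)
    general (a ∷ as) (b ∷ bs) (v ∷ vs) la lb with general as bs vs (ℕₚ.suc-injective la) (ℕₚ.suc-injective lb)
    ... | f₁ , f₂ , f₃ = step f₁ , step f₂ , step f₃
      where
      step : ∀ {v x y z} → x ≈ y - z → (a - b) * v + x ≈ (a * v + y) - (b * v + z)
      step {v} {x} {y} {z} e = trans (+-congˡ e) (solve 5 (λ a b v y z → (a :- b) :* v :+ (y :- z) := (a :* v :+ y) :- (b :* v :+ z)) refl a b v y z)
  ... | f₁ , f₂ , f₃ = trans f₁ (trans (+-congʳ e₁) (-‿inverseʳ _)) , trans f₂ (trans (+-congʳ e₂) (-‿inverseʳ _)) , trans f₃ (trans (+-congʳ e₃) (-‿inverseʳ _))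

  difference-zero : ∀ as bs → length as ≡ length bs → All (_≈ 0#) (zipWith _-_ as bs) → Pointwise _≈_ as bs
  difference-zero []       []       _ _        = []
  difference-zero (a ∷ as) (b ∷ bs) l (z ∷ zs) = x∙y⁻¹≈ε⇒x≈y _ _ z ∷ difference-zero as bs (ℕₚ.suc-injective l) zs

  lincomb-zeros : ∀ {X} as {vs} → All (Zeros X) vs → Zeros X (lincomb 𝔽 as vs)
  lincomb-zeros {X} as {vs} zs = All.tabulate λ {α} α∈ → go as (All.map (λ z → All.lookup z α∈) zs)
    where
    go : ∀ {α} as {vs} → All (λ v → dot 𝔽 α v ≈ 0#) vs → dot 𝔽 α (lincomb 𝔽 as vs) ≈ 0#
    go {a₁ , a₂ , a₃} []       _ = solve 3 (λ a b d → a :* :0 :+ b :* :0 :+ d :* :0 := :0) refl a₁ a₂ a₃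
    go {a₁ , a₂ , a₃} (s ∷ as) [] = solve 3 (λ a b d → a :* :0 :+ b :* :0 :+ d :* :0 := :0) refl a₁ a₂ a₃
    go {a₁ , a₂ , a₃} (s ∷ as) {(v₁ , v₂ , v₃) ∷ vs} (z ∷ zs) = trans
      (solve 10 (λ a b d s u v w x y t → a :* (s :* u :+ x) :+ b :* (s :* v :+ y) :+ d :* (s :* w :+ t)
        := s :* (a :* u :+ b :* v :+ d :* w) :+ (a :* x :+ b :* y :+ d :* t)) refl a₁ a₂ a₃ s v₁ v₂ v₃ _ _ _)
      (trans (+-cong (trans (*-congˡ z) (zeroʳ s)) (go {a₁ , a₂ , a₃} as zs)) (+-identityˡ _))

  Independent : List (V3 𝔽) → Set _
  Independent vs = ∀ as → length as ≡ length vs → lincomb 𝔽 as vs ≈V 0V → All (_≈ 0#) as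

  zeroVecB-complete : ∀ {v} → v ≈V 0V → zeroVecB 𝔽 v ≡ true
  zeroVecB-complete {v} (a , b , d) rewrite isZero-complete a | isZero-complete b | isZero-complete d = ≡.refl

  zeroVecB-sound : ∀ v → zeroVecB 𝔽 v ≡ true → v ≈V 0V
  zeroVecB-sound (a , b , d) e with isZero 𝔽 a in ea | isZero 𝔽 b in eb | isZero 𝔽 d in ed
  ... | true | true | true = isZero-sound ea , isZero-sound eb , isZero-sound ed

  independentB-sound : ∀ vs → independentB 𝔽 vs ≡ true → Independent vs
  independentB-sound vs e as la z with find (≡.subst (λ k → Any (Pointwise _≈_ as) (tuples elems k)) la (tuples-complete as))
  ... | bs , bs∈ , as≈bs = zeros as≈bs (allB-sound (isZero 𝔽) bs (implied (zeroVecB-complete (V.trans (V.sym {lincomb 𝔽 as vs} {lincomb 𝔽 bs vs} (lincomb-cong as≈bs vs)) z))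
                                (All.lookup (allB-sound _ (tuples elems (length vs)) e) bs∈)))
    where
    implied : ∀ {x y} → x ≡ true → (not x ∨ y) ≡ true → y ≡ true
    implied ≡.refl p = p
    zeros : ∀ {as bs} → Pointwise _≈_ as bs → All (λ b → isZero 𝔽 b ≡ true) bs → All (_≈ 0#) as
    zeros []       []       = []
    zeros (e ∷ es) (z ∷ zs) = trans e (isZero-sound z) ∷ zeros es zs

  -- In a nontrivial relation between w and the independent vs, the coefficient of w cannot be zero;
  -- dividing by it solves for w.
  spanned : ∀ w vs → Independent vs → independentB 𝔽 (w ∷ vs) ≡ false → w ∈V map (λ as → lincomb 𝔽 as vs) (tuples elems (length vs))
  spanned w@(w₁ , w₂ , w₃) vs ind e with find (allB-false _ (tuples elems (suc (length vs))) e)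
  ... | as , as∈ , fails = solveFor as (All.lookup (tuples-lengths elems (suc (length vs))) as∈) fails
    where
    solveFor : ∀ as → length as ≡ suc (length vs) → (not (zeroVecB 𝔽 (lincomb 𝔽 as (w ∷ vs))) ∨ allB (isZero 𝔽) as) ≡ false →
               w ∈V map (λ as → lincomb 𝔽 as vs) (tuples elems (length vs))
    solveFor (a ∷ as) la fails with zeroVecB 𝔽 (lincomb 𝔽 (a ∷ as) (w ∷ vs)) in ez | a ≟ 0#
    ... | true | yes a≈0 = ⊥-elim (true≢false (≡.trans (≡.sym (allB-complete (isZero 𝔽) (All.map isZero-complete zeros))) fails))
      where
      shorten : ∀ {v x} → a * v + x ≈ 0# → x ≈ 0#
      shorten p = trans (sym (trans (+-congʳ (trans (*-congʳ a≈0) (zeroˡ _))) (+-identityˡ _))) p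
      zeros : All (_≈ 0#) as
      zeros with zeroVecB-sound (lincomb 𝔽 (a ∷ as) (w ∷ vs)) ez
      ... | z₁ , z₂ , z₃ = ind as (ℕₚ.suc-injective la) (shorten z₁ , shorten z₂ , shorten z₃)
    ... | true | no a≉0 = Anyₚ.map⁺ (Any.map (λ {t} bs≈t → V.trans {w} {lincomb 𝔽 bs vs} {lincomb 𝔽 t vs} w≈ (lincomb-cong bs≈t vs))
        (≡.subst (λ k → Any (Pointwise _≈_ bs) (tuples elems k)) (≡.trans (Listₚ.length-map _ as) (ℕₚ.suc-injective la)) (tuples-complete bs)))
      where
      s = - proj₁ (inverse a a≉0)
      bs = map (s *_) as
      isolate : ∀ {v x y} → y ≈ s * x → a * v + x ≈ 0# → v ≈ y
      isolate {v} {x} {y} e p = trans (x∙y⁻¹≈ε⇒x≈y _ _ (*-cancelˡ-0 a≉0 (trans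
          (solve 4 (λ a i v x → a :* (v :- (:- i) :* x) := a :* v :+ (a :* i) :* x) refl a (proj₁ (inverse a a≉0)) v x)
          (trans (+-congˡ (trans (*-congʳ (proj₂ (inverse a a≉0))) (*-identityˡ x))) p)))) (sym e)
      w≈ : w ≈V lincomb 𝔽 bs vs
      w≈ with lincomb-scale s as vs | zeroVecB-sound (lincomb 𝔽 (a ∷ as) (w ∷ vs)) ez
      ... | e₁ , e₂ , e₃ | z₁ , z₂ , z₃ = isolate e₁ z₁ , isolate e₂ z₂ , isolate e₃ z₃

  span-distinct : ∀ vs → Independent vs → Distinct (map (λ as → lincomb 𝔽 as vs) (tuples elems (length vs)))
  span-distinct vs ind = AllPairsₚ.map⁺ (AllPairs.map (λ { {as} {bs} (la , lb , n) e →
    n (difference-zero as bs (≡.trans la (≡.sym lb)) (ind (zipWith _-_ as bs) (zip-length as bs la lb) (lincomb-difference as bs vs la lb e))) }) (tuples-distinct (length vs)))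
    where
    zip-length : ∀ as bs {n} → length as ≡ n → length bs ≡ n → length (zipWith _-_ as bs) ≡ n
    zip-length as bs {n} la lb = ≡.trans (Listₚ.length-zipWith _-_ as bs) (≡.trans (≡.cong₂ ℕ._⊓_ la lb) (ℕₚ.⊓-idem n))

  span-length : ∀ vs → length (map (λ as → lincomb 𝔽 as vs) (tuples elems (length vs))) ≡ q ℕ.^ length vs
  span-length vs = ≡.trans (Listₚ.length-map _ (tuples elems (length vs))) (≡.trans (tuples-length elems (length vs)) (cong (ℕ._^ length vs) size))

  count-lower : ∀ X vs → Independent vs → All (Zeros X) vs → q ℕ.^ length vs ≤ count X
  count-lower X vs ind zs = ≡.subst (_≤ count X) (span-length vs)
    (length-mono (span-distinct vs ind) (Allₚ.map⁺ (All.tabulate λ {as} _ → pointsOf-complete (lincomb-zeros as zs))))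

  count-upper : ∀ X vs → Independent vs → All (λ w → independentB 𝔽 (w ∷ vs) ≡ false) (pointsOf X) → count X ≤ q ℕ.^ length vs
  count-upper X vs ind maximal = ≡.subst (count X ≤_) (span-length vs)
    (length-mono (filterB-distinct (inX 𝔽 X) points-distinct) (All.map (λ {w} e → spanned w vs ind e) maximal))

  private
    witness : ∀ X d → hasIndependentB 𝔽 X d ≡ true → Σ (List (V3 𝔽)) λ vs →
      vs ∈ₗ tuples (pointsOf X) d × Independent vs × All (Zeros X) vs × length vs ≡ d
    witness X d e with find (anyB-true (independentB 𝔽) (tuples (pointsOf X) d) e)
    ... | vs , vs∈ , ind with All.lookup (tuples-All (filterB-All (inX 𝔽 X) (points 𝔽)) d) vs∈
    ...   | zs , len = vs , vs∈ , independentB-sound vs ind , All.map (inX-sound X) zs , len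

    exact : ∀ X d → hasIndependentB 𝔽 X d ≡ true → hasIndependentB 𝔽 X (suc d) ≡ false → count X ≡ q ℕ.^ d
    exact X d e f with witness X d e
    ... | vs , vs∈ , ind , zs , ≡.refl = ℕₚ.≤-antisym
          (count-upper X vs ind (All.map (λ a → All.lookup a vs∈) (tuples-∷⁻ (pointsOf X) d (anyB-false (independentB 𝔽) (tuples (pointsOf X) (suc d)) f))))
          (count-lower X vs ind zs)

    -- No search for four independent vectors is made, so in dimension 3 the upper bound comes from
    -- the q³ points of V.
    top : ∀ X → hasIndependentB 𝔽 X 3 ≡ true → count X ≡ q ℕ.^ 3
    top X e with witness X 3 e
    ... | vs , vs∈ , ind , zs , len = ℕₚ.≤-antisym (≡.subst (count X ≤_) points-length (filterB-length (inX 𝔽 X) (points 𝔽)))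
          (≡.subst (λ d → q ℕ.^ d ≤ count X) len (count-lower X vs ind zs))

    hasIndependentB-0 : ∀ X → hasIndependentB 𝔽 X 0 ≡ true
    hasIndependentB-0 X rewrite zeroVecB-complete {0V} V.refl = ≡.refl

  -- A longest independent tuple in X spans a set inside X. By maximality every point of X lies in
  -- that span, and by independence its q^d linear combinations are distinct.
  count-dim : ∀ X → count X ≡ q ℕ.^ dim 𝔽 X
  count-dim X with hasIndependentB 𝔽 X 3 in e₃
  ... | true = top X e₃
  ... | false with hasIndependentB 𝔽 X 2 in e₂
  ...   | true = exact X 2 e₂ e₃
  ...   | false with hasIndependentB 𝔽 X 1 in e₁
  ...     | true = exact X 1 e₁ e₂
  ...     | false = exact X 0 (hasIndependentB-0 X) e₁

  dim≤3 : ∀ X → dim 𝔽 X ≤ 3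
  dim≤3 X with hasIndependentB 𝔽 X 3
  ... | true = ℕₚ.≤-refl
  ... | false with hasIndependentB 𝔽 X 2
  ...   | true = s≤s (s≤s z≤n)
  ...   | false with hasIndependentB 𝔽 X 1
  ...     | true = s≤s z≤n
  ...     | false = z≤n

  q≢0 : q ≢ 0
  q≢0 e with FieldPolynomials.q≡2+ 𝔽
  ... | n , e' with () ← ≡.trans (≡.sym e) e'

  -- Strict inclusion means strictly fewer points, and the numbers of points are powers of q.
  dim-strict : ∀ X Y → ltB 𝔽 Y X ≡ true → dim 𝔽 X < dim 𝔽 Y
  dim-strict X Y e with subsetB 𝔽 X Y in X⊆Y | subsetB 𝔽 Y X in Y⊆X
  ... | true | false with dim 𝔽 X ℕ.<? dim 𝔽 Y
  ...   | yes lt = lt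
  ...   | no ≮   = ⊥-elim (ℕₚ.<⇒≱ (≡.subst₂ _<_ (count-dim X) (count-dim Y) smaller) (ℕₚ.^-monoʳ-≤ q {{ℕ.≢-nonZero q≢0}} (ℕₚ.≮⇒≥ ≮)))
    where
    smaller : count X < count Y
    smaller = filterB-strict (inX 𝔽 X) (inX 𝔽 Y)
      (All.tabulate λ _ p → inX-complete (subsetB-sound X Y X⊆Y (inX-sound X p)))
      (filterB-Any⁻ (inX 𝔽 Y) (points 𝔽) (allB-false (inX 𝔽 X) (pointsOf Y) Y⊆X))

-- The theorem of Crapo and Rota: χ(A, q) counts the points outside A

module CrapoRota {c ℓ} {q : ℕ} (𝔽 : FiniteField c ℓ q) where
  open FiniteField 𝔽
  open BooleanLists
  open SubspaceCounting 𝔽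
  open PolynomialEvaluation 𝔽 using (pivot)
  open LinearForms 𝔽 using (dualVector)

  module _ (A : List (V3 𝔽)) where

    -- Each step to some Y < X raises the dimension, which never exceeds 3. A descent from X thus
    -- has at most 4 - dim X levels, and this much fuel is never exhausted.
    fuel-irrelevant : ∀ k X → 4 ≤ k ℕ.+ dim 𝔽 X → mobiusF 𝔽 A k X ≡ mobiusF 𝔽 A (suc k) X
    fuel-irrelevant zero    X le = ⊥-elim (ℕₚ.<⇒≱ (s≤s (dim≤3 X)) le)
    fuel-irrelevant (suc k) X le with isV 𝔽 X
    ... | true  = ≡.refl
    ... | false = cong ℤ.-_ (∑-cong (All.map (λ {Y} Y<X → fuel-irrelevant k Y
        (ℕₚ.≤-trans le (≡.subst (_≤ k ℕ.+ dim 𝔽 Y) (ℕₚ.+-suc k (dim 𝔽 X)) (ℕₚ.+-monoʳ-≤ k (dim-strict X Y Y<X)))))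
      (filterB-All (λ Y → ltB 𝔽 Y X) (flats 𝔽 A))))

    μ : List (V3 𝔽) → ℤ
    μ = mobius 𝔽 A

    below : List (V3 𝔽) → List (List (V3 𝔽))
    below X = filterB (λ Y → ltB 𝔽 Y X) (flats 𝔽 A)

    -- The defining property of μ freed from fuel: the sum of μ over all Y ≤ X is 1 for X = V and 0
    -- otherwise.
    mobius-recursion : ∀ X → μ X ℤ.+ ∑ μ (below X) ≡ (if isV 𝔽 X then + 1 else + 0)
    mobius-recursion X with isV 𝔽 X in eV
    -- Unfolding `mobius` leaves fuel 3 for the elements below X. That suffices, since a space
    -- strictly larger than X has dimension at least 1.
    ... | false = ≡.trans (cong (λ s → ℤ.- s ℤ.+ ∑ μ (below X)) (∑-cong (All.map (λ {Y} Y<X → fuel-irrelevant 3 Y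
            (ℕₚ.+-monoʳ-≤ 3 (ℕₚ.≤-trans (s≤s z≤n) (dim-strict X Y Y<X)))) (filterB-All (λ Y → ltB 𝔽 Y X) (flats 𝔽 A)))))
          (ℤₚ.+-inverseˡ (∑ μ (below X)))
    ... | true  = cong (λ s → (+ 1) ℤ.+ s) (cong (∑ μ) (nothing-below (flats 𝔽 A)))
      where
      nothing-below : ∀ Ys → filterB (λ Y → ltB 𝔽 Y X) Ys ≡ []
      nothing-below []       = ≡.refl
      nothing-below (Y ∷ Ys) rewrite subsetB-complete Y X (λ _ → subsetB-sound [] X eV []) with subsetB 𝔽 X Y
      ... | true  = nothing-below Ys
      ... | false = nothing-below Ys

    maskAt : V3 𝔽 → List Bool
    maskAt v = map (λ α → isZero 𝔽 (dot 𝔽 α v)) A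

    -- The hyperplanes of A through v, hence the smallest member of L(A) that contains v.
    flatAt : V3 𝔽 → List (V3 𝔽)
    flatAt v = select (maskAt v) A

    -- The comparison inside `closedMask` is a local function. It is represented here by an
    -- arbitrary `g` with the right values at `true` and `false`, which hold by computation at the
    -- point of use.
    zip-sound : ∀ {p : V3 𝔽 → Bool} (g : Bool × V3 𝔽 → Bool) → (∀ α → g (true , α) ≡ p α) → (∀ α → g (false , α) ≡ not (p α)) →
                ∀ m B → length m ≡ length B → allB g (zip m B) ≡ true → m ≡ map p B
    zip-sound g t f []          []      _ _ = ≡.refl
    zip-sound {p} g t f (true ∷ m)  (α ∷ B) l e with g (true , α) | t α
    ... | true | pα = ≡.cong₂ _∷_ pα (zip-sound g t f m B (ℕₚ.suc-injective l) e)
    zip-sound {p} g t f (false ∷ m) (α ∷ B) l e with p α | g (false , α) | f α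
    ... | false | true | _  = cong (false ∷_) (zip-sound g t f m B (ℕₚ.suc-injective l) e)
    ... | true  | true | ()

    zip-complete : ∀ {p : V3 𝔽 → Bool} (g : Bool × V3 𝔽 → Bool) → (∀ α → g (true , α) ≡ p α) → (∀ α → g (false , α) ≡ not (p α)) →
                   ∀ m B → m ≡ map p B → allB g (zip m B) ≡ true
    zip-complete g t f _ [] ≡.refl = ≡.refl
    zip-complete {p} g t f _ (α ∷ B) ≡.refl with p α in pα
    ... | true  rewrite t α | pα = zip-complete g t f _ B ≡.refl
    ... | false rewrite f α | pα = zip-complete g t f _ B ≡.refl

    closed-sound : ∀ m → length m ≡ length A → closedMask 𝔽 A m ≡ true → m ≡ map (containedInB 𝔽 (select m A)) A
    closed-sound m l e = zip-sound _ (λ _ → ≡.refl) (λ _ → ≡.refl) m A l e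

    closed-complete : ∀ m → m ≡ map (containedInB 𝔽 (select m A)) A → closedMask 𝔽 A m ≡ true
    closed-complete m e = zip-complete _ (λ _ → ≡.refl) (λ _ → ≡.refl) m A e

    -- If v lies in the space of the mask m, every selected hyperplane passes through v. The space
    -- cut out by all hyperplanes through v is therefore contained in that of m.
    select-zeros : ∀ {v w} B m → Zeros (select m B) v → Zeros (select (map (λ α → isZero 𝔽 (dot 𝔽 α v)) B) B) w → Zeros (select m B) w
    select-zeros B       []          _  _  = []
    select-zeros []      (true ∷ m)  _  _  = []
    select-zeros []      (false ∷ m) _  _  = []
    select-zeros {v} (α ∷ B) (true ∷ m)  (z ∷ zs) ws with isZero 𝔽 (dot 𝔽 α v) | isZero-complete z
    select-zeros (α ∷ B) (true ∷ m)  (z ∷ zs) (w ∷ ws) | true | _ = w ∷ select-zeros B m zs ws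
    select-zeros {v} (α ∷ B) (false ∷ m) zs ws with isZero 𝔽 (dot 𝔽 α v)
    select-zeros (α ∷ B) (false ∷ m) zs (w ∷ ws) | true  = select-zeros B m zs ws
    select-zeros (α ∷ B) (false ∷ m) zs ws       | false = select-zeros B m zs ws

    flatAt-zeros : ∀ v B → Zeros (select (map (λ α → isZero 𝔽 (dot 𝔽 α v)) B) B) v
    flatAt-zeros v []      = []
    flatAt-zeros v (α ∷ B) with isZero 𝔽 (dot 𝔽 α v) in e
    ... | true  = isZero-sound e ∷ flatAt-zeros v B
    ... | false = flatAt-zeros v B

    flatAt-member : ∀ {v w α} B → α ∈ₗ B → dot 𝔽 α v ≈ 0# → Zeros (select (map (λ α → isZero 𝔽 (dot 𝔽 α v)) B) B) w → dot 𝔽 α w ≈ 0#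
    flatAt-member {v} (β ∷ B) (here ≡.refl) z ws with isZero 𝔽 (dot 𝔽 β v) | isZero-complete z
    flatAt-member (β ∷ B) (here ≡.refl) z (w ∷ ws) | true | _ = w
    flatAt-member {v} (β ∷ B) (there α∈) z ws with isZero 𝔽 (dot 𝔽 β v)
    flatAt-member (β ∷ B) (there α∈) z (w ∷ ws) | true  = flatAt-member B α∈ z ws
    flatAt-member (β ∷ B) (there α∈) z ws       | false = flatAt-member B α∈ z ws

    maskAt-contained : ∀ v → maskAt v ≡ map (containedInB 𝔽 (flatAt v)) A
    maskAt-contained v = Listₚ.map-cong-local (All.tabulate λ {α} α∈ → bool-ext
      (λ e → subsetB-complete (flatAt v) (α ∷ []) (λ z → flatAt-member A α∈ (isZero-sound e) z ∷ []))
      (λ e → isZero-complete (All.head (subsetB-sound (flatAt v) (α ∷ []) e (flatAt-zeros v A)))))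

    contained-cong : ∀ {X Y} → subsetB 𝔽 X Y ≡ true → subsetB 𝔽 Y X ≡ true → ∀ α → containedInB 𝔽 X α ≡ containedInB 𝔽 Y α
    contained-cong {X} {Y} xy yx α = bool-ext
      (λ e → subsetB-complete Y (α ∷ []) (λ z → subsetB-sound X (α ∷ []) e (subsetB-sound Y X yx z)))
      (λ e → subsetB-complete X (α ∷ []) (λ z → subsetB-sound Y (α ∷ []) e (subsetB-sound X Y xy z)))

    private
      Σ-flats : ∀ f → ∑ f (flats 𝔽 A) ≡ ∑ (λ m → if closedMask 𝔽 A m then f (select m A) else + 0) (masks (length A))
      Σ-flats f = ≡.trans (∑-map f (λ m → select m A) (filterB (closedMask 𝔽 A) (masks (length A))))
        (∑-filterB (λ m → f (select m A)) (closedMask 𝔽 A) (masks (length A)))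

      -- A flat containing v either has the mask of `flatAt v` or is a strictly larger space, thus
      -- strictly smaller in L(A). Closedness excludes a third case: flats with equal spaces have
      -- equal masks.
      same-or-below : ∀ v m → length m ≡ length A →
        (if closedMask 𝔽 A m then (if inX 𝔽 (select m A) v then μ (select m A) else + 0) else + 0) ≡
        (if sameMask m (maskAt v) then μ (flatAt v) else + 0) ℤ.+
        (if closedMask 𝔽 A m then (if ltB 𝔽 (select m A) (flatAt v) then μ (select m A) else + 0) else + 0)
      same-or-below v m l with sameMask m (maskAt v) in same
      ... | true with sameMask-sound m (maskAt v) same
      ...   | ≡.refl rewrite closed-complete (maskAt v) (maskAt-contained v)
                           | inX-complete (flatAt-zeros v A)
                           | subsetB-complete (flatAt v) (flatAt v) (λ z → z) = ≡.sym (ℤₚ.+-identityʳ _)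
      same-or-below v m l | false with closedMask 𝔽 A m in closed
      ... | false = ≡.refl
      ... | true  = ≡.trans (cong (λ b → if b then μ (select m A) else + 0) (bool-ext to from)) (≡.sym (ℤₚ.+-identityˡ _))
        where
        X Xᵥ : List (V3 𝔽)
        X = select m A
        Xᵥ = flatAt v
        to : inX 𝔽 X v ≡ true → ltB 𝔽 X Xᵥ ≡ true
        to e with subsetB 𝔽 Xᵥ X in below | subsetB-complete Xᵥ X (select-zeros A m (inX-sound X e))
        ... | true | _ with subsetB 𝔽 X Xᵥ in above
        ...   | false = ≡.refl
        ...   | true  = ⊥-elim (true≢false (≡.trans (≡.sym (≡.trans (cong (λ n → sameMask n (maskAt v)) m≡) (sameMask-refl (maskAt v)))) same))
          where
          m≡ : m ≡ maskAt v
          m≡ = ≡.trans (closed-sound m l closed) (≡.trans (Listₚ.map-cong (contained-cong {X} {Xᵥ} above below) A) (≡.sym (maskAt-contained v)))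
        from : ltB 𝔽 X Xᵥ ≡ true → inX 𝔽 X v ≡ true
        from e with subsetB 𝔽 Xᵥ X in below
        ... | true = inX-complete (subsetB-sound Xᵥ X below (flatAt-zeros v A))

    -- The flats containing v are exactly those below or equal to `flatAt v` in L(A), so the Möbius
    -- recursion evaluates the sum.
    mobius-at-point : ∀ v → ∑ (λ X → if inX 𝔽 X v then μ X else + 0) (flats 𝔽 A) ≡ (if isV 𝔽 (flatAt v) then + 1 else + 0)
    mobius-at-point v = begin
      ∑ (λ X → if inX 𝔽 X v then μ X else + 0) (flats 𝔽 A)
        ≡⟨ Σ-flats (λ X → if inX 𝔽 X v then μ X else + 0) ⟩
      ∑ (λ m → if closedMask 𝔽 A m then (if inX 𝔽 (select m A) v then μ (select m A) else + 0) else + 0) (masks (length A))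
        ≡⟨ ∑-cong (All.map (λ {m} l → same-or-below v m l) (masks-length (length A))) ⟩
      ∑ (λ m → (if sameMask m (maskAt v) then μ (flatAt v) else + 0) ℤ.+ g m) (masks (length A))
        ≡⟨ ∑-+ (λ m → if sameMask m (maskAt v) then μ (flatAt v) else + 0) g (masks (length A)) ⟩
      ∑ (λ m → if sameMask m (maskAt v) then μ (flatAt v) else + 0) (masks (length A)) ℤ.+ ∑ g (masks (length A))
        ≡⟨ ≡.cong₂ ℤ._+_
             (≡.trans (cong (λ n → ∑ (λ m → if sameMask m (maskAt v) then μ (flatAt v) else + 0) (masks n)) (≡.sym (Listₚ.length-map _ A)))
                      (∑-masks (μ (flatAt v)) (maskAt v)))
             (≡.sym (≡.trans (∑-filterB μ (λ Y → ltB 𝔽 Y (flatAt v)) (flats 𝔽 A)) (Σ-flats (λ Y → if ltB 𝔽 Y (flatAt v) then μ Y else + 0)))) ⟩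
      μ (flatAt v) ℤ.+ ∑ μ (below (flatAt v))
        ≡⟨ mobius-recursion (flatAt v) ⟩
      (if isV 𝔽 (flatAt v) then + 1 else + 0) ∎
      where
      open ≡.≡-Reasoning
      g : List Bool → ℤ
      g m = if closedMask 𝔽 A m then (if ltB 𝔽 (select m A) (flatAt v) then μ (select m A) else + 0) else + 0

    -- Each power q^dim X is replaced by the number of points of X. After the two sums are
    -- exchanged, a point contributes 1 if `flatAt v` is V and 0 otherwise.
    chi-counts : chi 𝔽 A q ≡ + length (filterB (λ v → isV 𝔽 (flatAt v)) (points 𝔽))
    chi-counts = begin
      ∑ (λ X → μ X ℤ.* + (q ℕ.^ dim 𝔽 X)) (flats 𝔽 A)
        ≡⟨ ∑-cong (All.tabulate {xs = flats 𝔽 A} λ {X} _ → ≡.trans (cong (λ n → μ X ℤ.* + n) (≡.sym (count-dim X)))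
             (≡.sym (∑-indicator (μ X) (inX 𝔽 X) (points 𝔽)))) ⟩
      ∑ (λ X → ∑ (λ v → if inX 𝔽 X v then μ X else + 0) (points 𝔽)) (flats 𝔽 A)
        ≡⟨ ∑-swap (λ X v → if inX 𝔽 X v then μ X else + 0) (flats 𝔽 A) (points 𝔽) ⟩
      ∑ (λ v → ∑ (λ X → if inX 𝔽 X v then μ X else + 0) (flats 𝔽 A)) (points 𝔽)
        ≡⟨ ∑-cong (All.tabulate {xs = points 𝔽} λ {v} _ → mobius-at-point v) ⟩
      ∑ (λ v → if isV 𝔽 (flatAt v) then + 1 else + 0) (points 𝔽)
        ≡⟨ ∑-indicator (+ 1) (λ v → isV 𝔽 (flatAt v)) (points 𝔽) ⟩
      (+ 1) ℤ.* + length (filterB (λ v → isV 𝔽 (flatAt v)) (points 𝔽))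
        ≡⟨ ℤₚ.*-identityˡ _ ⟩
      + length (filterB (λ v → isV 𝔽 (flatAt v)) (points 𝔽)) ∎
      where open ≡.≡-Reasoning

    chi≡0⇒covered : chi 𝔽 A q ≡ + 0 → ∀ v → Any (λ α → dot 𝔽 α v ≈ 0#) A
    chi≡0⇒covered χ≡0 v with Any.any? (λ α → dot 𝔽 α v ≟ 0#) A
    ... | yes covered = covered
    -- The list of points meets v only up to equality in the field, so the count is contradicted at
    -- a listed representative `u`; it lies on no hyperplane either, which makes its flat empty.
    ... | no uncovered with find (points-complete v)
    ...   | u , u∈ , v≈u = ⊥-elim (All.lookup (filterB-All⁻ {P = λ _ → ⊥} isV-at (points 𝔽) (empty (filterB isV-at (points 𝔽)) none)) u∈
                             (≡.subst (λ X → isV 𝔽 X ≡ true) (≡.sym (flat-empty A (Allₚ.¬Any⇒All¬ A uncovered))) (subsetB-complete [] [] (λ z → z))))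
      where
      isV-at : V3 𝔽 → Bool
      isV-at w = isV 𝔽 (flatAt w)
      none : length (filterB isV-at (points 𝔽)) ≡ 0
      none = ℤₚ.+-injective (≡.trans (≡.sym chi-counts) χ≡0)
      empty : ∀ (xs : List (V3 𝔽)) → length xs ≡ 0 → All (λ _ → ⊥) xs
      empty [] _ = []
      flat-empty : ∀ B → All (λ α → ¬ (dot 𝔽 α v ≈ 0#)) B → select (map (λ α → isZero 𝔽 (dot 𝔽 α u)) B) B ≡ []
      flat-empty []      []       = ≡.refl
      flat-empty (α ∷ B) (n ∷ ns) with dot 𝔽 α u ≟ 0#
      ... | yes z = ⊥-elim (n (trans (dot-cong α v≈u) z))
      ... | no _  = flat-empty B ns

    covered⇒chi≡0 : All (NonzeroForm 𝔽) A → (∀ v → Any (λ α → dot 𝔽 α v ≈ 0#) A) → chi 𝔽 A q ≡ + 0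
    covered⇒chi≡0 nonzero covered = ≡.trans chi-counts (cong (λ vs → + length vs) (none-left (points 𝔽)))
      where
      -- A hyperplane through v belongs to `flatAt v`. If that flat were all of V, the form α would
      -- vanish also at the vector `w` where it takes the value 1.
      proper : ∀ v → isV 𝔽 (flatAt v) ≢ true
      proper v e with find (covered v)
      ... | α , α∈ , αv≈0 with dualVector (pivot {α} (All.lookup nonzero α∈))
      ...   | w , αw≈1 = 1≉0 (trans (sym αw≈1) (flatAt-member A α∈ αv≈0 (subsetB-sound [] (flatAt v) e [])))
      none-left : ∀ vs → filterB (λ v → isV 𝔽 (flatAt v)) vs ≡ []
      none-left []       = ≡.refl
      none-left (v ∷ vs) with isV 𝔽 (flatAt v) in e
      ... | true  = ⊥-elim (proper v e)
      ... | false = none-left vs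

-- Both directions, with χ(A, q) = 0 read as covering

module _ {c ℓ} {q : ℕ} (𝔽 : FiniteField c ℓ q) (A : List (V3 𝔽)) (arrangement : IsArrangement 𝔽 A) where
  open FiniteField 𝔽
  open CrapoRota 𝔽 using (chi≡0⇒covered; covered⇒chi≡0)

  chi≡0⇒free : chi 𝔽 A q ≡ + 0 → Σ ℕ λ e → (1 ℕ.+ q ℕ.+ e ≡ length A) × FreeWithExponents 𝔽 A 1 q e
  chi≡0⇒free χ≡0 = CoveringArrangements.covering⇒free 𝔽 A arrangement (chi≡0⇒covered A χ≡0)

  free⇒chi≡0 : 2 ℕ.* q ≤ length A → Free 𝔽 A → chi 𝔽 A q ≡ + 0
  free⇒chi≡0 size (k , θ , basis) = covered⇒chi≡0 A (proj₁ arrangement) covered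
    where
    covered : ∀ v → Any (λ α → dot 𝔽 α v ≈ 0#) A
    covered v with Any.any? (λ α → dot 𝔽 α v ≟ 0#) A
    ... | yes αv≈0 = αv≈0
    ... | no none  = ⊥-elim (UncoveredPoint.uncovered-not-free 𝔽 A arrangement v uncovered k θ
            (Derivations.fromIsBasis 𝔽 {A} {k} {θ} basis) _ (proj₂ (FieldPolynomials.q≡2+ 𝔽)) size)
      where
      uncovered : All (λ α → ¬ (dot 𝔽 α v ≈ 0#)) A
      uncovered = Allₚ.¬Any⇒All¬ A none

open import Data.Nat using (_+_; _*_)

mainTheorem5 : ∀ {c ℓ} (q : ℕ) → IsPrimePower q → (𝔽 : FiniteField c ℓ q)
    → (A : List (V3 𝔽)) → IsArrangement 𝔽 A
    → (chi 𝔽 A q ≡ + 0 → Σ ℕ λ e → (1 + q + e ≡ length A) × FreeWithExponents 𝔽 A 1 q e)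
    × (2 * q ≤ length A → Free 𝔽 A → chi 𝔽 A q ≡ + 0)
mainTheorem5 q _ 𝔽 A arrangement = chi≡0⇒free 𝔽 A arrangement , free⇒chi≡0 𝔽 A arrangement
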